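{- For all integers $k\geq 5$ and $\ell\geq 3$, \[\mathrm{forb}(n,C^{(k)}_\ell)= 2^{(1+o(1)) \lfloor \frac{\ell-1}{2}\rfloor \binom{n}{k-1}}\quad\text{as } n\to\infty.\]
   Context: A $k$-graph is a pair $(V,E)$ where $E$ is a family of $k$-element subsets of $V$. For a $k$-graph $\mathcal{H}$, $\mathrm{forb}(n,\mathcal{H})$ is the number of labelled $k$-graphs on vertex set $[n]=\{1,\dots,n\}$ that contain no copy of $\mathcal{H}$ as a subgraph. The $k$-uniform linear cycle $C^{(k)}_\ell$ is the $k$-graph obtained from a graph cycle of length $\ell$ by enlarging each edge into a $k$-set by adding $k-2$ new vertices, each new vertex belonging only to that edge (distinct edges receive disjoint sets of new vertices). -}

module Defs where

open import Data.Nat using (ℕ; zero; suc; _+_; _*_; _∸_; _^_; _≤_; _<_)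
open import Data.Nat.DivMod using (_%_; m%n<n)
open import Data.Fin using (Fin; toℕ; fromℕ<)
open import Data.Fin.Subset using (Subset; inside; outside; _∈_; ∣_∣)
open import Data.Vec using (_∷_; [])
open import Data.List using (List; []; _∷_; [_]; _++_; map; filter; length; lookup)
open import Data.List.Relation.Unary.Unique.Propositional using (Unique)
import Data.List.Membership.Propositional as LM
open import Data.Product using (Σ; ∃; _×_; _,_; Σ-syntax; ∃-syntax)
open import Data.Sum using (_⊎_; inj₁; inj₂)
open import Function using (_⇔_)
open import Function.Definitions using (Injective)
open import Relation.Binary.PropositionalEquality using (_≡_)
open import Relation.Nullary using (¬_)
open import Data.Nat.Properties using (_≟_)

allSubsets : (n : ℕ) → List (Subset n)
allSubsets zero = [ [] ]
allSubsets (suc n) = map (outside ∷_) (allSubsets n) ++ map (inside ∷_) (allSubsets n)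

kSets : (n k : ℕ) → List (Subset n)
kSets n k = filter (λ S → ∣ S ∣ ≟ k) (allSubsets n)

-- A labelled k-graph on vertex set [n]: a choice, for each k-subset of [n],
-- of whether it is an edge.
KGraph : (n k : ℕ) → Set
KGraph n k = Subset (length (kSets n k))

IsEdge : ∀ n k → KGraph n k → Subset n → Set
IsEdge n k G S = Σ[ e ∈ Fin (length (kSets n k)) ] (e ∈ G × lookup (kSets n k) e ≡ S)

next : ∀ {ℓ} → Fin ℓ → Fin ℓ
next {suc m} i = fromℕ< (m%n<n (suc (toℕ i)) (suc m))

-- The k-uniform linear cycle C^{(k)}_ℓ:
-- vertices: cycle vertices inj₁ i (i : Fin ℓ) and, for each edge i,
-- k-2 private vertices inj₂ (i , j) (j : Fin (k ∸ 2)).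
-- Edge i consists of inj₁ i, inj₁ (next i) and all inj₂ (i , j).
CycV : (k ℓ : ℕ) → Set
CycV k ℓ = Fin ℓ ⊎ (Fin ℓ × Fin (k ∸ 2))

CycMem : ∀ {k ℓ} → Fin ℓ → CycV k ℓ → Set
CycMem i (inj₁ j) = j ≡ i ⊎ j ≡ next i
CycMem i (inj₂ (i′ , _)) = i′ ≡ i

ContainsCycle : ∀ n k ℓ → KGraph n k → Set
ContainsCycle n k ℓ G =
  Σ[ φ ∈ (CycV k ℓ → Fin n) ] (Injective _≡_ _≡_ φ ×
    ((i : Fin ℓ) → Σ[ S ∈ Subset n ] (IsEdge n k G S ×
       ((x : Fin n) → (x ∈ S) ⇔ (∃[ v ] (CycMem {k} i v × φ v ≡ x))))))

IsForb : (k ℓ n c : ℕ) → Set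
IsForb k ℓ n c = Σ[ L ∈ List (KGraph n k) ]
  (Unique L × ((G : KGraph n k) → (G LM.∈ L) ⇔ (¬ ContainsCycle n k ℓ G)) × length L ≡ c)

{-# OPTIONS --safe #-}

-- Write t = ⌊(ℓ-1)/2⌋.  Lower bound: a family of k-sets meeting a fixed t-set contains no C_ℓ, since every vertex
-- lies on at most two edges of the cycle.
--
-- Upper bound.  Call a set robust in G if it lies in an edge of G avoiding, outside the set, any boundedly many
-- prescribed vertices; a cycle all of whose consecutive pairs lie in robust sets extends greedily to a linear cycle.
-- By a delta-system argument in the style of Füredi (this uses k ≥ 5), all but O(n^(k-2)) edges of a C_ℓ-free G have
-- a center c such that all triples {c, y, y′} in the edge are robust.  The robust triples of G can be recorded with
-- n³ = o(n^(k-1)) bits.  They determine the k-graph X of all k-sets having such a center, which contains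
-- all but O(n^(k-2)) edges of G and, by greedy extension into G, is itself C_ℓ-free.  So the number of G is at most
-- 2^(n³) · 2^|X| · 2^(O(n^(k-2) log n)), and it remains to bound |X| by t·C(n, k-1) + O(n^(k-2)).
--
-- For the latter, delete edges as long as some (k-1)-set f has between 1 and t centers.  If edges with robust centers
-- remained, then every such f would have t+1 centers, and a walk y₀ c₁ y₁ c₂ y₂ … through sets f₁, f₂, …, all containing y₀,
-- where cᵢ and cᵢ₊₁ are centers of fᵢ ∋ yᵢ, would close up to a cycle of length 2t+2, or of length 2t+1 when the last
-- center is used as a private vertex.

module Submission where

open import Defs
open import Data.Nat using (ℕ; zero; suc; _+_; _*_; _∸_; _^_; _≤_; _<_; _/_; z≤n; s≤s; s≤s⁻¹; NonZero; _≤?_; _<?_; >-nonZero)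
open import Data.Nat.Properties
open import Data.Nat.DivMod using (_%_; m<n⇒m%n≡m; n%n≡0; m≡m%n+[m/n]*n; m%n<n; m*n/n≡m; m/n*n≤m; /-monoˡ-≤; m≥n⇒m/n>0)
open import Data.Nat.Combinatorics using (_C_; nCk+nC[k+1]≡[n+1]C[k+1]; nC1≡n)
open import Data.Nat.Combinatorics.Specification using (k>n⇒nCk≡0)
open import Data.Nat.Induction using (<-wellFounded)
open import Data.Nat.Tactic.RingSolver using (solve-∀)
open import Induction.WellFounded using (Acc; acc)
open import Data.Bool using (Bool; true; false)
open import Data.Fin using (Fin; zero; suc; toℕ; cast)
import Data.Fin.Properties as Fin
open import Data.Fin.Subset using (Subset; inside; outside; _∈_; _∉_; _⊆_; ∣_∣; _∩_; _∪_; ⁅_⁆; ∁; ⊤) renaming (⊥ to ∅)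
open import Data.Fin.Subset.Properties using (_∈?_; ⊆-antisym; ∈⊤; x∈⁅x⁆; x∈⁅y⁆⇒x≡y; x∈p∩q⁺; x∈p∩q⁻; x∈p∪q⁺; x∈p∪q⁻; ∣⊥∣≡0; x∈∁p⇒x∉p; x∉p⇒x∈∁p)
open import Data.Vec using ([]; _∷_; here; there; tabulate)
open import Data.Vec.Properties using (≡-dec)
import Data.Vec.Properties as Vec
import Data.Bool.Properties as Bool
open import Data.List using (List; []; _∷_; [_]; _++_; map; filter; length; lookup; take; allFin; concatMap; upTo; cartesianProductWith; cartesianProduct; replicate)
open import Data.Nat.ListAction using (sum)
import Data.List.Properties as List
open import Data.List.Properties using (length-map; length-++; length-tabulate; filter-accept; filter-notAll; filter-reject; filter-++; length-replicate; length-upTo)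
open import Data.List.Relation.Unary.All using (All; []; _∷_)
import Data.List.Relation.Unary.All as All
import Data.List.Relation.Unary.All.Properties as All
open import Data.List.Relation.Unary.Any using (Any; here; there; any?; index)
open import Data.List.Relation.Unary.Any.Properties using (lookup-index)
open import Data.List.Relation.Unary.AllPairs using (AllPairs; []; _∷_)
import Data.List.Relation.Unary.AllPairs.Properties as AllPairs
open import Data.List.Relation.Unary.Linked using (Linked; []; [-]; _∷_; tail)
open import Data.List.Relation.Unary.Unique.Propositional using (Unique)
import Data.List.Relation.Unary.Unique.Propositional.Properties as Unique
open import Data.List.Membership.Propositional using (find; lose) renaming (_∈_ to _∈ˡ_; _∉_ to _∉ˡ_)
open import Data.List.Membership.Propositional.Properties using (∈-++⁺ˡ; ∈-++⁺ʳ; ∈-++⁻; ∈-map⁺; ∈-map⁻; ∈-filter⁺; ∈-filter⁻; ∈-allFin; ∈-cartesianProductWith⁺; ∈-cartesianProductWith⁻; ∈-cartesianProduct⁺; ∈-∃++; ∈-upTo⁺; ∈-lookup; ∈-concatMap⁺; ∈-concatMap⁻)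
open import Data.Product using (∃; _×_; _,_; proj₁; proj₂; Σ-syntax; ∃-syntax)
open import Data.Product.Properties using () renaming (≡-dec to ×-≡-dec)
open import Data.Sum using (_⊎_; inj₁; inj₂; [_,_]′)
open import Data.Empty using (⊥)
open import Function using (_∘_; id; _⇔_; Equivalence; mk⇔; case_of_)
open import Function.Definitions using (Injective)
open import Relation.Binary.Definitions using (DecidableEquality)
open import Relation.Binary.PropositionalEquality using (_≡_; _≢_; refl; sym; trans; cong; cong₂; subst; subst₂; ≢-sym; module ≡-Reasoning)
open import Relation.Nullary using (¬_; Dec; yes; no; ¬?; contradiction; does)
open import Relation.Nullary.Decidable using (_×-dec_; _⊎-dec_; _→-dec_; decidable-stable; dec-true; toSum)
open import Relation.Unary using (Decidable)

-- An edge bound of about t·C(n, k-1) alone would allow each edge to be chosen in roughly n^k ways,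
-- and the count would carry an extra factor log n in the exponent. Inside a container fixed by few
-- bits an edge costs one bit; only the O(n^(k-2)) exceptional edges still cost log n each. Triples
-- are recorded, and not pairs, because an edge of a cycle in the container has to be replaced by an
-- edge of G through both of its joints. Nothing makes the pair of joints robust by itself; together
-- with the center it is. The walk moves from a set to another set with the same center and then to
-- another center of that set. Its witnesses must therefore be centered again, so robustness is
-- required inside a family of pointed edges. Deleting edges can destroy this property, hence the
-- largest such family is computed anew after every deletion; what survives the process is a list of
-- (k-1)-sets, each of which pays for at most t deleted edges. All obstacle lists are bounded by one
-- number `w` that depends only on k and ℓ, so every threshold is a constant times n^(k-2).

private variable
  A B : Set

-- Counting with lists: pigeonhole arguments, words, sublists.

length-filter-split : {P : A → Set} (P? : Decidable P) (xs : List A) →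
  length xs ≡ length (filter P? xs) + length (filter (¬? ∘ P?) xs)
length-filter-split P? [] = refl
length-filter-split P? (x ∷ xs) with P? x
... | yes _ = cong suc (length-filter-split P? xs)
... | no _ = trans (cong suc (length-filter-split P? xs)) (sym (+-suc _ _))

Unique-⊆-length : {xs ys : List A} → Unique xs → (∀ {x} → x ∈ˡ xs → x ∈ˡ ys) → length xs ≤ length ys
Unique-⊆-length {xs = []} _ _ = z≤n
Unique-⊆-length {xs = x ∷ xs} {ys} (x∉xs ∷ u) xs⊆ys with ∈-∃++ (xs⊆ys (here refl))
... | as , bs , refl = begin
  suc (length xs)                  ≤⟨ s≤s (Unique-⊆-length u xs⊆rest) ⟩
  suc (length (as ++ bs))          ≡⟨ cong suc (length-++ as) ⟩
  suc (length as + length bs)      ≡⟨ +-suc (length as) (length bs) ⟨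
  length as + suc (length bs)      ≡⟨ length-++ as ⟨
  length (as ++ x ∷ bs)            ∎
  where
  open ≤-Reasoning
  xs⊆rest : ∀ {y} → y ∈ˡ xs → y ∈ˡ as ++ bs
  xs⊆rest y∈ with ∈-++⁻ as (xs⊆ys (there y∈))
  ... | inj₁ y∈as = ∈-++⁺ˡ y∈as
  ... | inj₂ (here refl) = contradiction refl (All.lookup x∉xs y∈)
  ... | inj₂ (there y∈bs) = ∈-++⁺ʳ as y∈bs

Unique-∷⁻ : {x : A} {xs : List A} → Unique (x ∷ xs) → x ∉ˡ xs × Unique xs
Unique-∷⁻ (x∉ ∷ u) = (λ x∈ → All.lookup x∉ x∈ refl) , u

Unique-∷⁺ : {x : A} {xs : List A} → x ∉ˡ xs → Unique xs → Unique (x ∷ xs)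
Unique-∷⁺ x∉ u = All.tabulate (λ y∈ x≡y → x∉ (subst (_∈ˡ _) (sym x≡y) y∈)) ∷ u

∃-max : (g : A → ℕ) (xs : List A) → 1 ≤ length xs → ∃[ x ] x ∈ˡ xs × sum (map g xs) ≤ length xs * g x
∃-max g (x ∷ []) _ = x , here refl , ≤-refl
∃-max g (x ∷ xs@(_ ∷ _)) _ with ∃-max g xs (s≤s z≤n)
... | y , y∈ , le with ≤-total (g x) (g y)
...   | inj₁ gx≤gy = y , there y∈ , +-mono-≤ gx≤gy le
...   | inj₂ gy≤gx = x , here refl , +-monoʳ-≤ (g x) (≤-trans le (*-monoʳ-≤ (length xs) gy≤gx))

length-≤-sum-filter : {B : Set} (R : A → B → Set) (R? : ∀ a b → Dec (R a b)) (xs : List A) (os : List B) →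
  (∀ {a} → a ∈ˡ xs → ∃[ o ] o ∈ˡ os × R a o) →
  length xs ≤ sum (map (λ o → length (filter (λ a → R? a o) xs)) os)
length-≤-sum-filter R R? [] [] cov = z≤n
length-≤-sum-filter R R? (x ∷ xs) [] cov with cov (here refl)
... | _ , () , _
length-≤-sum-filter R R? xs (o ∷ os) cov = begin
  length xs                                   ≡⟨ length-filter-split P? xs ⟩
  length (filter P? xs) + length rest         ≤⟨ +-monoʳ-≤ _ (length-≤-sum-filter R R? rest os cov′) ⟩
  length (filter P? xs) + sum (map (λ o′ → length (filter (λ a → R? a o′) rest)) os) ≤⟨ +-monoʳ-≤ _ (mono os) ⟩
  length (filter P? xs) + sum (map (λ o′ → length (filter (λ a → R? a o′) xs)) os) ∎
  where
  open ≤-Reasoning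
  P? = λ a → R? a o
  rest = filter (¬? ∘ P?) xs
  cov′ : ∀ {a} → a ∈ˡ rest → ∃[ o′ ] o′ ∈ˡ os × R a o′
  cov′ a∈ with ∈-filter⁻ (¬? ∘ P?) {xs = xs} a∈
  ... | a∈xs , ¬r with cov a∈xs
  ...   | _ , here refl , r = contradiction r ¬r
  ...   | o′ , there o′∈ , r = o′ , o′∈ , r
  filter-filter : ∀ {P Q : A → Set} (P? : Decidable P) (Q? : Decidable Q) ys →
    length (filter P? (filter Q? ys)) ≤ length (filter P? ys)
  filter-filter P? Q? [] = z≤n
  filter-filter P? Q? (y ∷ ys) with Q? y
  filter-filter P? Q? (y ∷ ys) | yes _ with P? y
  ... | yes _ = s≤s (filter-filter P? Q? ys)
  ... | no _ = filter-filter P? Q? ys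
  filter-filter P? Q? (y ∷ ys) | no _ with P? y
  ... | yes _ = m≤n⇒m≤1+n (filter-filter P? Q? ys)
  ... | no _ = filter-filter P? Q? ys
  mono : ∀ os′ → sum (map (λ o′ → length (filter (λ a → R? a o′) rest)) os′) ≤
                 sum (map (λ o′ → length (filter (λ a → R? a o′) xs)) os′)
  mono [] = z≤n
  mono (o′ ∷ os′) = +-mono-≤ (filter-filter (λ a → R? a o′) (¬? ∘ P?) xs) (mono os′)

-- In `peel` the options are the pairs of a position and an obstacle, which is the origin of the
-- factor `k * w` there.
popular : {B : Set} (R : A → B → Set) (R? : ∀ a b → Dec (R a b)) (xs : List A) (os : List B) →
  1 ≤ length xs → (∀ {a} → a ∈ˡ xs → ∃[ o ] o ∈ˡ os × R a o) →
  ∃[ o ] length xs ≤ length os * length (filter (λ a → R? a o) xs)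
popular R R? xs@(x ∷ _) [] _ cov with cov (here refl)
... | _ , () , _
popular R R? xs os@(_ ∷ _) _ cov with ∃-max (λ o → length (filter (λ a → R? a o) xs)) os (s≤s z≤n)
... | o , _ , le = o , ≤-trans (length-≤-sum-filter R R? xs os cov) le

pigeonhole : DecidableEquality B → (h : A → B) (xs : List A) (codes : List B) → Unique xs →
  (∀ {a} → a ∈ˡ xs → h a ∈ˡ codes) → length codes < length xs →
  ∃[ a ] ∃[ b ] a ∈ˡ xs × b ∈ˡ xs × a ≢ b × h a ≡ h b
pigeonhole _≟_ h [] codes u _ ()
pigeonhole _≟_ h (x ∷ xs) codes (x∉ ∷ u) h∈ lt with any? (λ y → h x ≟ h y) xs
... | yes p = let y , y∈ , eq = find p in x , y , here refl , there y∈ , All.lookup x∉ y∈ , eq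
... | no ¬p with ∈-∃++ (h∈ (here refl))
...   | as , bs , refl = let a , b , a∈ , b∈ , a≢b , eq = pigeonhole _≟_ h xs (as ++ bs) u h∈′ lt′
                         in a , b , there a∈ , there b∈ , a≢b , eq
  where
  h∈′ : ∀ {a} → a ∈ˡ xs → h a ∈ˡ as ++ bs
  h∈′ {a} a∈ with ∈-++⁻ as (h∈ (there a∈))
  ... | inj₁ p = ∈-++⁺ˡ p
  ... | inj₂ (here eq) = contradiction (lose a∈ (sym eq)) ¬p
  ... | inj₂ (there p) = ∈-++⁺ʳ as p
  lt′ : length (as ++ bs) < length xs
  lt′ = s≤s⁻¹ (≤-trans (≤-reflexive (cong suc (trans (cong suc (length-++ as)) (trans (sym (+-suc (length as) (length bs))) (sym (length-++ as)))))) lt)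

length-cartesianProductWith : {C : Set} (f : A → B → C) (xs : List A) (ys : List B) →
  length (cartesianProductWith f xs ys) ≡ length xs * length ys
length-cartesianProductWith f [] ys = refl
length-cartesianProductWith f (x ∷ xs) ys = trans (length-++ (map (f x) ys))
  (cong₂ _+_ (length-map (f x) ys) (length-cartesianProductWith f xs ys))

length-concatMap-≤ : (f : A → List B) (xs : List A) (m : ℕ) → (∀ x → length (f x) ≤ m) →
  length (concatMap f xs) ≤ length xs * m
length-concatMap-≤ f [] m le = z≤n
length-concatMap-≤ f (x ∷ xs) m le = ≤-trans (≤-reflexive (length-++ (f x)))
  (+-mono-≤ (le x) (length-concatMap-≤ f xs m le))

words : ℕ → List A → List (List A)
words zero xs = [ [] ]
words (suc m) xs = cartesianProductWith _∷_ xs (words m xs)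

length-words : (m : ℕ) (xs : List A) → length (words m xs) ≡ length xs ^ m
length-words zero xs = refl
length-words (suc m) xs = trans (length-cartesianProductWith _∷_ xs (words m xs)) (cong (length xs *_) (length-words m xs))

∈-words : (xs ys : List A) → (∀ {y} → y ∈ˡ ys → y ∈ˡ xs) → ys ∈ˡ words (length ys) xs
∈-words xs [] _ = here refl
∈-words xs (y ∷ ys) ys⊆ = ∈-cartesianProductWith⁺ _∷_ (ys⊆ (here refl)) (∈-words xs ys (ys⊆ ∘ there))

words≤ : ℕ → List A → List (List A)
words≤ zero xs = [ [] ]
words≤ (suc m) xs = [] ∷ cartesianProductWith _∷_ xs (words≤ m xs)

∈-words≤ : (m : ℕ) (xs ys : List A) → length ys ≤ m → (∀ {y} → y ∈ˡ ys → y ∈ˡ xs) → ys ∈ˡ words≤ m xs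
∈-words≤ zero xs [] _ _ = here refl
∈-words≤ (suc m) xs [] _ _ = here refl
∈-words≤ (suc m) xs (y ∷ ys) (s≤s le) ys⊆ =
  there (∈-cartesianProductWith⁺ _∷_ (ys⊆ (here refl)) (∈-words≤ m xs ys le (ys⊆ ∘ there)))

length-words≤ : (m : ℕ) (xs : List A) {ys : List A} → ys ∈ˡ words≤ m xs → length ys ≤ m
length-words≤ zero xs (here refl) = z≤n
length-words≤ (suc m) xs (here refl) = z≤n
length-words≤ (suc m) xs (there p) with ∈-cartesianProductWith⁻ _∷_ xs (words≤ m xs) p
... | _ , _ , _ , q , refl = s≤s (length-words≤ m xs q)

sublists : List A → List (List A)
sublists [] = [ [] ]
sublists (x ∷ xs) = sublists xs ++ map (x ∷_) (sublists xs)

length-sublists : (xs : List A) → length (sublists xs) ≡ 2 ^ length xs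
length-sublists [] = refl
length-sublists (x ∷ xs) = begin
  length (sublists xs ++ map (x ∷_) (sublists xs))          ≡⟨ length-++ (sublists xs) ⟩
  length (sublists xs) + length (map (x ∷_) (sublists xs))  ≡⟨ cong₂ _+_ ih (trans (length-map (x ∷_) (sublists xs)) (trans ih (sym (+-identityʳ _)))) ⟩
  2 * 2 ^ length xs                                         ∎
  where
  open ≡-Reasoning
  ih = length-sublists xs

filter-∈-sublists : {P : A → Set} (P? : Decidable P) (xs : List A) → filter P? xs ∈ˡ sublists xs
filter-∈-sublists P? [] = here refl
filter-∈-sublists P? (x ∷ xs) with P? x
... | yes _ = ∈-++⁺ʳ (sublists xs) (∈-map⁺ (x ∷_) (filter-∈-sublists P? xs))
... | no _ = ∈-++⁺ˡ (filter-∈-sublists P? xs)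

∈-sublists⇒⊆ : (xs : List A) {ys : List A} → ys ∈ˡ sublists xs → ∀ {y} → y ∈ˡ ys → y ∈ˡ xs
∈-sublists⇒⊆ [] (here refl) ()
∈-sublists⇒⊆ (x ∷ xs) p y∈ with ∈-++⁻ (sublists xs) p
... | inj₁ q = there (∈-sublists⇒⊆ xs q y∈)
... | inj₂ q with ∈-map⁻ (x ∷_) q
∈-sublists⇒⊆ (x ∷ xs) p (here refl) | inj₂ q | zs , zs∈ , refl = here refl
∈-sublists⇒⊆ (x ∷ xs) p (there y∈) | inj₂ q | zs , zs∈ , refl = there (∈-sublists⇒⊆ xs zs∈ y∈)

-- Finite sets as duplicate-free lists.

elems : ∀ {n} → Subset n → List (Fin n)
elems [] = []
elems (outside ∷ S) = map suc (elems S)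
elems (inside ∷ S) = zero ∷ map suc (elems S)

length-elems : ∀ {n} (S : Subset n) → length (elems S) ≡ ∣ S ∣
length-elems [] = refl
length-elems (outside ∷ S) = trans (length-map suc (elems S)) (length-elems S)
length-elems (inside ∷ S) = cong suc (trans (length-map suc (elems S)) (length-elems S))

∈-elems⁺ : ∀ {n} {S : Subset n} {x} → x ∈ S → x ∈ˡ elems S
∈-elems⁺ {S = inside ∷ S} here = here refl
∈-elems⁺ {S = outside ∷ S} (there x∈) = ∈-map⁺ suc (∈-elems⁺ x∈)
∈-elems⁺ {S = inside ∷ S} (there x∈) = there (∈-map⁺ suc (∈-elems⁺ x∈))

∈-elems⁻ : ∀ {n} {S : Subset n} {x} → x ∈ˡ elems S → x ∈ S
∈-elems⁻ {S = outside ∷ S} p with ∈-map⁻ suc p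
... | _ , q , refl = there (∈-elems⁻ q)
∈-elems⁻ {S = inside ∷ S} (here refl) = here
∈-elems⁻ {S = inside ∷ S} (there p) with ∈-map⁻ suc p
... | _ , q , refl = there (∈-elems⁻ q)

elems-unique : ∀ {n} (S : Subset n) → Unique (elems S)
elems-unique [] = []
elems-unique (outside ∷ S) = Unique.map⁺ Fin.suc-injective (elems-unique S)
elems-unique (inside ∷ S) = Unique-∷⁺ (λ p → case ∈-map⁻ suc p of λ { (_ , _ , ()) })
  (Unique.map⁺ Fin.suc-injective (elems-unique S))

lookup-injective : {xs : List A} → Unique xs → ∀ {i j} → lookup xs i ≡ lookup xs j → i ≡ j
lookup-injective {xs = x ∷ xs} u {zero} {zero} eq = refl
lookup-injective {xs = x ∷ xs} (x∉ ∷ u) {zero} {suc j} eq = contradiction eq (All.lookup x∉ (∈-lookup j))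
lookup-injective {xs = x ∷ xs} (x∉ ∷ u) {suc i} {zero} eq = contradiction (sym eq) (All.lookup x∉ (∈-lookup i))
lookup-injective {xs = x ∷ xs} (x∉ ∷ u) {suc i} {suc j} eq = cong suc (lookup-injective u eq)

-- Robustness properties quantify over all obstacle lists of bounded length, which makes them decidable.
bounded-∀? : ∀ {n} (w : ℕ) {Q : List (Fin n) → Set} → (∀ W → Dec (Q W)) →
  (∀ W → length W ≤ w → Q W) ⊎ (∃[ W ] length W ≤ w × ¬ Q W)
bounded-∀? {n} w Q? with All.all? Q? (words≤ w (allFin n))
... | yes all = inj₁ (λ W le → All.lookup all (∈-words≤ w (allFin n) W le (λ _ → ∈-allFin _)))
... | no ¬all with find (All.¬All⇒Any¬ Q? _ ¬all)
...   | W , W∈ , ¬q = inj₂ (W , length-words≤ w _ W∈ , ¬q)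

-- Linear cycles

toℕ-next-suc : ∀ {ℓ} (i : Fin ℓ) → suc (toℕ i) < ℓ → toℕ (next i) ≡ suc (toℕ i)
toℕ-next-suc {suc m} i lt = trans (Fin.toℕ-fromℕ< (m%n<n (suc (toℕ i)) (suc m))) (m<n⇒m%n≡m lt)

toℕ-next-last : ∀ {ℓ} (i : Fin ℓ) → suc (toℕ i) ≡ ℓ → toℕ (next i) ≡ 0
toℕ-next-last {suc m} i eq = trans (Fin.toℕ-fromℕ< (m%n<n (suc (toℕ i)) (suc m)))
  (trans (cong (_% suc m) eq) (n%n≡0 (suc m)))

last⊎suc : ∀ {ℓ} (i : Fin ℓ) → suc (toℕ i) ≡ ℓ ⊎ suc (toℕ i) < ℓ
last⊎suc {ℓ} i with m≤n⇒m<n∨m≡n (Fin.toℕ<n i)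
... | inj₁ lt = inj₂ lt
... | inj₂ eq = inj₁ eq

next-≢ : ∀ {ℓ} → 2 ≤ ℓ → (i : Fin ℓ) → i ≢ next i
next-≢ 2≤ℓ i eq with last⊎suc i
... | inj₂ lt = 1+n≢n (sym (trans (cong toℕ eq) (toℕ-next-suc i lt)))
... | inj₁ last = 1+n≰n (subst (2 ≤_) (trans (sym last) (cong suc (trans (cong toℕ eq) (toℕ-next-last i last)))) 2≤ℓ)

-- Private vertices stay implicit. In a k-uniform family they are the k-2 vertices of `S i` other
-- than its two joints; `S∩S` and `v∈⇒` together keep them out of all other edges.
record LinCyc {n} (H : List (Subset n)) (ℓ : ℕ) : Set where
  field
    v       : Fin ℓ → Fin n
    v-inj   : ∀ {i j} → v i ≡ v j → i ≡ j
    S       : Fin ℓ → Subset n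
    S∈      : ∀ i → S i ∈ˡ H
    v∈      : ∀ i → v i ∈ S i
    v-next∈ : ∀ i → v (next i) ∈ S i
    v∈⇒     : ∀ {i j} → v j ∈ S i → j ≡ i ⊎ j ≡ next i
    S∩S     : ∀ {i j x} → i ≢ j → x ∈ S i → x ∈ S j → ∃[ m ] x ≡ v m

LinCyc⇒ContainsCycle : ∀ {n k ℓ} (G : KGraph n k) (H : List (Subset n)) → 2 ≤ ℓ →
  (∀ {S} → S ∈ˡ H → IsEdge n k G S × ∣ S ∣ ≡ k) → LinCyc H ℓ → ContainsCycle n k ℓ G
LinCyc⇒ContainsCycle {n} {k} {ℓ} G H 2≤ℓ H⇒ cyc = φ , φ-inj , λ i → S i , proj₁ (H⇒ (S∈ i)) , edge i
  where
  open LinCyc cyc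
  Joint : Fin ℓ → Fin n → Set
  Joint i x = x ≡ v i ⊎ x ≡ v (next i)
  joint? : ∀ i x → Dec (Joint i x)
  joint? i x = (x Fin.≟ v i) ⊎-dec (x Fin.≟ v (next i))
  priv : Fin ℓ → List (Fin n)
  priv i = filter (¬? ∘ joint? i) (elems (S i))
  joints : ∀ i → length (filter (joint? i) (elems (S i))) ≡ 2
  joints i = ≤-antisym
    (Unique-⊆-length (Unique.filter⁺ (joint? i) (elems-unique (S i)))
      (λ p → case proj₂ (∈-filter⁻ (joint? i) {xs = elems (S i)} p) of λ
        { (inj₁ e) → here {xs = [ v (next i) ]} e ; (inj₂ e) → there (here e) }))
    (Unique-⊆-length {xs = v i ∷ v (next i) ∷ []} (Unique-∷⁺ (λ { (here e) → next-≢ 2≤ℓ i (v-inj e) }) (Unique-∷⁺ (λ ()) []))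
      (λ { (here refl) → ∈-filter⁺ (joint? i) (∈-elems⁺ (v∈ i)) (inj₁ refl)
         ; (there (here refl)) → ∈-filter⁺ (joint? i) (∈-elems⁺ (v-next∈ i)) (inj₂ refl) }))
  length-priv : ∀ i → length (priv i) ≡ k ∸ 2
  length-priv i = sym (trans (cong (_∸ 2) (sym (begin
    2 + length (priv i)                                        ≡⟨ cong (_+ length (priv i)) (sym (joints i)) ⟩
    length (filter (joint? i) (elems (S i))) + length (priv i) ≡⟨ length-filter-split (joint? i) (elems (S i)) ⟨
    length (elems (S i))                                       ≡⟨ length-elems (S i) ⟩
    ∣ S i ∣                                                    ≡⟨ proj₂ (H⇒ (S∈ i)) ⟩
    k                                                          ∎))) refl)
    where open ≡-Reasoning
  φ : CycV k ℓ → Fin n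
  φ (inj₁ i) = v i
  φ (inj₂ (i , j)) = lookup (priv i) (cast (sym (length-priv i)) j)
  priv⇒ : ∀ {i x} → x ∈ˡ priv i → x ∈ S i × ¬ Joint i x
  priv⇒ {i} p = let q , r = ∈-filter⁻ (¬? ∘ joint? i) {xs = elems (S i)} p in ∈-elems⁻ q , r
  φ₂ : ∀ i j → φ (inj₂ (i , j)) ∈ S i × ¬ Joint i (φ (inj₂ (i , j)))
  φ₂ i j = priv⇒ (∈-lookup {xs = priv i} (cast (sym (length-priv i)) j))
  not-v : ∀ i j m → φ (inj₂ (i , j)) ≢ v m
  not-v i j m eq with φ₂ i j
  ... | x∈ , ¬joint with v∈⇒ (subst (_∈ S i) eq x∈)
  ...   | inj₁ refl = ¬joint (inj₁ eq)
  ...   | inj₂ refl = ¬joint (inj₂ eq)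
  φ-inj : Injective _≡_ _≡_ φ
  φ-inj {inj₁ i} {inj₁ j} eq = cong inj₁ (v-inj eq)
  φ-inj {inj₁ m} {inj₂ (i , j)} eq = contradiction (sym eq) (not-v i j m)
  φ-inj {inj₂ (i , j)} {inj₁ m} eq = contradiction eq (not-v i j m)
  φ-inj {inj₂ (i , j)} {inj₂ (i′ , j′)} eq with i Fin.≟ i′
  ... | yes refl = cong (λ z → inj₂ (i , z)) (Fin.toℕ-injective (begin
    toℕ j                                ≡⟨ Fin.toℕ-cast (sym (length-priv i)) j ⟨
    toℕ (cast (sym (length-priv i)) j)   ≡⟨ cong toℕ (lookup-injective (Unique.filter⁺ (¬? ∘ joint? i) (elems-unique (S i))) eq) ⟩
    toℕ (cast (sym (length-priv i)) j′)  ≡⟨ Fin.toℕ-cast (sym (length-priv i)) j′ ⟩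
    toℕ j′                               ∎))
    where open ≡-Reasoning
  ... | no i≢i′ = let m , x≡ = S∩S i≢i′ (proj₁ (φ₂ i j)) (subst (_∈ S i′) (sym eq) (proj₁ (φ₂ i′ j′)))
                  in contradiction x≡ (not-v i j m)
  edge : ∀ i x → (x ∈ S i) ⇔ (∃[ u ] (CycMem {k} i u × φ u ≡ x))
  edge i x = mk⇔ to from
    where
    to : x ∈ S i → ∃[ u ] (CycMem {k} i u × φ u ≡ x)
    to x∈ with joint? i x
    ... | yes (inj₁ refl) = inj₁ i , inj₁ refl , refl
    ... | yes (inj₂ refl) = inj₁ (next i) , inj₂ refl , refl
    ... | no ¬j = let p = ∈-filter⁺ (¬? ∘ joint? i) (∈-elems⁺ x∈) ¬j in
      inj₂ (i , cast (length-priv i) (index p)) , refl ,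
      trans (cong (lookup (priv i)) (Fin.toℕ-injective (trans (Fin.toℕ-cast (sym (length-priv i)) (cast (length-priv i) (index p))) (Fin.toℕ-cast (length-priv i) (index p))))) (sym (lookup-index p))
    from : ∃[ u ] (CycMem {k} i u × φ u ≡ x) → x ∈ S i
    from (inj₁ _ , inj₁ refl , refl) = v∈ i
    from (inj₁ _ , inj₂ refl , refl) = v-next∈ i
    from (inj₂ (_ , j) , refl , refl) = proj₁ (φ₂ i j)

-- `D` plays the kernel of a large delta-system. It is a list that may repeat entries, so that pairs
-- and triples are treated alike.
Rob : ∀ {n} → List (Subset n) → ℕ → List (Fin n) → Set
Rob H w D = ∀ W → length W ≤ w →
  ∃[ S ] S ∈ˡ H × (∀ {x} → x ∈ˡ D → x ∈ S) × (∀ {x} → x ∈ S → x ∈ˡ W → x ∈ˡ D)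

Rob-resp : ∀ {n} {H : List (Subset n)} {w D D′} → All (_∈ˡ D′) D → All (_∈ˡ D) D′ →
  Rob H w D → Rob H w D′
Rob-resp D⊆D′ D′⊆D rob W le with rob W le
... | S , S∈ , D⊆ , avoid = S , S∈ , D⊆ ∘ All.lookup D′⊆D , λ x∈ x∈W → All.lookup D⊆D′ (avoid x∈ x∈W)

-- Each chosen edge becomes an obstacle for the later ones, at a cost of k per edge. A later edge
-- can meet an earlier one only in its own prescribed set; as that set lies in `W`, which the
-- earlier edge avoids too, the common vertex is prescribed for both.
greedy : ∀ {n k w} (H : List (Subset n)) → (∀ {S} → S ∈ˡ H → ∣ S ∣ ≡ k) → (m : ℕ) (D : Fin m → List (Fin n)) (W : List (Fin n)) →
  (∀ i → Rob H w (D i)) → (∀ i {x} → x ∈ˡ D i → x ∈ˡ W) → length W + m * k ≤ w →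
  Σ[ S ∈ (Fin m → Subset n) ]
    (∀ i → S i ∈ˡ H) × (∀ i {x} → x ∈ˡ D i → x ∈ S i) × (∀ i {x} → x ∈ S i → x ∈ˡ W → x ∈ˡ D i) ×
    (∀ {i j x} → i ≢ j → x ∈ S i → x ∈ S j → x ∈ˡ D i × x ∈ˡ D j)
greedy H size zero D W rob D⊆W le = (λ ()) , (λ ()) , (λ ()) , (λ ()) , λ { {()} }
greedy {n} {k} {w} H size (suc m) D W rob D⊆W le
  with rob zero W (≤-trans (m≤m+n _ _) le)
... | S₀ , S₀∈ , D₀⊆ , avoid₀
  with greedy {w = w} H size m (D ∘ suc) (elems S₀ ++ W) (rob ∘ suc) (λ i x∈ → ∈-++⁺ʳ (elems S₀) (D⊆W (suc i) x∈)) le′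
  where
  open ≤-Reasoning
  le′ : length (elems S₀ ++ W) + m * k ≤ w
  le′ = begin
    length (elems S₀ ++ W) + m * k        ≡⟨ cong (_+ m * k) (length-++ (elems S₀)) ⟩
    length (elems S₀) + length W + m * k  ≡⟨ cong (λ z → z + length W + m * k) (trans (length-elems S₀) (size S₀∈)) ⟩
    k + length W + m * k                  ≡⟨ cong (_+ m * k) (+-comm k (length W)) ⟩
    length W + k + m * k                  ≡⟨ +-assoc (length W) k (m * k) ⟩
    length W + (k + m * k)                ≤⟨ le ⟩
    w                                     ∎
... | S , S∈ , D⊆ , avoid , meet = S′ , S′∈ , D⊆′ , avoid′ , meet′
  where
  S′ : Fin (suc m) → Subset n
  S′ zero = S₀
  S′ (suc i) = S i
  S′∈ : ∀ i → S′ i ∈ˡ H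
  S′∈ zero = S₀∈
  S′∈ (suc i) = S∈ i
  D⊆′ : ∀ i {x} → x ∈ˡ D i → x ∈ S′ i
  D⊆′ zero = D₀⊆
  D⊆′ (suc i) = D⊆ i
  avoid′ : ∀ i {x} → x ∈ S′ i → x ∈ˡ W → x ∈ˡ D i
  avoid′ zero = avoid₀
  avoid′ (suc i) x∈ x∈W = avoid i x∈ (∈-++⁺ʳ (elems S₀) x∈W)
  meet₀ : ∀ {j x} → x ∈ S₀ → x ∈ S j → x ∈ˡ D zero × x ∈ˡ D (suc j)
  meet₀ {j} x∈₀ x∈ = let p = avoid j x∈ (∈-++⁺ˡ (∈-elems⁺ x∈₀)) in avoid₀ x∈₀ (D⊆W (suc j) p) , p
  meet′ : ∀ {i j x} → i ≢ j → x ∈ S′ i → x ∈ S′ j → x ∈ˡ D i × x ∈ˡ D j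
  meet′ {zero} {zero} ne _ _ = contradiction refl ne
  meet′ {zero} {suc j} _ x∈ x∈′ = meet₀ x∈ x∈′
  meet′ {suc i} {zero} _ x∈ x∈′ = let p , q = meet₀ x∈′ x∈ in q , p
  meet′ {suc i} {suc j} ne x∈ x∈′ = meet (ne ∘ cong suc) x∈ x∈′

length-concatMap-triples : ∀ {n m} (f g h : Fin m → Fin n) (is : List (Fin m)) →
  length (concatMap (λ i → f i ∷ g i ∷ h i ∷ []) is) ≡ 3 * length is
length-concatMap-triples f g h [] = refl
length-concatMap-triples f g h (i ∷ is) = trans (cong (3 +_) (length-concatMap-triples f g h is)) (sym (*-suc 3 (length is)))

-- The third vertex `z i` serves edges for which only a triple through a center is known to be
-- robust; for a robust pair it may repeat a joint. The budget counts three prescribed vertices and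
-- one k-set for each of the ℓ edges.
embed : ∀ {n k w ℓ} (H : List (Subset n)) → (∀ {S} → S ∈ˡ H → ∣ S ∣ ≡ k) → 3 * ℓ + ℓ * k ≤ w →
  (v z : Fin ℓ → Fin n) → (∀ {i j} → v i ≡ v j → i ≡ j) →
  (∀ {i j} → z i ≡ v j → j ≡ i ⊎ j ≡ next i) → (∀ {i j} → i ≢ j → z i ≡ z j → ∃[ m ] z i ≡ v m) →
  (∀ i → Rob H w (v i ∷ v (next i) ∷ z i ∷ [])) → LinCyc H ℓ
embed {n} {k} {w} {ℓ} H size le v z v-inj z-v z-z rob
  with greedy H size ℓ D (concatMap D (allFin ℓ)) rob D⊆W
         (subst (λ q → q + ℓ * k ≤ w) (sym (trans (length-concatMap-triples v (v ∘ next) z (allFin ℓ)) (cong (3 *_) (length-tabulate {n = ℓ} id)))) le)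
  where
  D : Fin ℓ → List (Fin n)
  D i = v i ∷ v (next i) ∷ z i ∷ []
  D⊆W : ∀ i {x} → x ∈ˡ D i → x ∈ˡ concatMap D (allFin ℓ)
  D⊆W i x∈ = ∈-concatMap⁺ D (lose (∈-allFin i) x∈)
... | S , S∈ , D⊆ , avoid , meet = record
  { v = v ; v-inj = v-inj ; S = S ; S∈ = S∈
  ; v∈ = λ i → D⊆ i (here refl) ; v-next∈ = λ i → D⊆ i (there (here refl))
  ; v∈⇒ = v∈⇒ ; S∩S = S∩S }
  where
  v∈⇒ : ∀ {i j} → v j ∈ S i → j ≡ i ⊎ j ≡ next i
  v∈⇒ {i} {j} p with avoid i p (∈-concatMap⁺ (λ i → v i ∷ v (next i) ∷ z i ∷ []) (lose (∈-allFin j) (here refl)))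
  ... | here e = inj₁ (v-inj e)
  ... | there (here e) = inj₂ (v-inj e)
  ... | there (there (here e)) = z-v (sym e)
  S∩S : ∀ {i j x} → i ≢ j → x ∈ S i → x ∈ S j → ∃[ m ] x ≡ v m
  S∩S {i} {j} ne x∈ x∈′ with meet ne x∈ x∈′
  ... | here e , _ = i , e
  ... | there (here e) , _ = next i , e
  ... | there (there (here e)) , here e′ = j , e′
  ... | there (there (here e)) , there (here e′) = next j , e′
  ... | there (there (here e)) , there (there (here e′)) = let m , q = z-z ne (trans (sym e) e′) in m , trans e q

lastOf : ∀ {n} → Fin n → List (Fin n) → Fin n
lastOf a [] = a
lastOf a (b ∷ bs) = lastOf b bs

lookup-lastOf : ∀ {n} (a : Fin n) us (i : Fin (length (a ∷ us))) → suc (toℕ i) ≡ length (a ∷ us) → lookup (a ∷ us) i ≡ lastOf a us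
lookup-lastOf a [] zero eq = refl
lookup-lastOf a (b ∷ us) (suc i) eq = lookup-lastOf b us i (suc-injective eq)

lookup-Linked : ∀ {n} {R : Fin n → Fin n → Set} {xs} → Linked R xs → ∀ i j → toℕ j ≡ suc (toℕ i) → R (lookup xs i) (lookup xs j)
lookup-Linked [-] zero (suc ()) eq
lookup-Linked (r ∷ rs) zero (suc zero) eq = r
lookup-Linked (r ∷ rs) (suc i) (suc j) eq = lookup-Linked rs i j (suc-injective eq)

-- Only the closing edge may need a third vertex: zigzags of odd length close through a center,
-- while all other applications let `z` be the first vertex of the path.
embed-list : ∀ {n k w} (H : List (Subset n)) → (∀ {S} → S ∈ˡ H → ∣ S ∣ ≡ k) → (a : Fin n) (us : List (Fin n)) (z : Fin n) →
  3 * length (a ∷ us) + length (a ∷ us) * k ≤ w → Unique (a ∷ us) →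
  Linked (λ x y → Rob H w (x ∷ y ∷ [])) (a ∷ us) → Rob H w (lastOf a us ∷ a ∷ z ∷ []) →
  (z ∈ˡ a ∷ us → z ≡ lastOf a us ⊎ z ≡ a) → LinCyc H (length (a ∷ us))
embed-list {n} {k} {w} H size a us z le u linked closing z∈ = embed H size le v z′ v-inj z-v z-z rob
  where
  v : Fin (length (a ∷ us)) → Fin n
  v = lookup (a ∷ us)
  v-inj : ∀ {i j} → v i ≡ v j → i ≡ j
  v-inj = lookup-injective u
  v-first : ∀ j → toℕ j ≡ 0 → v j ≡ a
  v-first zero eq = refl
  z″ : (i : Fin (length (a ∷ us))) → suc (toℕ i) ≡ length (a ∷ us) ⊎ suc (toℕ i) < length (a ∷ us) → Fin n
  z″ i (inj₁ _) = z
  -- All edges but the closing one come from a robust pair, so their third vertex just repeats a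
  -- joint.
  z″ i (inj₂ _) = v i
  z′ : Fin (length (a ∷ us)) → Fin n
  z′ i = z″ i (last⊎suc i)
  z-v : ∀ {i j} → z′ i ≡ v j → j ≡ i ⊎ j ≡ next i
  z-v {i} {j} eq with last⊎suc i
  ... | inj₂ _ = inj₁ (v-inj (sym eq))
  ... | inj₁ last with z∈ (subst (_∈ˡ a ∷ us) (sym eq) (∈-lookup {xs = a ∷ us} j))
  ...   | inj₁ e = inj₁ (v-inj (trans (sym eq) (trans e (sym (lookup-lastOf a us i last)))))
  ...   | inj₂ e = inj₂ (v-inj (trans (sym eq) (trans e (sym (v-first (next i) (toℕ-next-last i last))))))
  z-z : ∀ {i j} → i ≢ j → z′ i ≡ z′ j → ∃[ m ] z′ i ≡ v m
  z-z {i} {j} ne eq with last⊎suc i | last⊎suc j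
  ... | inj₂ _ | _ = i , refl
  ... | inj₁ _ | inj₂ _ = j , eq
  ... | inj₁ p | inj₁ q = contradiction (Fin.toℕ-injective (suc-injective (trans p (sym q)))) ne
  rob : ∀ i → Rob H w (v i ∷ v (next i) ∷ z′ i ∷ [])
  rob i with last⊎suc i
  ... | inj₁ last = subst₂ (λ p q → Rob H w (p ∷ q ∷ z ∷ []))
    (sym (lookup-lastOf a us i last)) (sym (v-first (next i) (toℕ-next-last i last))) closing
  ... | inj₂ lt = Rob-resp {w = w}
    (here refl ∷ there (here refl) ∷ [])
    (here refl ∷ there (here refl) ∷ here refl ∷ [])
    (lookup-Linked linked i (next i) (toℕ-next-suc i lt))

-- Intersection structure

all⊎∃ : {P Q : A → Set} → (∀ x → P x ⊎ Q x) → (xs : List A) → (∀ {x} → x ∈ˡ xs → P x) ⊎ (∃[ x ] x ∈ˡ xs × Q x)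
all⊎∃ dec [] = inj₁ λ ()
all⊎∃ dec (x ∷ xs) with dec x | all⊎∃ dec xs
... | inj₂ q | _ = inj₂ (x , here refl , q)
... | inj₁ p | inj₁ ps = inj₁ λ { (here refl) → p ; (there x∈) → ps x∈ }
... | inj₁ p | inj₂ (y , y∈ , q) = inj₂ (y , there y∈ , q)

sum-map-mono : {g h : A → ℕ} → (∀ x → g x ≤ h x) → (xs : List A) → sum (map g xs) ≤ sum (map h xs)
sum-map-mono le [] = z≤n
sum-map-mono le (x ∷ xs) = +-mono-≤ (le x) (sum-map-mono le xs)

sum-map-bump : {g h : A → ℕ} {s : ℕ} {y : A} → (∀ x → g x ≤ h x) → s + g y ≤ h y → (xs : List A) → y ∈ˡ xs →
  s + sum (map g xs) ≤ sum (map h xs)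
sum-map-bump {s = s} le bump (x ∷ xs) (here refl) =
  ≤-trans (≤-reflexive (sym (+-assoc s _ _))) (+-mono-≤ bump (sum-map-mono le xs))
sum-map-bump {g = g} {h} {s} le bump (x ∷ xs) (there y∈) = begin
  s + (g x + sum (map g xs))   ≡⟨ +-assoc s (g x) _ ⟨
  s + g x + sum (map g xs)     ≡⟨ cong (_+ sum (map g xs)) (+-comm s (g x)) ⟩
  g x + s + sum (map g xs)     ≡⟨ +-assoc (g x) s _ ⟩
  g x + (s + sum (map g xs))   ≤⟨ +-mono-≤ (le x) (sum-map-bump le bump xs y∈) ⟩
  h x + sum (map h xs)         ∎
  where open ≤-Reasoning

_≟ˢ_ : ∀ {n} → DecidableEquality (Subset n)
_≟ˢ_ = ≡-dec Bool._≟_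

-- Solves the recursion in `homogeneous`: the core may take M members, and the rest, up to the
-- factor `k * w`, is shared by at most `suc j` parts of size at most M times the previous constant.
homConst : (k w : ℕ) → ℕ → ℕ
homConst k w zero = 1
homConst k w (suc j) = 1 + k * w * (suc j * homConst k w j)

1≤homConst : ∀ k w j → 1 ≤ homConst k w j
1≤homConst k w zero = ≤-refl
1≤homConst k w (suc j) = s≤s z≤n

-- Füredi's intersection-structure theorem for families of k-tuples: agreement sets of tuples play the
-- role of intersections, so that no passage to a k-partite subfamily is needed.
module Homogeneous {n k : ℕ} {A : Set} (τ : A → Fin k → Fin n) (w : ℕ) where

  AgreeOn : Subset k → A → A → Set
  AgreeOn J a b = ∀ i → i ∈ J → τ a i ≡ τ b i

  agreeOn? : ∀ J a b → Dec (AgreeOn J a b)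
  agreeOn? J a b = Fin.all? (λ i → (i ∈? J) →-dec (τ a i Fin.≟ τ b i))

  Robust : List A → Subset k → A → Set
  Robust F J a = ∀ W → length W ≤ w → ∃[ b ] b ∈ˡ F × AgreeOn J a b × (∀ i → i ∉ J → τ b i ∉ˡ W)

  -- Equivalently, `J` is not the exact agreement set of two members, which may coincide. Unlike
  -- robustness, this passes to subfamilies.
  Dead : List A → Subset k → Set
  Dead F J = ∀ {a b} → a ∈ˡ F → b ∈ˡ F → AgreeOn J a b → ∃[ i ] i ∉ J × τ a i ≡ τ b i

  Fragile : List A → Subset k → A → Set
  Fragile F J a = ∃[ W ] length W ≤ w × (∀ {b} → b ∈ˡ F → AgreeOn J a b → ∃[ i ] i ∉ J × τ b i ∈ˡ W)

  open import Data.List.Membership.DecPropositional (Fin._≟_ {n}) using () renaming (_∈?_ to _∈ˡ?_)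

  robust⊎fragile : ∀ F J a → Robust F J a ⊎ Fragile F J a
  robust⊎fragile F J a with bounded-∀? w Q?
    where
    Q? : ∀ W → Dec (Any (λ b → AgreeOn J a b × (∀ i → i ∉ J → τ b i ∉ˡ W)) F)
    Q? W = any? (λ b → agreeOn? J a b ×-dec Fin.all? (λ i → ¬? (i ∈? J) →-dec ¬? (τ b i ∈ˡ? W))) F
  ... | inj₁ all = inj₁ (λ W le → find (all W le))
  ... | inj₂ (W , le , ¬q) = inj₂ (W , le , hit)
    where
    hit : ∀ {b} → b ∈ˡ F → AgreeOn J a b → ∃[ i ] i ∉ J × τ b i ∈ˡ W
    hit {b} b∈ agree with Fin.any? (λ i → ¬? (i ∈? J) ×-dec (τ b i ∈ˡ? W))
    ... | yes p = p
    ... | no ¬p = contradiction (lose b∈ (agree , λ i i∉ τ∈ → ¬p (i , i∉ , τ∈))) ¬q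

  record Peeled (Js : List (Subset k)) (F : List A) : Set where
    field
      core        : List A
      core⊆       : ∀ {a} → a ∈ˡ core → a ∈ˡ F
      core-unique : Unique core
      core-robust : ∀ {a J} → J ∈ˡ Js → a ∈ˡ core → Robust core J a
      part        : Subset k → List A
      part⊆       : ∀ {J a} → a ∈ˡ part J → a ∈ˡ F
      part-unique : ∀ J → Unique (part J)
      part-dead   : ∀ J → Dead (part J) J
      bound       : length F ≤ length core + k * w * sum (map (length ∘ part) Js)

  -- While some member is fragile for some `J`, its whole group of members agreeing on `J` is
  -- removed. A fraction 1/(kw) of the group shares one value at one position outside `J`, and this
  -- fraction is saved in `part J`. Saved members of the same group agree outside `J`, those of
  -- different groups disagree on `J`, so `part J` stays dead.
  peel : ∀ Js F → Unique F → Acc _<_ (length F) → Peeled Js F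
  peel Js F u (acc rs) with all⊎∃ {P = λ a → ∀ {J} → J ∈ˡ Js → Robust F J a} {Q = λ a → ∃[ J ] J ∈ˡ Js × Fragile F J a}
                              (λ a → all⊎∃ (λ J → robust⊎fragile F J a) Js) F
  ... | inj₁ robust = record
    { core = F ; core⊆ = id ; core-unique = u ; core-robust = λ J∈ a∈ → robust a∈ J∈
    ; part = λ _ → [] ; part⊆ = λ () ; part-unique = λ _ → [] ; part-dead = λ _ ()
    ; bound = m≤m+n _ _ }
  ... | inj₂ (a , a∈ , J , J∈ , W , W≤w , hit) = record
    { core = core ; core⊆ = proj₁ ∘ ∈-filter⁻ (¬? ∘ agreeOn? J a) {xs = F} ∘ core⊆ ; core-unique = core-unique ; core-robust = core-robust
    ; part = part′ ; part⊆ = λ {J′} → add⊆ J′ (J′ ≟ˢ J) ; part-unique = λ J′ → add-unique J′ (J′ ≟ˢ J) ; part-dead = λ J′ → add-dead J′ (J′ ≟ˢ J)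
    ; bound = bound′ }
    where
    group = filter (agreeOn? J a) F
    rest = filter (¬? ∘ agreeOn? J a) F
    a∈group : a ∈ˡ group
    a∈group = ∈-filter⁺ (agreeOn? J a) a∈ (λ _ _ → refl)
    open Peeled (peel Js rest (Unique.filter⁺ (¬? ∘ agreeOn? J a) u)
      (rs (filter-notAll (¬? ∘ agreeOn? J a) F (lose a∈ (λ ¬agree → ¬agree λ _ _ → refl)))))
    Hits : A → Fin k × Fin n → Set
    Hits b (i , v) = i ∉ J × τ b i ≡ v
    hits? : ∀ b o → Dec (Hits b o)
    hits? b (i , v) = ¬? (i ∈? J) ×-dec (τ b i Fin.≟ v)
    os = cartesianProduct (allFin k) W
    nonempty : 1 ≤ length group
    nonempty with group | a∈group
    ... | _ ∷ _ | _ = s≤s z≤n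
    pop = popular Hits hits? group os nonempty (λ {b} b∈ →
      let b∈F , agree = ∈-filter⁻ (agreeOn? J a) {xs = F} b∈
          i , i∉ , τ∈ = hit b∈F agree
      in (i , τ b i) , ∈-cartesianProduct⁺ (∈-allFin i) τ∈ , i∉ , refl)
    i₀ = proj₁ (proj₁ pop)
    dense = filter (λ b → hits? b (proj₁ pop)) group
    dense⇒ : ∀ {b} → b ∈ˡ dense → b ∈ˡ F × AgreeOn J a b × Hits b (proj₁ pop)
    dense⇒ b∈ = let b∈g , h = ∈-filter⁻ (λ b → hits? b (proj₁ pop)) {xs = group} b∈
                    b∈F , ag = ∈-filter⁻ (agreeOn? J a) {xs = F} b∈g in b∈F , ag , h
    part⇒ : ∀ {b J′} → b ∈ˡ part J′ → b ∈ˡ F × ¬ AgreeOn J a b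
    part⇒ b∈ = ∈-filter⁻ (¬? ∘ agreeOn? J a) {xs = F} (part⊆ b∈)
    add : (J′ : Subset k) → Dec (J′ ≡ J) → List A
    add J′ (yes _) = dense ++ part J′
    add J′ (no _) = part J′
    part′ : Subset k → List A
    part′ J′ = add J′ (J′ ≟ˢ J)
    add⊆ : ∀ J′ d {b} → b ∈ˡ add J′ d → b ∈ˡ F
    add⊆ J′ (no _) b∈ = proj₁ (part⇒ b∈)
    add⊆ J′ (yes _) b∈ = [ proj₁ ∘ dense⇒ , proj₁ ∘ part⇒ {J′ = J′} ]′ (∈-++⁻ dense b∈)
    add-unique : ∀ J′ d → Unique (add J′ d)
    add-unique J′ (no _) = part-unique J′
    add-unique J′ (yes _) =
      Unique.++⁺ (Unique.filter⁺ (λ b → hits? b (proj₁ pop)) (Unique.filter⁺ (agreeOn? J a) u)) (part-unique J′)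
        (λ (p , q) → proj₂ (part⇒ q) (proj₁ (proj₂ (dense⇒ p))))
    dense++part-dead : ∀ {b c} → b ∈ˡ dense ⊎ b ∈ˡ part J → c ∈ˡ dense ⊎ c ∈ˡ part J → AgreeOn J b c → ∃[ i ] i ∉ J × τ b i ≡ τ c i
    dense++part-dead (inj₁ p) (inj₁ q) agree = let _ , _ , i∉ , e = dense⇒ p ; _ , _ , _ , e′ = dense⇒ q in i₀ , i∉ , trans e (sym e′)
    dense++part-dead (inj₂ p) (inj₂ q) agree = part-dead J p q agree
    dense++part-dead (inj₁ p) (inj₂ q) agree = contradiction (λ i i∈ → trans (proj₁ (proj₂ (dense⇒ p)) i i∈) (agree i i∈)) (proj₂ (part⇒ q))
    dense++part-dead (inj₂ p) (inj₁ q) agree = contradiction (λ i i∈ → trans (proj₁ (proj₂ (dense⇒ q)) i i∈) (sym (agree i i∈))) (proj₂ (part⇒ p))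
    add-dead : ∀ J′ d → Dead (add J′ d) J′
    add-dead J′ (no _) = part-dead J′
    add-dead J′ (yes refl) b∈ c∈ = dense++part-dead (∈-++⁻ dense b∈) (∈-++⁻ dense c∈)
    add-grows : ∀ J′ d → length (part J′) ≤ length (add J′ d)
    add-grows J′ (no _) = ≤-refl
    add-grows J′ (yes _) = ≤-trans (m≤n+m _ (length dense)) (≤-reflexive (sym (length-++ dense)))
    add-grows-at : ∀ d → length dense + length (part J) ≤ length (add J d)
    add-grows-at (no ¬p) = contradiction refl ¬p
    add-grows-at (yes _) = ≤-reflexive (sym (length-++ dense))
    open ≤-Reasoning
    Σpart = sum (map (length ∘ part) Js)
    bound′ : length F ≤ length core + k * w * sum (map (length ∘ part′) Js)
    bound′ = begin
      length F                                                        ≡⟨ length-filter-split (agreeOn? J a) F ⟩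
      length group + length rest                                      ≤⟨ +-mono-≤ (proj₂ pop) bound ⟩
      length os * length dense + (length core + k * w * Σpart)        ≤⟨ +-monoˡ-≤ _ (*-monoˡ-≤ (length dense) os≤) ⟩
      k * w * length dense + (length core + k * w * Σpart)            ≡⟨ arith (k * w) (length dense) (length core) Σpart ⟩
      length core + k * w * (length dense + Σpart)                    ≤⟨ +-monoʳ-≤ (length core) (*-monoʳ-≤ (k * w) (sum-map-bump (λ J′ → add-grows J′ (J′ ≟ˢ J)) (add-grows-at (J ≟ˢ J)) Js J∈)) ⟩
      length core + k * w * sum (map (length ∘ part′) Js)             ∎
      where
      arith : ∀ q d c s → q * d + (c + q * s) ≡ c + q * (d + s)
      arith = solve-∀
      os≤ : length os ≤ k * w
      os≤ = begin
        length os                    ≡⟨ length-cartesianProductWith _,_ (allFin k) W ⟩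
        length (allFin k) * length W ≡⟨ cong (_* length W) (length-tabulate {n = k} id) ⟩
        k * length W                 ≤⟨ *-monoʳ-≤ k W≤w ⟩
        k * w                        ∎

  record Homogeneity (Js : List (Subset k)) (F : List A) (M : ℕ) : Set where
    field
      family : List A
      family⊆ : ∀ {a} → a ∈ˡ family → a ∈ˡ F
      unique : Unique family
      large : M < length family
      dead⊎robust : ∀ {J} → J ∈ˡ Js → Dead family J ⊎ (∀ {a} → a ∈ˡ family → Robust family J a)

  -- If the core is too small, some dead part is large. Since deadness is hereditary, that `J` is
  -- settled for good and the recursion continues inside the part with the other sets; `j` bounds
  -- the number of undecided ones.
  homogeneous : ∀ j Js F M → length Js ≤ j → Unique F → M * homConst k w j < length F → Homogeneity Js F M
  homogeneous j [] F M le u lt = record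
    { family = F ; family⊆ = id ; unique = u ; dead⊎robust = λ ()
    ; large = ≤-<-trans (m≤m*n′ (1≤homConst k w j)) lt }
    where
    m≤m*n′ : ∀ {c} → 1 ≤ c → M ≤ M * c
    m≤m*n′ p = ≤-trans (≤-reflexive (sym (*-identityʳ M))) (*-monoʳ-≤ M p)
  homogeneous (suc j) Js@(_ ∷ _) F M le u lt with peel Js F u (<-wellFounded _)
  ... | P with M <? length (Peeled.core P)
  ...   | yes M< = record
    { family = core ; family⊆ = core⊆ ; unique = core-unique ; large = M<
    ; dead⊎robust = λ J∈ → inj₂ (core-robust J∈) }
    where open Peeled P
  ...   | no M≮ with ∃-max (length ∘ Peeled.part P) Js (s≤s z≤n)
  ...     | J , J∈ , Σ≤ = record
    { family = family ; family⊆ = part⊆ ∘ family⊆ ; unique = unique ; large = large ; dead⊎robust = λ {J′} → status (J′ ≟ˢ J) }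
    where
    open Peeled P
    open ≤-Reasoning
    C = homConst k w j
    large-part : M * C < length (part J)
    large-part = ≰⇒> λ small → <⇒≱ lt (begin
      length F                                                  ≤⟨ bound ⟩
      length core + k * w * sum (map (length ∘ part) Js)        ≤⟨ +-mono-≤ (≮⇒≥ M≮) (*-monoʳ-≤ (k * w) Σ≤) ⟩
      M + k * w * (length Js * length (part J))                 ≤⟨ +-monoʳ-≤ M (*-monoʳ-≤ (k * w) (*-mono-≤ le small)) ⟩
      M + k * w * (suc j * (M * C))                             ≡⟨ arith M (k * w) (suc j) C ⟩
      M * (1 + k * w * (suc j * C))                             ∎)
      where
      arith : ∀ m q s c → m + q * (s * (m * c)) ≡ m * (1 + q * (s * c))
      arith = solve-∀
    others = filter (λ J′ → ¬? (J′ ≟ˢ J)) Js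
    open Homogeneity (homogeneous j others (part J) M
      (s≤s⁻¹ (≤-trans (filter-notAll (λ J′ → ¬? (J′ ≟ˢ J)) Js (lose J∈ λ ne → ne refl)) le))
      (part-unique J) large-part)
    status : ∀ {J′} → Dec (J′ ≡ J) → J′ ∈ˡ Js → Dead family J′ ⊎ (∀ {a} → a ∈ˡ family → Robust family J′ a)
    status (yes refl) _ = inj₁ (λ a∈ b∈ → part-dead J (family⊆ a∈) (family⊆ b∈))
    status (no ne) J′∈ = dead⊎robust (∈-filter⁺ (λ J′ → ¬? (J′ ≟ˢ J)) J′∈ ne)

-- Intersection-closed systems of positions.

⟦_⟧ : ∀ {n} {P : Fin n → Set} → Decidable P → Subset n
⟦ P? ⟧ = tabulate (does ∘ P?)

∈-⟦⟧⁺ : ∀ {n} {P : Fin n → Set} (P? : Decidable P) {x} → P x → x ∈ ⟦ P? ⟧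
∈-⟦⟧⁺ P? {x} p = Vec.lookup⇒[]= x _ (trans (Vec.lookup∘tabulate (does ∘ P?) x) (dec-true (P? x) p))

∈-⟦⟧⁻ : ∀ {n} {P : Fin n → Set} (P? : Decidable P) {x} → x ∈ ⟦ P? ⟧ → P x
∈-⟦⟧⁻ P? {x} x∈ with P? x | trans (sym (Vec.lookup∘tabulate (does ∘ P?) x)) (Vec.[]=⇒lookup x∈)
... | yes p | _ = p
... | no _ | ()

pair : ∀ {n} → Fin n → Fin n → Subset n
pair p q = ⁅ p ⁆ ∪ ⁅ q ⁆

∈-pair⁻ : ∀ {n} {p q x : Fin n} → x ∈ pair p q → x ≡ p ⊎ x ≡ q
∈-pair⁻ {p = p} {q} x∈ with x∈p∪q⁻ ⁅ p ⁆ ⁅ q ⁆ x∈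
... | inj₁ x∈p = inj₁ (x∈⁅y⁆⇒x≡y p x∈p)
... | inj₂ x∈q = inj₂ (x∈⁅y⁆⇒x≡y q x∈q)

pairˡ : ∀ {n} {p q : Fin n} → p ∈ pair p q
pairˡ {p = p} = x∈p∪q⁺ (inj₁ (x∈⁅x⁆ p))

pairʳ : ∀ {n} {p q : Fin n} → q ∈ pair p q
pairʳ {q = q} = x∈p∪q⁺ (inj₂ (x∈⁅x⁆ q))

∈-∁⁅⁆ : ∀ {n} {i x : Fin n} → x ≢ i → x ∈ ∁ ⁅ i ⁆
∈-∁⁅⁆ {i = i} ne = x∉p⇒x∈∁p (ne ∘ x∈⁅y⁆⇒x≡y i)

∉-∁⁅⁆ : ∀ {n} {i : Fin n} → i ∉ ∁ ⁅ i ⁆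
∉-∁⁅⁆ {i = i} i∈ = x∈∁p⇒x∉p i∈ (x∈⁅x⁆ i)

-- `Alive` abstracts the exact agreement sets of a homogeneous family. The hypothesis `cover` is
-- what more than n^(k-2) members provide: two distinct ones that differ at most in the positions i
-- and j.
module Closure {k : ℕ} (Alive : Subset k → Set) (alive? : Decidable Alive) (alive-⊤ : Alive ⊤)
  (alive-∩ : ∀ {I J} → Alive I → Alive J → Alive (I ∩ J))
  (cover : ∀ i j → i ≢ j → ∃[ J ] Alive J × (i ∉ J ⊎ j ∉ J) × (∀ m → m ≢ i → m ≢ j → m ∈ J)) where

  separated⇒alive : ∀ J → (∀ i → i ∉ J → ∃[ I ] Alive I × J ⊆ I × i ∉ I) → Alive J
  separated⇒alive J sep = let I , alive , J⊆I , out = go (allFin k) in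
    subst Alive (⊆-antisym (λ {x} x∈I → decidable-stable (x ∈? J) (λ x∉J → out (∈-allFin x) x∉J x∈I)) J⊆I) alive
    where
    go : (is : List (Fin k)) → ∃[ I ] Alive I × J ⊆ I × (∀ {i} → i ∈ˡ is → i ∉ J → i ∉ I)
    go [] = ⊤ , alive-⊤ , (λ _ → ∈⊤) , λ ()
    go (i ∷ is) with go is | i ∈? J
    ... | I , alive , J⊆I , out | yes i∈J = I , alive , J⊆I , λ { (here refl) i∉J → contradiction i∈J i∉J ; (there p) → out p }
    ... | I , alive , J⊆I , out | no i∉J with sep i i∉J
    ...   | I′ , alive′ , J⊆I′ , i∉I′ = I ∩ I′ , alive-∩ alive alive′ , (λ x∈ → x∈p∩q⁺ (J⊆I x∈ , J⊆I′ x∈)) ,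
      λ { (here refl) _ x∈ → i∉I′ (proj₂ (x∈p∩q⁻ I I′ x∈)) ; (there p) x∉J x∈ → out p x∉J (proj₁ (x∈p∩q⁻ I I′ x∈)) }

  -- In the application, no two members differ in position `i` alone; this is the tuple form of an
  -- own subset in the sense of Frankl and Füredi.
  Own : Fin k → Set
  Own i = ¬ Alive (∁ ⁅ i ⁆)

  own? : Decidable Own
  own? i = ¬? (alive? (∁ ⁅ i ⁆))

  -- J is an intersection of complements of non-own points and of pairs of own points.
  paired⇒alive : ∀ J → (∀ i → i ∉ J → Own i → ∃[ j ] j ≢ i × j ∉ J × Own j) → Alive J
  paired⇒alive J partner = separated⇒alive J sep
    where
    alive-∁⁅⁆ : ∀ {I m} → Alive I → m ∉ I → (∀ x → x ≢ m → x ∈ I) → Alive (∁ ⁅ m ⁆)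
    alive-∁⁅⁆ {I} {m} alive m∉ others = subst Alive
      (⊆-antisym (λ {x} x∈ → ∈-∁⁅⁆ (λ { refl → m∉ x∈ })) (λ {x} x∈ → others x (λ { refl → ∉-∁⁅⁆ x∈ }))) alive
    sep : ∀ i → i ∉ J → ∃[ I ] Alive I × J ⊆ I × i ∉ I
    sep i i∉J with alive? (∁ ⁅ i ⁆)
    ... | yes alive = _ , alive , (λ x∈ → ∈-∁⁅⁆ (λ { refl → i∉J x∈ })) , ∉-∁⁅⁆
    ... | no own with partner i i∉J own
    ...   | j , j≢i , j∉J , own-j with cover i j (≢-sym j≢i)
    ...     | I , alive , out , others with i ∈? I | j ∈? I
    ...       | no i∉I | _ = I , alive , (λ {x} x∈ → others x (λ { refl → i∉J x∈ }) (λ { refl → j∉J x∈ })) , i∉I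
    ...       | yes i∈I | yes j∈I = contradiction out λ { (inj₁ p) → p i∈I ; (inj₂ p) → p j∈I }
    ...       | yes i∈I | no j∉I = contradiction
                (alive-∁⁅⁆ alive j∉I (λ x x≢j → case x Fin.≟ i of λ { (yes refl) → i∈I ; (no x≢i) → others x x≢i x≢j })) own-j

  Center : Fin k → Set
  Center c = ∀ J → c ∈ J → Alive J

  record Triangle : Set where
    field
      p q r : Fin k
      p≢q : p ≢ q
      p≢r : p ≢ r
      q≢r : q ≢ r
      pq : Alive (pair p q)
      pr : Alive (pair p r)
      qr : Alive (pair q r)

  -- By `paired⇒alive`, a set can fail to be alive only if it misses exactly one own position. With
  -- no own position every position is a center, and a single own position is one itself. Otherwise
  -- three positions are wanted such that each two of them leave at least two own positions out:
  -- three non-own ones if there are two own positions, two non-own and one own if there are three,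
  -- and three own ones if there are more. The first two choices need k ≥ 5.
  center⊎triangle : 5 ≤ k → ∃ Center ⊎ Triangle
  center⊎triangle 5≤k = cases (filter own? (allFin k)) (filter (¬? ∘ own?) (allFin k))
      (trans (sym (length-filter-split own? (allFin k))) (length-tabulate {n = k} id))
      (λ own → ∈-filter⁺ own? (∈-allFin _) own) (λ p → proj₂ (∈-filter⁻ own? {xs = allFin k} p))
      (λ p → proj₂ (∈-filter⁻ (¬? ∘ own?) {xs = allFin k} p))
      (Unique.filter⁺ own? (Unique.allFin⁺ k)) (Unique.filter⁺ (¬? ∘ own?) (Unique.allFin⁺ k))
    where
    choose : ∀ {J} a b → a ≢ b → a ∉ J → b ∉ J → Own a → Own b → ∀ i → i ∉ J → Own i → ∃[ j ] j ≢ i × j ∉ J × Own j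
    choose a b a≢b a∉ b∉ oa ob i _ _ with a Fin.≟ i
    ... | no a≢i = a , a≢i , a∉ , oa
    ... | yes refl = b , ≢-sym a≢b , b∉ , ob
    out : ∀ {p q x : Fin k} → x ≢ p → x ≢ q → x ∉ pair p q
    out x≢p x≢q x∈ = [ x≢p , x≢q ]′ (∈-pair⁻ x∈)
    cases : (N M : List (Fin k)) → length N + length M ≡ k → (∀ {i} → Own i → i ∈ˡ N) → (∀ {i} → i ∈ˡ N → Own i) →
      (∀ {i} → i ∈ˡ M → ¬ Own i) → Unique N → Unique M → ∃ Center ⊎ Triangle
    cases [] [] len _ _ _ _ _ with () ← subst (5 ≤_) (sym len) 5≤k
    cases [] (c ∷ _) _ N-all _ _ _ _ = inj₁ (c , λ J _ → paired⇒alive J (λ i _ own → case N-all own of λ ()))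
    cases (c ∷ []) _ _ N-all _ _ _ _ = inj₁ (c , λ J c∈ → paired⇒alive J
      (λ i i∉ own → case N-all own of λ { (here refl) → contradiction c∈ i∉ }))
    cases (a ∷ b ∷ []) (p ∷ q ∷ r ∷ _) _ N-all N-own M-own ((a≢b ∷ []) ∷ _) ((p≢q ∷ p≢r ∷ _) ∷ (q≢r ∷ _) ∷ _) = inj₂ record
      { p = p ; q = q ; r = r ; p≢q = p≢q ; p≢r = p≢r ; q≢r = q≢r
      ; pq = alive (here refl) (there (here refl)) ; pr = alive (here refl) (there (there (here refl)))
      ; qr = alive (there (here refl)) (there (there (here refl))) }
      where
      alive : ∀ {x y} → x ∈ˡ p ∷ q ∷ r ∷ _ → y ∈ˡ p ∷ q ∷ r ∷ _ → Alive (pair x y)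
      alive x∈ y∈ = paired⇒alive _ (choose a b a≢b
        (out (λ { refl → M-own x∈ (N-own (here refl)) }) (λ { refl → M-own y∈ (N-own (here refl)) }))
        (out (λ { refl → M-own x∈ (N-own (there (here refl))) }) (λ { refl → M-own y∈ (N-own (there (here refl))) }))
        (N-own (here refl)) (N-own (there (here refl))))
    cases (_ ∷ _ ∷ []) [] len _ _ _ _ _ with s≤s (s≤s ()) ← subst (5 ≤_) (sym len) 5≤k
    cases (_ ∷ _ ∷ []) (_ ∷ []) len _ _ _ _ _ with s≤s (s≤s (s≤s ())) ← subst (5 ≤_) (sym len) 5≤k
    cases (_ ∷ _ ∷ []) (_ ∷ _ ∷ []) len _ _ _ _ _ with s≤s (s≤s (s≤s (s≤s ()))) ← subst (5 ≤_) (sym len) 5≤k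
    cases (a ∷ b ∷ d ∷ []) (p ∷ q ∷ M) _ N-all N-own M-own ((a≢b ∷ a≢d ∷ []) ∷ (b≢d ∷ []) ∷ _) ((p≢q ∷ _) ∷ _) = inj₂ record
      { p = p ; q = q ; r = a ; p≢q = p≢q ; p≢r = ≢-sym (a≢ p∈) ; q≢r = ≢-sym (a≢ q∈)
      ; pq = paired⇒alive _ (choose b d b≢d (out (b≢ p∈) (b≢ q∈)) (out (d≢ p∈) (d≢ q∈)) ob od)
      ; pr = paired⇒alive _ (choose b d b≢d (out (b≢ p∈) (≢-sym a≢b)) (out (d≢ p∈) (≢-sym a≢d)) ob od)
      ; qr = paired⇒alive _ (choose b d b≢d (out (b≢ q∈) (≢-sym a≢b)) (out (d≢ q∈) (≢-sym a≢d)) ob od) }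
      where
      p∈ : p ∈ˡ p ∷ q ∷ M
      p∈ = here refl
      q∈ : q ∈ˡ p ∷ q ∷ M
      q∈ = there (here refl)
      oa = N-own (here refl)
      ob = N-own (there (here refl))
      od = N-own (there (there (here refl)))
      a≢ : ∀ {x} → x ∈ˡ p ∷ q ∷ M → a ≢ x
      a≢ x∈ refl = M-own x∈ oa
      b≢ : ∀ {x} → x ∈ˡ p ∷ q ∷ M → b ≢ x
      b≢ x∈ refl = M-own x∈ ob
      d≢ : ∀ {x} → x ∈ˡ p ∷ q ∷ M → d ≢ x
      d≢ x∈ refl = M-own x∈ od
    cases (_ ∷ _ ∷ _ ∷ []) [] len _ _ _ _ _ with s≤s (s≤s (s≤s ())) ← subst (5 ≤_) (sym len) 5≤k
    cases (_ ∷ _ ∷ _ ∷ []) (_ ∷ []) len _ _ _ _ _ with s≤s (s≤s (s≤s (s≤s ()))) ← subst (5 ≤_) (sym len) 5≤k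
    cases (a ∷ b ∷ c ∷ d ∷ N) M _ N-all N-own M-own ((a≢b ∷ a≢c ∷ a≢d ∷ _) ∷ (b≢c ∷ b≢d ∷ _) ∷ (c≢d ∷ _) ∷ _) _ = inj₂ record
      { p = a ; q = b ; r = c ; p≢q = a≢b ; p≢r = a≢c ; q≢r = b≢c
      ; pq = paired⇒alive _ (choose c d c≢d (out (≢-sym a≢c) (≢-sym b≢c)) (out (≢-sym a≢d) (≢-sym b≢d)) oc od)
      ; pr = paired⇒alive _ (choose b d b≢d (out (≢-sym a≢b) b≢c) (out (≢-sym a≢d) (≢-sym c≢d)) ob od)
      ; qr = paired⇒alive _ (choose a d a≢d (out a≢b a≢c) (out (≢-sym b≢d) (≢-sym c≢d)) oa od) }
      where
      oa = N-own (here refl)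
      ob = N-own (there (here refl))
      oc = N-own (there (there (here refl)))
      od = N-own (there (there (there (here refl))))

-- Pointed edges and the centering of large cycle-free families.

_∖_ : ∀ {n} → Subset n → Fin n → Subset n
S ∖ c = S ∩ ∁ ⁅ c ⁆

∈-∖⁺ : ∀ {n} {S : Subset n} {c x} → x ∈ S → x ≢ c → x ∈ S ∖ c
∈-∖⁺ x∈ x≢c = x∈p∩q⁺ (x∈ , ∈-∁⁅⁆ x≢c)

∈-∖⁻ : ∀ {n} {S : Subset n} {c x} → x ∈ S ∖ c → x ∈ S × x ≢ c
∈-∖⁻ {S = S} {c} x∈ = let p , q = x∈p∩q⁻ S (∁ ⁅ c ⁆) x∈ in p , λ { refl → ∉-∁⁅⁆ q }

∖-∪ : ∀ {n} {S : Subset n} {c} → c ∈ S → (S ∖ c) ∪ ⁅ c ⁆ ≡ S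
∖-∪ {S = S} {c} c∈ = ⊆-antisym to from
  where
  to : (S ∖ c) ∪ ⁅ c ⁆ ⊆ S
  to x∈ with x∈p∪q⁻ (S ∖ c) ⁅ c ⁆ x∈
  ... | inj₁ p = proj₁ (∈-∖⁻ p)
  ... | inj₂ p rewrite x∈⁅y⁆⇒x≡y c p = c∈
  from : S ⊆ (S ∖ c) ∪ ⁅ c ⁆
  from {x} x∈ with x Fin.≟ c
  ... | yes refl = x∈p∪q⁺ (inj₂ (x∈⁅x⁆ c))
  ... | no x≢c = x∈p∪q⁺ (inj₁ (∈-∖⁺ x∈ x≢c))

∈-allSubsets : ∀ {n} (S : Subset n) → S ∈ˡ allSubsets n
∈-allSubsets [] = here refl
∈-allSubsets {suc n} (outside ∷ S) = ∈-++⁺ˡ (∈-map⁺ (outside ∷_) (∈-allSubsets S))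
∈-allSubsets {suc n} (inside ∷ S) = ∈-++⁺ʳ (map (outside ∷_) (allSubsets n)) (∈-map⁺ (inside ∷_) (∈-allSubsets S))

length-allSubsets : ∀ n → length (allSubsets n) ≡ 2 ^ n
length-allSubsets zero = refl
length-allSubsets (suc n) = trans (length-++ (map (outside ∷_) (allSubsets n)))
  (cong₂ _+_ (trans (length-map _ (allSubsets n)) (length-allSubsets n))
             (trans (length-map _ (allSubsets n)) (trans (length-allSubsets n) (sym (+-identityʳ _)))))

-- (f , c) stands for the edge f ∪ ⁅ c ⁆ with the distinguished vertex c ∉ f.
Pointed : ℕ → Set
Pointed n = Subset n × Fin n

PRob : ∀ {n} → ℕ → List (Pointed n) → Fin n → Fin n → Fin n → Set
PRob w P c y y′ = ∀ W → length W ≤ w →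
  ∃[ f ] (f , c) ∈ˡ P × y ∈ f × y′ ∈ f × (∀ {x} → x ∈ f → x ∈ˡ W → x ≡ y ⊎ x ≡ y′)

-- The witnesses for robustness lie in `P` again and keep the center, so a walk that passes from a
-- pointed edge to a witness can be continued.
SelfGood : ∀ {n} → ℕ → List (Pointed n) → Set
SelfGood w P = ∀ {f c} → (f , c) ∈ˡ P → ∀ {y y′} → y ∈ f → y′ ∈ f → PRob w P c y y′

PointedIn : ∀ {n} → List (Subset n) → List (Pointed n) → Set
PointedIn H P = ∀ {f c} → (f , c) ∈ˡ P → c ∉ f × f ∪ ⁅ c ⁆ ∈ˡ H

module Centering {n k ℓ w : ℕ} (5≤k : 5 ≤ k) (3≤ℓ : 3 ≤ ℓ) (2k≤w : k + k ≤ w) (cyc≤w : 3 * ℓ + ℓ * k ≤ w)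
  (B : List (Subset n)) (size : ∀ {S} → S ∈ˡ B → ∣ S ∣ ≡ k) (no-cycle : ¬ LinCyc B ℓ)
  {E : Set} (S : E → Subset n) (S∈ : ∀ e → S e ∈ˡ B) (τ : E → Fin k → Fin n) (τ∈ : ∀ {e} i → τ e i ∈ S e)
  (τ-inj : ∀ {e i j} → τ e i ≡ τ e j → i ≡ j) (τ-surj : ∀ {e x} → x ∈ S e → ∃[ i ] x ≡ τ e i)
  (τ-ext : ∀ {e e′} → (∀ i → τ e i ≡ τ e′ i) → e ≡ e′)
  (F : List E) (hom : Homogeneous.Homogeneity τ w (allSubsets k) F (n ^ (k ∸ 2))) where

  open Homogeneous τ w

  private
    open Homogeneity hom renaming (large to family-large)

    some : ∃[ e ] e ∈ˡ family
    some with family | family-large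
    ... | e ∷ _ | _ = e , here refl

    e₀ : E
    e₀ = proj₁ some

    e₀∈ : e₀ ∈ˡ family
    e₀∈ = proj₂ some

  Alive : Subset k → Set
  Alive J = ∀ {a} → a ∈ˡ family → Robust family J a

  private
    |S| : ∀ e → length (elems (S e)) ≤ k
    |S| e = ≤-reflexive (trans (length-elems (S e)) (size (S∈ e)))

    k≤w : k ≤ w
    k≤w = ≤-trans (m≤m+n k k) 2k≤w

    ¬dead : ∀ {J} → ¬ Dead family J → Alive J
    ¬dead {J} nd with dead⊎robust (∈-allSubsets J)
    ... | inj₁ d = contradiction (λ {a} {b} → d {a} {b}) nd
    ... | inj₂ r = r

    -- With all vertices of `e₀` as obstacles, robustness yields a member whose agreement set with
    -- `e₀` is exactly `J`.
    dead⇒¬alive : ∀ {J} → Dead family J → ¬ Alive J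
    dead⇒¬alive {J} dead alive with alive e₀∈ (elems (S e₀)) (≤-trans (|S| e₀) k≤w)
    ... | b , b∈ , agree , avoid with dead e₀∈ b∈ agree
    ...   | i , i∉ , eq = avoid i i∉ (∈-elems⁺ (subst (_∈ S e₀) eq (τ∈ i)))

    alive? : Decidable Alive
    alive? J with dead⊎robust (∈-allSubsets J)
    ... | inj₁ d = no (dead⇒¬alive d)
    ... | inj₂ r = yes r

    alive-⊤ : Alive ⊤
    alive-⊤ {a} a∈ W _ = a , a∈ , (λ _ _ → refl) , λ i i∉ → contradiction ∈⊤ i∉

    -- Choose b agreeing with `e₀` exactly on I, then c agreeing with `e₀` exactly on J and
    -- otherwise avoiding both `e₀` and b. The agreement set of b and c is then exactly I ∩ J. The
    -- obstacles of the second choice fill two edges, hence 2k ≤ w.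
    alive-∩ : ∀ {I J} → Alive I → Alive J → Alive (I ∩ J)
    alive-∩ {I} {J} aI aJ = ¬dead λ dead → conflict dead
      where
      conflict : ¬ Dead family (I ∩ J)
      conflict dead with aI e₀∈ (elems (S e₀)) (≤-trans (|S| e₀) k≤w)
      ... | b , b∈ , agree , avoid with aJ e₀∈ (elems (S e₀) ++ elems (S b))
             (≤-trans (≤-reflexive (length-++ (elems (S e₀)))) (≤-trans (+-mono-≤ (|S| e₀) (|S| b)) 2k≤w))
      ...   | c , c∈ , agree′ , avoid′ with dead b∈ c∈ (λ i i∈ → let p , q = x∈p∩q⁻ I J i∈ in trans (sym (agree i p)) (agree′ i q))
      ...     | i , i∉ , eq with i ∈? J
      ...       | no i∉J = avoid′ i i∉J (∈-++⁺ʳ (elems (S e₀)) (∈-elems⁺ (subst (_∈ S b) eq (τ∈ i))))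
      ...       | yes i∈J = avoid i (λ i∈I → i∉ (x∈p∩q⁺ (i∈I , i∈J))) (∈-elems⁺ (subst (_∈ S e₀) (trans (agree′ i i∈J) (sym eq)) (τ∈ i)))

    -- With positions i and j forgotten, at most n^(k-2) words remain, fewer than there are members.
    -- Two members with the same word have an agreement set that cannot be dead, and being distinct
    -- they do not agree at both i and j.
    cover : ∀ i j → i ≢ j → ∃[ J ] Alive J × (i ∉ J ⊎ j ∉ J) × (∀ m → m ≢ i → m ≢ j → m ∈ J)
    cover i j i≢j = J , ¬dead not-dead , missing , λ m m≢i m≢j → ∈-⟦⟧⁺ agree? (agree m m≢i m≢j)
      where
      other? : ∀ m → Dec (m ≢ i × m ≢ j)
      other? m = ¬? (m Fin.≟ i) ×-dec ¬? (m Fin.≟ j)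
      ms = filter other? (allFin k)
      code : E → List (Fin n)
      code e = map (τ e) ms
      2+ms≤k : 2 + length ms ≤ k
      2+ms≤k = ≤-trans (Unique-⊆-length {xs = i ∷ j ∷ ms}
          (Unique-∷⁺ (λ { (here e) → i≢j e ; (there p) → proj₁ (proj₂ (∈-filter⁻ other? {xs = allFin k} p)) refl })
            (Unique-∷⁺ (λ p → proj₂ (proj₂ (∈-filter⁻ other? {xs = allFin k} p)) refl) (Unique.filter⁺ other? (Unique.allFin⁺ k))))
          (λ {x} _ → ∈-allFin x))
        (≤-reflexive (length-tabulate {n = k} id))
      open ≤-Reasoning
      few : length (words (length ms) (allFin n)) < length family
      few = begin-strict
        length (words (length ms) (allFin n)) ≡⟨ length-words (length ms) (allFin n) ⟩
        length (allFin n) ^ length ms         ≡⟨ cong (_^ length ms) (length-tabulate {n = n} id) ⟩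
        n ^ length ms                         ≤⟨ ^-monoʳ-≤ n {{Fin.nonZeroIndex (τ e₀ i)}} (∸-monoˡ-≤ 2 2+ms≤k) ⟩
        n ^ (k ∸ 2)                           <⟨ family-large ⟩
        length family                         ∎
      collision = pigeonhole (List.≡-dec Fin._≟_) code family (words (length ms) (allFin n)) unique
        (λ {e} _ → subst (λ z → code e ∈ˡ words z (allFin n)) (length-map (τ e) ms) (∈-words (allFin n) (code e) (λ {y} _ → ∈-allFin y))) few
      a = proj₁ collision
      b = proj₁ (proj₂ collision)
      a∈ = proj₁ (proj₂ (proj₂ collision))
      b∈ = proj₁ (proj₂ (proj₂ (proj₂ collision)))
      a≢b = proj₁ (proj₂ (proj₂ (proj₂ (proj₂ collision))))
      same = proj₂ (proj₂ (proj₂ (proj₂ (proj₂ collision))))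
      map-eq : ∀ {xs m} → map (τ a) xs ≡ map (τ b) xs → m ∈ˡ xs → τ a m ≡ τ b m
      map-eq {x ∷ xs} eq (here refl) = proj₁ (List.∷-injective eq)
      map-eq {x ∷ xs} eq (there p) = map-eq (proj₂ (List.∷-injective eq)) p
      agree : ∀ m → m ≢ i → m ≢ j → τ a m ≡ τ b m
      agree m m≢i m≢j = map-eq same (∈-filter⁺ other? (∈-allFin m) (m≢i , m≢j))
      agree? : Decidable (λ m → τ a m ≡ τ b m)
      agree? m = τ a m Fin.≟ τ b m
      J = ⟦ agree? ⟧
      not-dead : ¬ Dead family J
      not-dead dead with dead a∈ b∈ (λ m m∈ → ∈-⟦⟧⁻ agree? m∈)
      ... | m , m∉ , eq = m∉ (∈-⟦⟧⁺ agree? eq)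
      missing : i ∉ J ⊎ j ∉ J
      missing with i ∈? J | j ∈? J
      ... | no i∉ | _ = inj₁ i∉
      ... | yes _ | no j∉ = inj₂ j∉
      ... | yes i∈ | yes j∈ = contradiction (τ-ext all-agree) a≢b
        where
        all-agree : ∀ m → τ a m ≡ τ b m
        all-agree m with m Fin.≟ i | m Fin.≟ j
        ... | yes refl | _ = ∈-⟦⟧⁻ agree? i∈
        ... | no _ | yes refl = ∈-⟦⟧⁻ agree? j∈
        ... | no m≢i | no m≢j = agree m m≢i m≢j

    open Closure Alive alive? alive-⊤ (λ {I} {J} → alive-∩ {I} {J}) cover

    robust⇒Rob : ∀ {a} p q → a ∈ˡ family → Alive (pair p q) → Rob B w (τ a p ∷ τ a q ∷ [])
    robust⇒Rob {a} p q a∈ alive W le with alive a∈ W le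
    ... | b , b∈ , agree , avoid = S b , S∈ b , through , outside-W
      where
      through : ∀ {x} → x ∈ˡ τ a p ∷ τ a q ∷ [] → x ∈ S b
      through (here refl) = subst (_∈ S b) (sym (agree p pairˡ)) (τ∈ p)
      through (there (here refl)) = subst (_∈ S b) (sym (agree q (pairʳ {p = p}))) (τ∈ q)
      outside-W : ∀ {x} → x ∈ S b → x ∈ˡ W → x ∈ˡ τ a p ∷ τ a q ∷ []
      outside-W x∈ x∈W with τ-surj x∈
      ... | i , refl with i ∈? pair p q
      ...   | no i∉ = contradiction x∈W (avoid i i∉)
      ...   | yes i∈ with ∈-pair⁻ i∈
      ...     | inj₁ refl = here (sym (agree i i∈))
      ...     | inj₂ refl = there (here (sym (agree i i∈)))

    swap : ∀ {a b : Fin n} → Rob B w (a ∷ b ∷ []) → Rob B w (b ∷ a ∷ [])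
    swap = Rob-resp {w = w} (there (here refl) ∷ here refl ∷ []) (there (here refl) ∷ here refl ∷ [])

    Fan : Fin k → Fin k → ℕ → Set
    Fan p q m = ∃[ a ] ∃[ us ] a ∈ˡ family × length us ≡ suc m × Unique (τ a q ∷ us) ×
      Linked (λ x y → Rob B w (x ∷ y ∷ [])) (τ a q ∷ us) × lastOf (τ a q) us ≡ τ a p

    -- The vertex in position p is common to all the edges used, while the other one alternates between positions q and r.
    fan : ∀ m p q r → p ≢ q → p ≢ r → q ≢ r → Alive (pair p q) → Alive (pair p r) → Alive (pair q r) → Alive (pair r q) →
      m + 2 ≤ w → Fan p q m
    fan zero p q r p≢q _ _ pq _ _ _ _ = e₀ , [ τ e₀ p ] , e₀∈ , refl ,
      Unique-∷⁺ (λ { (here e) → p≢q (sym (τ-inj e)) }) (Unique-∷⁺ (λ ()) []) ,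
      swap (robust⇒Rob p q e₀∈ pq) ∷ [-] , refl
    fan (suc m) p q r p≢q p≢r q≢r pq pr qr rq m≤w with fan m p r q p≢r p≢q (≢-sym q≢r) pr pq rq qr (≤-trans (n≤1+n _) m≤w)
    ... | a , us , a∈ , len , u , linked , last with pr a∈ (τ a r ∷ us) (≤-trans (≤-reflexive (trans (cong suc len) (+-comm 2 m))) (≤-trans (n≤1+n _) m≤w))
    ...   | b , b∈ , agree , avoid = b , τ a r ∷ us , b∈ , cong suc len , Unique-∷⁺ (avoid q (λ q∈ → [ p≢q ∘ sym , q≢r ]′ (∈-pair⁻ q∈))) u ,
      subst (λ z → Rob B w (τ b q ∷ z ∷ [])) (sym (agree r (pairʳ {p = p}))) (robust⇒Rob q r b∈ qr) ∷ linked ,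
      trans last (agree p pairˡ)

    pair-comm : ∀ {p q : Fin k} → pair p q ≡ pair q p
    pair-comm = ⊆-antisym flip flip
      where
      flip : ∀ {p q : Fin k} → pair p q ⊆ pair q p
      flip {p} x∈ = x∈p∪q⁺ (case ∈-pair⁻ x∈ of λ { (inj₁ refl) → inj₂ (x∈⁅x⁆ _) ; (inj₂ refl) → inj₁ (x∈⁅x⁆ _) })

    -- The two ends of a fan are the vertices of one member in positions p and q, a robust pair, so
    -- the fan closes. A fan with parameter m has m + 2 vertices, hence `ℓ ∸ 2`.
    triangle⇒cycle : Triangle → LinCyc B ℓ
    triangle⇒cycle T = close (fan (ℓ ∸ 2) p q r p≢q p≢r q≢r pq pr qr (subst Alive pair-comm qr) ℓ≤w)
      where
      open Triangle T
      ℓ≡ : ℓ ∸ 2 + 2 ≡ ℓ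
      ℓ≡ = m∸n+n≡m (≤-trans (n≤1+n 2) 3≤ℓ)
      ℓ≤w : ℓ ∸ 2 + 2 ≤ w
      ℓ≤w = ≤-trans (≤-reflexive ℓ≡) (≤-trans (m≤m+n ℓ _) (≤-trans (m≤m+n (3 * ℓ) (ℓ * k)) cyc≤w))
      close : Fan p q (ℓ ∸ 2) → LinCyc B ℓ
      close (a , us , a∈ , len , u , linked , last) = subst (LinCyc B) length≡
        (embed-list B size (τ a q) us (τ a q)
          (subst (λ z → 3 * z + z * k ≤ w) (sym length≡) cyc≤w)
          u linked
          (subst (λ z → Rob B w (z ∷ τ a q ∷ τ a q ∷ [])) (sym last)
            (Rob-resp {w = w} (here refl ∷ there (here refl) ∷ [])
                      (here refl ∷ there (here refl) ∷ there (here refl) ∷ [])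
                      (robust⇒Rob p q a∈ pq)))
          (λ _ → inj₂ refl))
        where
        length≡ : length (τ a q ∷ us) ≡ ℓ
        length≡ = trans (cong suc len) (trans (+-comm 2 (ℓ ∸ 2)) ℓ≡)

    -- For two further vertices in positions i and j, the set {c, i, j} contains the center and is
    -- alive. Its witnesses agree in position c, so they are pointed at the same vertex.
    centered : ∃ Center → ∃[ P ] 0 < length P × PointedIn B P × SelfGood w P
    centered (c , center) = P , 0<P , in-B , good
      where
      point : E → Pointed n
      point e = S e ∖ τ e c , τ e c
      P = map point family
      0<P : 0 < length P
      0<P = ≤-<-trans z≤n (<-≤-trans family-large (≤-reflexive (sym (length-map point family))))
      in-B : PointedIn B P
      in-B p∈ with ∈-map⁻ point p∈
      ... | e , e∈ , refl = (λ x∈ → proj₂ (∈-∖⁻ x∈) refl) , subst (_∈ˡ B) (sym (∖-∪ (τ∈ c))) (S∈ e)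
      good : SelfGood w P
      good p∈ y∈ y′∈ with ∈-map⁻ point p∈
      ... | e , e∈ , refl with ∈-∖⁻ y∈ | ∈-∖⁻ y′∈
      ...   | y∈S , y≢c | y′∈S , y′≢c with τ-surj y∈S | τ-surj y′∈S
      ...     | i , refl | j , refl = λ W le → extract W (center (⁅ c ⁆ ∪ pair i j) (x∈p∪q⁺ (inj₁ (x∈⁅x⁆ c))) e∈ W le)
        where
        J = ⁅ c ⁆ ∪ pair i j
        c∈J : c ∈ J
        c∈J = x∈p∪q⁺ (inj₁ (x∈⁅x⁆ c))
        i∈J : i ∈ J
        i∈J = x∈p∪q⁺ (inj₂ pairˡ)
        j∈J : j ∈ J
        j∈J = x∈p∪q⁺ (inj₂ (pairʳ {p = i}))
        extract : ∀ W → (∃[ b ] b ∈ˡ family × AgreeOn J e b × (∀ m → m ∉ J → τ b m ∉ˡ W)) →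
          ∃[ f ] (f , τ e c) ∈ˡ P × τ e i ∈ f × τ e j ∈ f × (∀ {x} → x ∈ f → x ∈ˡ W → x ≡ τ e i ⊎ x ≡ τ e j)
        extract W (b , b∈ , agree , avoid) = S b ∖ τ b c ,
          subst (λ z → (S b ∖ τ b c , z) ∈ˡ P) (sym (agree c c∈J)) (∈-map⁺ point b∈) ,
          ∈-∖⁺ (subst (_∈ S b) (sym (agree i i∈J)) (τ∈ i)) (λ eq → y≢c (trans eq (sym (agree c c∈J)))) ,
          ∈-∖⁺ (subst (_∈ S b) (sym (agree j j∈J)) (τ∈ j)) (λ eq → y′≢c (trans eq (sym (agree c c∈J)))) ,
          hits
          where
          hits : ∀ {x} → x ∈ S b ∖ τ b c → x ∈ˡ W → x ≡ τ e i ⊎ x ≡ τ e j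
          hits x∈ x∈W with ∈-∖⁻ x∈
          ... | x∈S , x≢c with τ-surj x∈S
          ...   | m , refl with m ∈? J
          ...     | no m∉ = contradiction x∈W (avoid m m∉)
          ...     | yes m∈ with x∈p∪q⁻ ⁅ c ⁆ (pair i j) m∈
          ...       | inj₁ m∈c = contradiction (cong (τ b) (x∈⁅y⁆⇒x≡y c m∈c)) x≢c
          ...       | inj₂ m∈ij with ∈-pair⁻ m∈ij
          ...         | inj₁ refl = inj₁ (sym (agree m m∈))
          ...         | inj₂ refl = inj₂ (sym (agree m m∈))

  selfGood : ∃[ P ] 0 < length P × PointedIn B P × SelfGood w P
  selfGood = [ centered , (λ T → contradiction (triangle⇒cycle T) no-cycle) ]′ (center⊎triangle 5≤k)

sparseConst : (k w : ℕ) → ℕ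
sparseConst k w = homConst k w (2 ^ k)

-- Used contrapositively twice: for the edges that survive the deletion process and for the edges
-- outside a container. Positions in an edge come from listing it increasingly; the exponent 2^k in
-- the constant's index counts all possible agreement sets.
large⇒selfGood : ∀ {n k ℓ w} → 5 ≤ k → 3 ≤ ℓ → k + k ≤ w → 3 * ℓ + ℓ * k ≤ w →
  (B : List (Subset n)) → Unique B → (∀ {S} → S ∈ˡ B → ∣ S ∣ ≡ k) → ¬ LinCyc B ℓ →
  n ^ (k ∸ 2) * sparseConst k w < length B →
  ∃[ P ] 0 < length P × PointedIn B P × SelfGood w P
large⇒selfGood {n} {k} {ℓ} {w} 5≤k 3≤ℓ 2k≤w cyc≤w B B-unique size no-cycle large =
  Centering.selfGood 5≤k 3≤ℓ 2k≤w cyc≤w B size no-cycle S (λ e → ∈-lookup e) τ (λ {e} → τ∈ {e}) (λ {e} → τ-inj {e}) τ-surj τ-ext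
    (allFin (length B))
    (Homogeneous.homogeneous τ w (2 ^ k) (allSubsets k) (allFin (length B)) (n ^ (k ∸ 2))
      (≤-reflexive (length-allSubsets k)) (Unique.allFin⁺ (length B))
      (<-≤-trans large (≤-reflexive (sym (length-tabulate {n = length B} id)))))
  where
  E : Set
  E = Fin (length B)
  S : E → Subset n
  S = lookup B
  len : ∀ e → length (elems (S e)) ≡ k
  len e = trans (length-elems (S e)) (size (∈-lookup e))
  τ : E → Fin k → Fin n
  τ e i = lookup (elems (S e)) (cast (sym (len e)) i)
  τ∈ : ∀ {e} i → τ e i ∈ S e
  τ∈ {e} i = ∈-elems⁻ (∈-lookup (cast (sym (len e)) i))
  τ-inj : ∀ {e i j} → τ e i ≡ τ e j → i ≡ j
  τ-inj {e} {i} {j} eq = Fin.toℕ-injective (trans (sym (Fin.toℕ-cast (sym (len e)) i))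
    (trans (cong toℕ (lookup-injective (elems-unique (S e)) eq)) (Fin.toℕ-cast (sym (len e)) j)))
  τ-surj : ∀ {e x} → x ∈ S e → ∃[ i ] x ≡ τ e i
  τ-surj {e} x∈ = let p = ∈-elems⁺ x∈ in cast (len e) (index p) ,
    trans (lookup-index p) (cong (lookup (elems (S e)))
      (Fin.toℕ-injective (sym (trans (Fin.toℕ-cast (sym (len e)) (cast (len e) (index p))) (Fin.toℕ-cast (len e) (index p))))))
  τ-ext : ∀ {e e′} → (∀ i → τ e i ≡ τ e′ i) → e ≡ e′
  τ-ext {e} {e′} eq = lookup-injective B-unique (⊆-antisym
    (λ x∈ → let i , x≡ = τ-surj x∈ in subst (_∈ S e′) (sym (trans x≡ (eq i))) (τ∈ {e′} i))
    (λ x∈ → let i , x≡ = τ-surj x∈ in subst (_∈ S e) (sym (trans x≡ (sym (eq i)))) (τ∈ {e} i)))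

-- Zigzag cycles

-- Splitting by one vertex of vs at a time and keeping the larger half.
refine : {B : Set} (R : B → A → Set) (R? : ∀ v f → Dec (R v f)) (vs : List B) (fs : List A) (m : ℕ) → m * 2 ^ length vs ≤ length fs →
  {D : A → A → Set} → AllPairs D fs →
  ∃[ fs′ ] m ≤ length fs′ × (∀ {f} → f ∈ˡ fs′ → f ∈ˡ fs) × AllPairs D fs′ ×
    (∀ {f f′ v} → f ∈ˡ fs′ → f′ ∈ˡ fs′ → v ∈ˡ vs → R v f → R v f′)
refine R R? [] fs m le ps = fs , ≤-trans (≤-reflexive (sym (*-identityʳ m))) le , id , ps , λ _ _ ()
refine {A} R R? (v ∷ vs) fs m le ps = [ keep (R? v) (λ r _ _ → r) , keep (¬? ∘ R? v) (λ _ ¬r r → contradiction r ¬r) ]′ half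
  where
  open ≤-Reasoning
  ins = filter (R? v) fs
  outs = filter (¬? ∘ R? v) fs
  half : m * 2 ^ length vs ≤ length ins ⊎ m * 2 ^ length vs ≤ length outs
  half with m * 2 ^ length vs ≤? length ins
  ... | yes p = inj₁ p
  ... | no ¬p = inj₂ (+-cancelˡ-≤ (length ins) _ _ (begin
    length ins + m * 2 ^ length vs            ≤⟨ +-monoˡ-≤ _ (<⇒≤ (≰⇒> ¬p)) ⟩
    m * 2 ^ length vs + m * 2 ^ length vs     ≡⟨ arith m (2 ^ length vs) ⟩
    m * (2 * 2 ^ length vs)                   ≤⟨ le ⟩
    length fs                                 ≡⟨ length-filter-split (R? v) fs ⟩
    length ins + length outs                  ∎))
    where
    arith : ∀ a b → a * b + a * b ≡ a * (2 * b)
    arith = solve-∀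
  keep : {Q : A → Set} (Q? : Decidable Q) → (∀ {f f′} → Q f′ → Q f → R v f → R v f′) → m * 2 ^ length vs ≤ length (filter Q? fs) →
    ∃[ fs′ ] m ≤ length fs′ × (∀ {f} → f ∈ˡ fs′ → f ∈ˡ fs) × AllPairs _ fs′ ×
      (∀ {f f′ v′} → f ∈ˡ fs′ → f′ ∈ˡ fs′ → v′ ∈ˡ v ∷ vs → R v′ f → R v′ f′)
  keep Q? same le′ with refine R R? vs (filter Q? fs) m le′ (AllPairs.filter⁺ Q? ps)
  ... | fs′ , m≤ , fs′⊆ , ps′ , same′ = fs′ , m≤ , proj₁ ∘ ∈-filter⁻ Q? ∘ fs′⊆ , ps′ , λ
    { p q (here refl) → same (proj₂ (∈-filter⁻ Q? {xs = fs} (fs′⊆ q))) (proj₂ (∈-filter⁻ Q? {xs = fs} (fs′⊆ p)))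
    ; p q (there v∈) → same′ p q v∈ }

∣∪⁅⁆∣ : ∀ {n} {f : Subset n} {c} → c ∉ f → ∣ f ∪ ⁅ c ⁆ ∣ ≡ suc ∣ f ∣
∣∪⁅⁆∣ {f = f} {c} c∉ = trans (sym (length-elems (f ∪ ⁅ c ⁆))) (trans (≤-antisym
  (Unique-⊆-length {ys = c ∷ elems f} (elems-unique (f ∪ ⁅ c ⁆)) to)
  (Unique-⊆-length {xs = c ∷ elems f} (Unique-∷⁺ (c∉ ∘ ∈-elems⁻) (elems-unique f)) from)) (cong suc (length-elems f)))
  where
  to : ∀ {x} → x ∈ˡ elems (f ∪ ⁅ c ⁆) → x ∈ˡ c ∷ elems f
  to x∈ with x∈p∪q⁻ f ⁅ c ⁆ (∈-elems⁻ x∈)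
  ... | inj₁ p = there (∈-elems⁺ p)
  ... | inj₂ p = here (x∈⁅y⁆⇒x≡y c p)
  from : ∀ {x} → x ∈ˡ c ∷ elems f → x ∈ˡ elems (f ∪ ⁅ c ⁆)
  from (here refl) = ∈-elems⁺ {S = f ∪ ⁅ c ⁆} (x∈p∪q⁺ {p = f} (inj₂ (x∈⁅x⁆ c)))
  from (there x∈) = ∈-elems⁺ {S = f ∪ ⁅ c ⁆} (x∈p∪q⁺ {p = f} (inj₁ (∈-elems⁻ x∈)))

∃-other : ∀ {n} (f : Subset n) (y : Fin n) → 2 ≤ ∣ f ∣ → ∃[ x ] x ∈ f × x ≢ y
∃-other f y 2≤ = pick (elems f) (elems-unique f) ∈-elems⁻ (≤-trans 2≤ (≤-reflexive (sym (length-elems f))))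
  where
  pick : ∀ xs → Unique xs → (∀ {x} → x ∈ˡ xs → x ∈ f) → 2 ≤ length xs → ∃[ x ] x ∈ f × x ≢ y
  pick (_ ∷ []) _ _ (s≤s ())
  pick (a ∷ b ∷ _) ((a≢b ∷ _) ∷ _) ∈f _ with a Fin.≟ y
  ... | no a≢y = a , ∈f (here refl) , a≢y
  ... | yes refl = b , ∈f (there (here refl)) , ≢-sym a≢b

_∈ᴾ?_ : ∀ {n} (p : Pointed n) (P : List (Pointed n)) → Dec (p ∈ˡ P)
p ∈ᴾ? P = any? (×-≡-dec _≟ˢ_ Fin._≟_ p) P

centers : ∀ {n} → List (Pointed n) → Subset n → List (Fin n)
centers {n} P f = filter (λ c → (f , c) ∈ᴾ? P) (allFin n)

∈-centers⁺ : ∀ {n} {P : List (Pointed n)} {f c} → (f , c) ∈ˡ P → c ∈ˡ centers P f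
∈-centers⁺ {P = P} {f} {c} p = ∈-filter⁺ (λ c → (f , c) ∈ᴾ? P) (∈-allFin c) p

∈-centers⁻ : ∀ {n} {P : List (Pointed n)} {f c} → c ∈ˡ centers P f → (f , c) ∈ˡ P
∈-centers⁻ {n} {P} {f} p = proj₂ (∈-filter⁻ (λ c → (f , c) ∈ᴾ? P) {xs = allFin n} p)

centers-unique : ∀ {n} (P : List (Pointed n)) f → Unique (centers P f)
centers-unique {n} P f = Unique.filter⁺ (λ c → (f , c) ∈ᴾ? P) (Unique.allFin⁺ n)

PRob⇒Rob : ∀ {n w} {H : List (Subset n)} {P c y y′} → PointedIn H P → PRob w P c y y′ → Rob H w (c ∷ y ∷ y′ ∷ [])
PRob⇒Rob {c = c} {y} {y′} in-H rob W le with rob W le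
... | f , p , y∈ , y′∈ , avoid = f ∪ ⁅ c ⁆ , proj₂ (in-H p) , through , outside-W
  where
  through : ∀ {x} → x ∈ˡ c ∷ y ∷ y′ ∷ [] → x ∈ f ∪ ⁅ c ⁆
  through (here refl) = x∈p∪q⁺ (inj₂ (x∈⁅x⁆ c))
  through (there (here refl)) = x∈p∪q⁺ (inj₁ y∈)
  through (there (there (here refl))) = x∈p∪q⁺ (inj₁ y′∈)
  outside-W : ∀ {x} → x ∈ f ∪ ⁅ c ⁆ → x ∈ˡ W → x ∈ˡ c ∷ y ∷ y′ ∷ []
  outside-W x∈ x∈W with x∈p∪q⁻ f ⁅ c ⁆ x∈
  ... | inj₂ q = here (x∈⁅y⁆⇒x≡y c q)
  ... | inj₁ q with avoid q x∈W
  ...   | inj₁ e = there (here e)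
  ...   | inj₂ e = there (there (here e))

-- The bound `wide` pays for the obstacles at any moment of the walk: its at most 2 + 2t vertices
-- and (t+1)·2^(2+2t) candidate sets with at most k vertices each.
module Zigzag {n k t w : ℕ} (3≤k : 3 ≤ k) (H : List (Subset n)) (size : ∀ {S} → S ∈ˡ H → ∣ S ∣ ≡ k)
  (P : List (Pointed n)) (in-H : PointedIn H P) (good : SelfGood w P)
  (many : ∀ {f c} → (f , c) ∈ˡ P → t < length (centers P f))
  (wide : (2 + 2 * t) + suc t * 2 ^ (2 + 2 * t) * k ≤ w) where

  open import Data.List.Membership.DecPropositional (Fin._≟_ {n}) using () renaming (_∈?_ to _∈ˡ?_)

  prob⇒Rob : ∀ {f c y y′} → (f , c) ∈ˡ P → y ∈ f → y′ ∈ f → Rob H w (c ∷ y ∷ y′ ∷ [])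
  prob⇒Rob p y∈ y′∈ = PRob⇒Rob {w = w} in-H (good p y∈ y′∈)

  R : Fin n → Fin n → Set
  R x y = Rob H w (x ∷ y ∷ [])

  link : ∀ {f c y} → (f , c) ∈ˡ P → y ∈ f → R c y
  link p y∈ = Rob-resp {w = w}
    (here refl ∷ there (here refl) ∷ there (here refl) ∷ [])
    (here refl ∷ there (here refl) ∷ []) (prob⇒Rob p y∈ y∈)

  link′ : ∀ {f c y} → (f , c) ∈ˡ P → y ∈ f → R y c
  link′ p y∈ = Rob-resp {w = w} (there (here refl) ∷ here refl ∷ [])
    (there (here refl) ∷ here refl ∷ []) (link p y∈)

  ∣f∣≡ : ∀ {f c} → (f , c) ∈ˡ P → suc ∣ f ∣ ≡ k
  ∣f∣≡ p = let c∉ , f∪c∈ = in-H p in trans (sym (∣∪⁅⁆∣ c∉)) (size f∪c∈)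

  2≤∣f∣ : ∀ {f c} → (f , c) ∈ˡ P → 2 ≤ ∣ f ∣
  2≤∣f∣ p = s≤s⁻¹ (≤-trans 3≤k (≤-reflexive (sym (∣f∣≡ p))))

  module From (y₀ : Fin n) where

    -- The newest vertices come first: the walk is read from its latest center `c` back to `y₀` and
    -- has 2i + 2 vertices. Keeping `y` and `y₀` in one set `f` with center `c` is what permits
    -- closing it.
    record Chain (i : ℕ) : Set where
      field
        c y    : Fin n
        us     : List (Fin n)
        f      : Subset n
        p      : (f , c) ∈ˡ P
        y∈     : y ∈ f
        y₀∈    : y₀ ∈ f
        unique : Unique (c ∷ y ∷ us)
        linked : Linked R (c ∷ y ∷ us)
        last   : lastOf y us ≡ y₀
        len    : length us ≡ 2 * i

    Option : List (Fin n) → Subset n → Set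
    Option vs f = y₀ ∈ f × (∀ {x} → x ∈ f → x ∈ˡ vs → x ≡ y₀) × 2 ≤ ∣ f ∣

    OffDisjoint : Subset n → Subset n → Set
    OffDisjoint f f′ = ∀ {x} → x ∈ f → x ∈ f′ → x ≡ y₀

    Blocked : List (Fin n) → Subset n → Set
    Blocked vs f = t < length (centers P f) × (∀ {c} → (f , c) ∈ˡ P → c ∈ˡ vs)

    -- Candidates are collected one at a time, each avoiding the walk and the earlier candidates
    -- except for `y₀`. The search ends early at a candidate with a center off the walk; if it never
    -- does, all centers of all candidates lie on the walk.
    options : ∀ {f₀ c} (vs : List (Fin n)) → (f₀ , c) ∈ˡ P → y₀ ∈ f₀ → (M : ℕ) → length vs + M * k ≤ w →
      (∃[ f ] (f , c) ∈ˡ P × Option vs f × (∃[ c′ ] (f , c′) ∈ˡ P × c′ ∉ˡ vs)) ⊎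
      (∃[ fs ] length fs ≡ M × (∀ {f} → f ∈ˡ fs → ∣ f ∣ ≤ k × Option vs f × Blocked vs f) × AllPairs OffDisjoint fs)
    options vs p₀ y₀∈ zero le = inj₂ ([] , refl , (λ ()) , [])
    options {f₀} {c} vs p₀ y₀∈ (suc M) le with options vs p₀ y₀∈ M (≤-trans (+-monoʳ-≤ (length vs) (m≤n+m (M * k) k)) le)
    ... | inj₁ done = inj₁ done
    ... | inj₂ (fs , lenfs , props , pairs) with good p₀ y₀∈ y₀∈ (vs ++ concatMap elems fs) W≤
      where
      open ≤-Reasoning
      sizes : ∀ gs → (∀ {f} → f ∈ˡ gs → ∣ f ∣ ≤ k) → length (concatMap elems gs) ≤ length gs * k
      sizes [] _ = z≤n
      sizes (g ∷ gs) le = ≤-trans (≤-reflexive (length-++ (elems g)))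
        (+-mono-≤ (≤-trans (≤-reflexive (length-elems g)) (le (here refl))) (sizes gs (le ∘ there)))
      W≤ : length (vs ++ concatMap elems fs) ≤ w
      W≤ = begin
        length (vs ++ concatMap elems fs)          ≡⟨ length-++ vs ⟩
        length vs + length (concatMap elems fs)    ≤⟨ +-monoʳ-≤ (length vs) (sizes fs (proj₁ ∘ props)) ⟩
        length vs + length fs * k                  ≡⟨ cong (λ z → length vs + z * k) lenfs ⟩
        length vs + M * k                          ≤⟨ +-monoʳ-≤ (length vs) (m≤n+m (M * k) k) ⟩
        length vs + suc M * k                      ≤⟨ le ⟩
        w                                          ∎
    ...   | f , p , y₀∈f , _ , avoid with any? (λ c′ → ¬? (c′ ∈ˡ? vs)) (centers P f)
    ...     | yes new = let c′ , c′∈ , c′∉ = find new in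
      inj₁ (f , p , (y₀∈f , (λ x∈ x∈vs → [ id , id ]′ (avoid x∈ (∈-++⁺ˡ x∈vs))) , 2≤∣f∣ p) , c′ , ∈-centers⁻ c′∈ , c′∉)
    ...     | no none = inj₂ (f ∷ fs , cong suc lenfs ,
      (λ { (here refl) → ≤-trans (n≤1+n _) (≤-reflexive (∣f∣≡ p)) ,
                         (y₀∈f , (λ x∈ x∈vs → [ id , id ]′ (avoid x∈ (∈-++⁺ˡ x∈vs))) , 2≤∣f∣ p) ,
                         many p , λ {c′} p′ → decidable-stable (c′ ∈ˡ? vs) (λ c′∉ → none (lose (∈-centers⁺ p′) c′∉))
         ; (there f′∈) → props f′∈ }) ,
      All.tabulate (λ f′∈ {x} x∈ x∈′ → [ id , id ]′ (avoid x∈ (∈-++⁺ʳ vs (∈-concatMap⁺ elems (lose f′∈ (∈-elems⁺ x∈′)))))) ∷ pairs)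

    module Bipartite (vs : List (Fin n)) where

      -- Every center belongs to every set, so centers and vertices picked from successive sets may
      -- alternate freely, with `y₀` itself picked from the last set. The returned location of the
      -- vertices gives distinctness: the sets avoid all centers and meet each other only in `y₀`.
      chain : ∀ m c cs f fs → length cs ≡ m → length fs ≡ m → Unique (c ∷ cs) → (∀ {c′} → c′ ∈ˡ c ∷ cs → c′ ∈ˡ vs) →
        (∀ {g} → g ∈ˡ f ∷ fs → Option vs g) → AllPairs OffDisjoint (f ∷ fs) →
        (∀ {g c′} → g ∈ˡ f ∷ fs → c′ ∈ˡ c ∷ cs → (g , c′) ∈ˡ P) →
        Σ[ K ∈ Chain m ] Chain.c K ≡ c ×
          (∀ {x} → x ∈ˡ Chain.y K ∷ Chain.us K → x ∈ˡ cs ⊎ x ≡ y₀ ⊎ (∃[ g ] g ∈ˡ f ∷ fs × x ∈ g))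
      chain zero c [] f [] _ _ u c∈ opt _ inP = record
        { c = c ; y = y₀ ; us = [] ; f = f ; p = p ; y∈ = y₀∈ ; y₀∈ = y₀∈
        ; unique = Unique-∷⁺ (λ { (here refl) → proj₁ (in-H p) y₀∈ }) (Unique-∷⁺ (λ ()) [])
        ; linked = link p y₀∈ ∷ [-] ; last = refl ; len = refl } , refl , λ { (here e) → inj₂ (inj₁ e) }
        where
        p = inP (here refl) (here refl)
        y₀∈ = proj₁ (opt (here refl))
      chain (suc m) c (c₁ ∷ cs) f (f₁ ∷ fs) lenc lenf (c∉ ∷ u) c∈ opt (disj ∷ pairs) inP
        with chain m c₁ cs f₁ fs (suc-injective lenc) (suc-injective lenf) u (c∈ ∘ there) (opt ∘ there) pairs (λ g∈ c′∈ → inP (there g∈) (there c′∈))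
           | opt (here refl)
      ... | K , refl , where-us | y₀∈ , avoid , 2≤f with ∃-other f y₀ 2≤f
      ...   | y′ , y′∈ , y′≢y₀ = record
        { c = c ; y = y′ ; us = c₁ ∷ y ∷ us ; f = f ; p = inP (here refl) (here refl) ; y∈ = y′∈ ; y₀∈ = y₀∈
        ; unique = Unique-∷⁺ c-new (Unique-∷⁺ y′-new unique)
        ; linked = link (inP (here refl) (here refl)) y′∈ ∷ link′ (inP (here refl) (there (here refl))) y′∈ ∷ linked
        ; last = last ; len = trans (cong (2 +_) len) (sym (*-suc 2 m)) } , refl , where-us′
        where
        open Chain K using (y; us; unique; linked; last; len)
        y′-new : y′ ∉ˡ c₁ ∷ y ∷ us
        y′-new (here refl) = y′≢y₀ (avoid y′∈ (c∈ (there (here refl))))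
        y′-new (there q) with where-us q
        ... | inj₁ r = y′≢y₀ (avoid y′∈ (c∈ (there (there r))))
        ... | inj₂ (inj₁ r) = y′≢y₀ r
        ... | inj₂ (inj₂ (g , g∈ , r)) = y′≢y₀ (All.lookup disj g∈ y′∈ r)
        c-new : c ∉ˡ y′ ∷ c₁ ∷ y ∷ us
        c-new (here refl) = y′≢y₀ (avoid y′∈ (c∈ (here refl)))
        c-new (there (here e)) = All.lookup c∉ (here refl) e
        c-new (there (there q)) with where-us q
        ... | inj₁ r = All.lookup c∉ (there r) refl
        ... | inj₂ (inj₁ refl) = proj₁ (in-H (inP (here refl) (here refl))) y₀∈
        ... | inj₂ (inj₂ (g , g∈ , r)) = proj₁ (in-H (inP (there g∈) (here refl))) r
        where-us′ : ∀ {x} → x ∈ˡ y′ ∷ c₁ ∷ y ∷ us → x ∈ˡ c₁ ∷ cs ⊎ x ≡ y₀ ⊎ (∃[ g ] g ∈ˡ f ∷ f₁ ∷ fs × x ∈ g)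
        where-us′ (here refl) = inj₂ (inj₂ (f , here refl , y′∈))
        where-us′ (there (here refl)) = inj₁ (here refl)
        where-us′ (there (there q)) with where-us q
        ... | inj₁ r = inj₁ (there r)
        ... | inj₂ (inj₁ r) = inj₂ (inj₁ r)
        ... | inj₂ (inj₂ (g , g∈ , r)) = inj₂ (inj₂ (g , there g∈ , r))

    -- Many of the options have exactly the same centers, which gives a complete bipartite pattern.
    blocked : ∀ vs fs → suc t * 2 ^ length vs ≤ length fs →
      (∀ {f} → f ∈ˡ fs → ∣ f ∣ ≤ k × Option vs f × Blocked vs f) → AllPairs OffDisjoint fs → Chain t
    blocked vs fs le props pairs with refine (λ c f → (f , c) ∈ˡ P) (λ c f → (f , c) ∈ᴾ? P) vs fs (suc t) le pairs
    ... | [] , () , _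
    ... | f ∷ fs′ , s≤s t≤ , fs′⊆ , pairs′ , same = pick (centers P f) (centers-unique P f) ∈-centers⁻ (proj₁ (proj₂ (proj₂ (props (fs′⊆ (here refl))))))
      where
      ∈-take : ∀ {A : Set} m {xs : List A} {x} → x ∈ˡ take m xs → x ∈ˡ xs
      ∈-take (suc m) {_ ∷ _} (here e) = here e
      ∈-take (suc m) {_ ∷ _} (there p) = there (∈-take m p)
      length-take : ∀ {A : Set} m {xs : List A} → m ≤ length xs → length (take m xs) ≡ m
      length-take m {xs} le = trans (List.length-take m xs) (m≤n⇒m⊓n≡m le)
      pick : ∀ cs → Unique cs → (∀ {c} → c ∈ˡ cs → (f , c) ∈ˡ P) → t < length cs → Chain t
      pick (c ∷ cs) (c∉ ∷ u) cs∈ (s≤s t≤′) = proj₁ (Bipartite.chain vs t c (take t cs) f (take t fs′)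
        (length-take t t≤′) (length-take t t≤)
        (Unique-∷⁺ (λ q → All.lookup c∉ (∈-take t q) refl) (Unique.take⁺ t u))
        (λ c′∈ → in-vs (sub c′∈))
        (λ g∈ → proj₁ (proj₂ (props (fs′⊆ (subF g∈)))))
        (AllPairs.take⁺ (suc t) pairs′)
        (λ g∈ c′∈ → same (here refl) (subF g∈) (in-vs (sub c′∈)) (cs∈ (sub c′∈))))
        where
        sub : ∀ {x} → x ∈ˡ c ∷ take t cs → x ∈ˡ c ∷ cs
        sub = ∈-take (suc t)
        subF : ∀ {x} → x ∈ˡ f ∷ take t fs′ → x ∈ˡ f ∷ fs′
        subF = ∈-take (suc t)
        in-vs : ∀ {x} → x ∈ˡ c ∷ cs → x ∈ˡ vs
        in-vs x∈ = proj₂ (proj₂ (proj₂ (props (fs′⊆ (here refl))))) (cs∈ x∈)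

    -- The new set has both the old head `c` and a fresh `c′` as centers, so one of its vertices
    -- links the two. If the walk is stuck because all centers on offer are already used, the
    -- bipartite pattern replaces it by a chain of full length.
    extend : ∀ {i} → i < t → Chain i → Chain (suc i) ⊎ Chain t
    extend {i} i<t K with options vs p y₀∈ (suc t * 2 ^ length vs) vs≤
      where
      open Chain K
      vs = c ∷ y ∷ us
      open ≤-Reasoning
      |vs|≤ : length vs ≤ 2 + 2 * t
      |vs|≤ = s≤s (s≤s (≤-trans (≤-reflexive len) (*-monoʳ-≤ 2 (<⇒≤ i<t))))
      vs≤ : length vs + suc t * 2 ^ length vs * k ≤ w
      vs≤ = ≤-trans (+-mono-≤ |vs|≤ (*-monoˡ-≤ k (*-monoʳ-≤ (suc t) (^-monoʳ-≤ 2 |vs|≤)))) wide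
    ... | inj₂ (fs , lenfs , props , pairs) = inj₂ (blocked _ fs (≤-reflexive (sym lenfs)) props pairs)
    ... | inj₁ (f′ , p′ , (y₀∈′ , avoid , 2≤f′) , c′ , q , c′∉) with ∃-other f′ y₀ 2≤f′
    ...   | y′ , y′∈ , y′≢y₀ = inj₁ record
      { c = c′ ; y = y′ ; us = c ∷ y ∷ us ; f = f′ ; p = q ; y∈ = y′∈ ; y₀∈ = y₀∈′
      ; unique = Unique-∷⁺ (λ { (here refl) → proj₁ (in-H q) y′∈ ; (there r) → c′∉ r })
                   (Unique-∷⁺ (λ r → y′≢y₀ (avoid y′∈ r)) unique)
      ; linked = link q y′∈ ∷ link′ p′ y′∈ ∷ linked
      ; last = last ; len = trans (cong (2 +_) len) (sym (*-suc 2 i)) }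
      where open Chain K using (c; y; us; unique; linked; last; len)

    reach : ∀ i → i ≤ t → Chain 0 → Chain i ⊎ Chain t
    reach zero _ K = inj₁ K
    reach (suc i) i<t K = [ extend i<t , inj₂ ]′ (reach i (<⇒≤ i<t) K)

  cycle : ∀ {ℓ} → ℓ ≡ 1 + 2 * t ⊎ ℓ ≡ 2 + 2 * t → 3 * ℓ + ℓ * k ≤ w → ∀ {f c} → (f , c) ∈ˡ P → LinCyc H ℓ
  cycle {ℓ} parity cyc≤w {f₀} {c₀} p₀ = close parity ([ id , id ]′ (reach t ≤-refl start))
    where
    first = ∃-other f₀ c₀ (2≤∣f∣ p₀)
    y₀ = proj₁ first
    open From y₀
    start : Chain 0
    start = record
      { c = c₀ ; y = y₀ ; us = [] ; f = f₀ ; p = p₀ ; y∈ = proj₁ (proj₂ first) ; y₀∈ = proj₁ (proj₂ first)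
      ; unique = Unique-∷⁺ (λ { (here e) → proj₂ (proj₂ first) (sym e) }) (Unique-∷⁺ (λ ()) [])
      ; linked = link p₀ (proj₁ (proj₂ first)) ∷ [-] ; last = refl ; len = refl }
    close : ℓ ≡ 1 + 2 * t ⊎ ℓ ≡ 2 + 2 * t → Chain t → LinCyc H ℓ
    -- The head `c` leaves the path but stays in the closing triple, since the pair of `y` and `y₀`
    -- alone is not known to be robust.
    close (inj₁ odd) K = subst (LinCyc H) eq (embed-list H size y us c
        (subst (λ z → 3 * z + z * k ≤ w) (sym eq) cyc≤w) (proj₂ (Unique-∷⁻ unique)) (tail linked)
        (subst (λ z → Rob H w (z ∷ y ∷ c ∷ [])) (sym last)
          (Rob-resp {w = w} (there (there (here refl)) ∷ there (here refl) ∷ here refl ∷ [])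
                    (there (there (here refl)) ∷ there (here refl) ∷ here refl ∷ [])
                    (prob⇒Rob p y∈ y₀∈)))
        (λ c∈ → contradiction c∈ (proj₁ (Unique-∷⁻ unique))))
      where
      open Chain K
      eq : length (y ∷ us) ≡ ℓ
      eq = trans (cong suc len) (sym odd)
    close (inj₂ even) K = subst (LinCyc H) eq (embed-list H size c (y ∷ us) c
        (subst (λ z → 3 * z + z * k ≤ w) (sym eq) cyc≤w) unique linked
        (subst (λ z → Rob H w (z ∷ c ∷ c ∷ [])) (sym last)
          (Rob-resp {w = w} (here refl ∷ there (here refl) ∷ [])
                    (here refl ∷ there (here refl) ∷ there (here refl) ∷ [])
                    (link′ p y₀∈)))
        (λ _ → inj₂ refl))
      where
      open Chain K
      eq : length (c ∷ y ∷ us) ≡ ℓ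
      eq = trans (cong (2 +_) len) (sym even)

-- The extremal number

PRob-mono : ∀ {n w} {P Q : List (Pointed n)} {c y y′} → (∀ {p} → p ∈ˡ P → p ∈ˡ Q) → PRob w P c y y′ → PRob w Q c y y′
PRob-mono P⊆Q rob W le = let f , p , rest = rob W le in f , P⊆Q p , rest

PRob? : ∀ {n} w (P : List (Pointed n)) c y y′ → Dec (PRob w P c y y′)
PRob? {n} w P c y y′ with bounded-∀? w avoids?
  where
  open import Data.List.Membership.DecPropositional (Fin._≟_ {n}) using () renaming (_∈?_ to _∈ˡ?_)
  avoids? : ∀ W → Dec (Any (λ (f , d) → d ≡ c × y ∈ f × y′ ∈ f × (∀ x → x ∈ f → x ∈ˡ W → x ≡ y ⊎ x ≡ y′)) P)
  avoids? W = any? (λ (f , d) → (d Fin.≟ c) ×-dec (y ∈? f) ×-dec (y′ ∈? f) ×-dec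
    Fin.all? (λ x → (x ∈? f) →-dec ((x ∈ˡ? W) →-dec ((x Fin.≟ y) ⊎-dec (x Fin.≟ y′))))) P
... | inj₁ all = yes λ W le → case find (all W le) of λ { ((f , _) , p , refl , y∈ , y′∈ , av) → f , p , y∈ , y′∈ , λ {x} → av x }
... | inj₂ (W , le , none) = no λ rob → let f , p , y∈ , y′∈ , av = rob W le in none (lose p (refl , y∈ , y′∈ , λ x → av {x}))

Good : ∀ {n} → ℕ → List (Pointed n) → Pointed n → Set
Good w P (f , c) = ∀ y y′ → y ∈ f → y′ ∈ f → PRob w P c y y′

good? : ∀ {n} w (P : List (Pointed n)) p → Dec (Good w P p)
good? w P (f , c) = Fin.all? λ y → Fin.all? λ y′ → (y ∈? f) →-dec ((y′ ∈? f) →-dec PRob? w P c y y′)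

record Core {n} (w : ℕ) (P : List (Pointed n)) : Set where
  field
    core     : List (Pointed n)
    core⊆    : ∀ {p} → p ∈ˡ core → p ∈ˡ P
    selfGood : SelfGood w core
    largest  : ∀ {Q} → (∀ {p} → p ∈ˡ Q → p ∈ˡ P) → SelfGood w Q → ∀ {p} → p ∈ˡ Q → p ∈ˡ core

-- Goodness is monotone in the family, so a pointed edge that is not good in `P` belongs to no
-- self-good subfamily and can be discarded.
core-of : ∀ {n} w (P : List (Pointed n)) → Acc _<_ (length P) → Core w P
core-of {n} w P (acc rs) with all⊎∃ (λ p → case good? w P p of λ { (yes g) → inj₁ g ; (no b) → inj₂ b }) P
... | inj₁ all = record { core = P ; core⊆ = id ; selfGood = λ p y∈ y′∈ → all p _ _ y∈ y′∈ ; largest = λ Q⊆ _ → Q⊆ }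
... | inj₂ (b , b∈ , bad) = record
  { core = core ; core⊆ = proj₁ ∘ ∈-filter⁻ ≢b? {xs = P} ∘ core⊆ ; selfGood = selfGood
  ; largest = λ Q⊆ good → largest (λ p∈ → ∈-filter⁺ ≢b? (Q⊆ p∈) (λ { refl → bad (λ y y′ y∈ y′∈ → PRob-mono Q⊆ (good p∈ y∈ y′∈)) })) good }
  where
  ≢b? : (p : Pointed n) → Dec (p ≢ b)
  ≢b? p = ¬? (×-≡-dec _≟ˢ_ Fin._≟_ p b)
  open Core (core-of w (filter ≢b? P) (rs (filter-notAll ≢b? P (lose b∈ λ ne → ne refl))))

pointings : ∀ {n} → List (Subset n) → List (Pointed n)
pointings = concatMap (λ S → map (λ c → S ∖ c , c) (elems S))

∪-∖ : ∀ {n} {f : Subset n} {c} → c ∉ f → (f ∪ ⁅ c ⁆) ∖ c ≡ f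
∪-∖ {f = f} {c} c∉ = ⊆-antisym to (λ x∈ → ∈-∖⁺ (x∈p∪q⁺ (inj₁ x∈)) (λ { refl → c∉ x∈ }))
  where
  to : (f ∪ ⁅ c ⁆) ∖ c ⊆ f
  to x∈ with ∈-∖⁻ {S = f ∪ ⁅ c ⁆} x∈
  ... | x∈∪ , x≢c with x∈p∪q⁻ f ⁅ c ⁆ x∈∪
  ...   | inj₁ p = p
  ...   | inj₂ p = contradiction (x∈⁅y⁆⇒x≡y c p) x≢c

pointings-in : ∀ {n} (H : List (Subset n)) → PointedIn H (pointings H)
pointings-in H p with find (∈-concatMap⁻ (λ S → map (λ c → S ∖ c , c) (elems S)) {xs = H} p)
... | S , S∈ , q with ∈-map⁻ (λ c → S ∖ c , c) q
...   | c , c∈ , refl = (λ x∈ → proj₂ (∈-∖⁻ {S = S} x∈) refl) , subst (_∈ˡ H) (sym (∖-∪ (∈-elems⁻ c∈))) S∈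

in⇒pointings : ∀ {n} {H : List (Subset n)} {P} → PointedIn H P → ∀ {p} → p ∈ˡ P → p ∈ˡ pointings H
in⇒pointings {H = H} in-H {f , c} p = let c∉ , S∈ = in-H p in
  subst (λ g → (g , c) ∈ˡ pointings H) (∪-∖ c∉)
    (∈-concatMap⁺ (λ S → map (λ c → S ∖ c , c) (elems S))
      (lose S∈ (∈-map⁺ (λ d → (f ∪ ⁅ c ⁆) ∖ d , d) (∈-elems⁺ {S = f ∪ ⁅ c ⁆} (x∈p∪q⁺ {p = f} (inj₂ (x∈⁅x⁆ c)))))))

LinCyc-mono : ∀ {n ℓ} {H H′ : List (Subset n)} → (∀ {S} → S ∈ˡ H → S ∈ˡ H′) → LinCyc H ℓ → LinCyc H′ ℓ
LinCyc-mono H⊆ cyc = record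
  { v = v ; v-inj = v-inj ; S = S ; S∈ = H⊆ ∘ S∈ ; v∈ = v∈ ; v-next∈ = v-next∈ ; v∈⇒ = v∈⇒ ; S∩S = S∩S }
  where open LinCyc cyc

∈-kSets⁺ : ∀ {n k} {S : Subset n} → ∣ S ∣ ≡ k → S ∈ˡ kSets n k
∈-kSets⁺ {n} {k} {S} eq = ∈-filter⁺ (λ S → ∣ S ∣ ≟ k) (∈-allSubsets S) eq

∈-kSets⁻ : ∀ {n k} {S : Subset n} → S ∈ˡ kSets n k → ∣ S ∣ ≡ k
∈-kSets⁻ {n} {k} p = proj₂ (∈-filter⁻ (λ S → ∣ S ∣ ≟ k) {xs = allSubsets n} p)

module Extremal {n k ℓ t w : ℕ} (5≤k : 5 ≤ k) (3≤ℓ : 3 ≤ ℓ) (parity : ℓ ≡ 1 + 2 * t ⊎ ℓ ≡ 2 + 2 * t)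
  (2k≤w : k + k ≤ w) (cyc≤w : 3 * ℓ + ℓ * k ≤ w) (wide : (2 + 2 * t) + suc t * 2 ^ (2 + 2 * t) * k ≤ w) where

  slack : ℕ
  slack = n ^ (k ∸ 2) * sparseConst k w

  -- `Φ` holds the (k-1)-sets that may still be bases; it is both the decreasing measure of `shrink`
  -- and the account from which deleted edges are paid.
  Confined : List (Subset n) → List (Subset n) → Set
  Confined H Φ = ∀ {P} → PointedIn H P → SelfGood w P → ∀ {f c} → (f , c) ∈ˡ P → f ∈ˡ Φ

  -- Repeatedly delete the at most t edges centered over some (k-1)-set f; then f is never again the base of a self-good pointed edge.
  shrink : ∀ Φ H → Acc _<_ (length Φ) → Unique H → (∀ {S} → S ∈ˡ H → ∣ S ∣ ≡ k) → ¬ LinCyc H ℓ → Confined H Φ →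
    length H ≤ t * length Φ + slack
  shrink Φ H (acc rs) u size no-cycle confined = step (core-of w (pointings H) (<-wellFounded _))
    where
    step : Core w (pointings H) → length H ≤ t * length Φ + slack
    step K = [ none , some ]′ (all⊎∃ sparse? core)
      where
      open Core K
      in-H : PointedIn H core
      in-H = pointings-in H ∘ core⊆
      sparse? : ∀ p → t < length (centers core (proj₁ p)) ⊎ length (centers core (proj₁ p)) ≤ t
      sparse? p = case t <? length (centers core (proj₁ p)) of λ { (yes lt) → inj₁ lt ; (no ≮) → inj₂ (≮⇒≥ ≮) }
      none : (∀ {p} → p ∈ˡ core → t < length (centers core (proj₁ p))) → length H ≤ t * length Φ + slack
      -- With more than `slack` edges left, a self-good family would exist and make the core
      -- nonempty, and the zigzag would close to a cycle.
      none many = ≤-trans (≮⇒≥ λ large → absurd (large⇒selfGood 5≤k 3≤ℓ 2k≤w cyc≤w H u size no-cycle large)) (m≤n+m slack (t * length Φ))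
        where
        absurd : ¬ (∃[ P ] 0 < length P × PointedIn H P × SelfGood w P)
        absurd (p ∷ _ , _ , in-H′ , good′) = no-cycle (Zigzag.cycle {t = t} {w = w} (≤-trans (m≤m+n 3 2) 5≤k) H size core in-H selfGood many wide
          parity cyc≤w (largest (in⇒pointings in-H′) good′ (here refl)))
      some : (∃[ p ] p ∈ˡ core × length (centers core (proj₁ p)) ≤ t) → length H ≤ t * length Φ + slack
      some ((f , c) , p , few) = begin
        length H                                        ≡⟨ length-filter-split over? H ⟩
        length (filter over? H) + length H′             ≤⟨ +-mono-≤ over≤ (shrink Φ′ H′ (rs Φ′<Φ) (Unique.filter⁺ (¬? ∘ over?) u) (size ∘ H′⊆) (no-cycle ∘ LinCyc-mono H′⊆) confined′) ⟩
        t + (t * length Φ′ + slack)                     ≡⟨ +-assoc t (t * length Φ′) slack ⟨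
        t + t * length Φ′ + slack                       ≡⟨ cong (_+ slack) (*-suc t (length Φ′)) ⟨
        t * suc (length Φ′) + slack                     ≤⟨ +-monoˡ-≤ slack (*-monoʳ-≤ t Φ′<Φ) ⟩
        t * length Φ + slack                            ∎
        where
        open ≤-Reasoning
        over = map (λ d → f ∪ ⁅ d ⁆) (centers core f)
        over? : ∀ S → Dec (S ∈ˡ over)
        over? S = any? (S ≟ˢ_) over
        H′ = filter (¬? ∘ over?) H
        ≢f? : ∀ g → Dec (g ≢ f)
        ≢f? g = ¬? (g ≟ˢ f)
        Φ′ = filter ≢f? Φ
        H′⊆ : ∀ {S} → S ∈ˡ H′ → S ∈ˡ H
        H′⊆ = proj₁ ∘ ∈-filter⁻ (¬? ∘ over?) {xs = H}
        over≤ : length (filter over? H) ≤ t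
        over≤ = ≤-trans (Unique-⊆-length (Unique.filter⁺ over? u) (λ S∈ → proj₂ (∈-filter⁻ over? {xs = H} S∈)))
          (≤-trans (≤-reflexive (length-map _ (centers core f))) few)
        Φ′<Φ : length Φ′ < length Φ
        Φ′<Φ = filter-notAll ≢f? Φ (lose (confined in-H selfGood p) λ ne → ne refl)
        confined′ : Confined H′ Φ′
        confined′ in-H′ good {g} {d} q = ∈-filter⁺ ≢f? (confined in-H″ good q) g≢f
          where
          in-H″ : PointedIn H _
          in-H″ r = let d∉ , S∈ = in-H′ r in d∉ , H′⊆ S∈
          g≢f : g ≢ f
          -- A self-good family over `H′` is one over `H`, hence inside `core`; with base `f` its
          -- edge would be one of those just deleted.
          g≢f refl = proj₂ (∈-filter⁻ (¬? ∘ over?) {xs = H} (proj₂ (in-H′ q)))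
            (∈-map⁺ (λ d → f ∪ ⁅ d ⁆) (∈-centers⁺ (largest (in⇒pointings in-H″) good q)))

  extremal : ∀ H → Unique H → (∀ {S} → S ∈ˡ H → ∣ S ∣ ≡ k) → ¬ LinCyc H ℓ → length H ≤ t * length (kSets n (k ∸ 1)) + slack
  extremal H u size no-cycle = shrink (kSets n (k ∸ 1)) H (<-wellFounded _) u size no-cycle
    (λ in-H _ {f} q → let c∉ , S∈ = in-H q in ∈-kSets⁺ (cong (_∸ 1) (trans (sym (∣∪⁅⁆∣ c∉)) (size S∈))))

-- Containers

length-filter-map : {B : Set} {P : B → Set} {Q : A → Set} (P? : Decidable P) (Q? : Decidable Q) (f : A → B) →
  (∀ x → P (f x) → Q x) → (∀ x → Q x → P (f x)) → (xs : List A) → length (filter P? (map f xs)) ≡ length (filter Q? xs)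
length-filter-map P? Q? f to from [] = refl
length-filter-map P? Q? f to from (x ∷ xs) with P? (f x) | Q? x
... | yes _ | yes _ = cong suc (length-filter-map P? Q? f to from xs)
... | no _ | no _ = length-filter-map P? Q? f to from xs
... | yes p | no ¬q = contradiction (to x p) ¬q
... | no ¬p | yes q = contradiction (from x q) ¬p

length-kSets : ∀ n k → length (kSets n k) ≡ n C k
length-kSets zero zero = refl
length-kSets zero (suc k) = sym (k>n⇒nCk≡0 {0} {suc k} (s≤s z≤n))
length-kSets (suc n) k = begin
  length (filter (size? k) (map (outside ∷_) (allSubsets n) ++ map (inside ∷_) (allSubsets n)))
    ≡⟨ cong length (filter-++ (size? k) (map (outside ∷_) (allSubsets n)) _) ⟩
  length (filter (size? k) (map (outside ∷_) (allSubsets n)) ++ filter (size? k) (map (inside ∷_) (allSubsets n)))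
    ≡⟨ length-++ (filter (size? k) (map (outside ∷_) (allSubsets n))) ⟩
  length (filter (size? k) (map (outside ∷_) (allSubsets n))) + length (filter (size? k) (map (inside ∷_) (allSubsets n)))
    ≡⟨ cong₂ _+_ (trans (length-filter-map (size? k) (size? k) (outside ∷_) (λ _ → id) (λ _ → id) (allSubsets n)) (length-kSets n k)) (insides k) ⟩
  n C k + without k
    ≡⟨ total k ⟩
  suc n C k ∎
  where
  open ≡-Reasoning
  size? : ∀ {m} k → Decidable (λ (S : Subset m) → ∣ S ∣ ≡ k)
  size? k S = ∣ S ∣ ≟ k
  without : ℕ → ℕ
  without zero = 0
  without (suc k) = n C k
  insides : ∀ k → length (filter (size? k) (map (inside ∷_) (allSubsets n))) ≡ without k
  insides zero = none (allSubsets n)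
    where
    none : ∀ xs → length (filter (size? 0) (map (inside ∷_) xs)) ≡ 0
    none [] = refl
    none (x ∷ xs) = none xs
  insides (suc k) = trans (length-filter-map (size? (suc k)) (size? k) (inside ∷_) (λ _ → suc-injective) (λ _ → cong suc) (allSubsets n)) (length-kSets n k)
  total : ∀ k → n C k + without k ≡ suc n C k
  total zero = refl
  total (suc k) = trans (+-comm (n C suc k) (n C k)) (nCk+nC[k+1]≡[n+1]C[k+1] n k)

allSubsets-unique : ∀ n → Unique (allSubsets n)
allSubsets-unique zero = Unique-∷⁺ (λ ()) []
allSubsets-unique (suc n) = Unique.++⁺
  (Unique.map⁺ Vec.∷-injectiveʳ (allSubsets-unique n)) (Unique.map⁺ Vec.∷-injectiveʳ (allSubsets-unique n))
  (λ (p , q) → case ∈-map⁻ (outside ∷_) p , ∈-map⁻ (inside ∷_) q of λ { ((_ , _ , refl) , (_ , _ , ())) })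

kSets-unique : ∀ n k → Unique (kSets n k)
kSets-unique n k = Unique.filter⁺ (λ S → ∣ S ∣ ≟ k) (allSubsets-unique n)

Rob? : ∀ {n} (H : List (Subset n)) w D → Dec (Rob H w D)
Rob? {n} H w D with bounded-∀? w avoids?
  where
  open import Data.List.Membership.DecPropositional (Fin._≟_ {n}) using () renaming (_∈?_ to _∈ˡ?_)
  avoids? : ∀ W → Dec (Any (λ S → (∀ x → x ∈ˡ D → x ∈ S) × (∀ x → x ∈ S → x ∈ˡ W → x ∈ˡ D)) H)
  avoids? W = any? (λ S → Fin.all? (λ x → (x ∈ˡ? D) →-dec (x ∈? S)) ×-dec
    Fin.all? (λ x → (x ∈? S) →-dec ((x ∈ˡ? W) →-dec (x ∈ˡ? D)))) H
... | inj₁ all = yes λ W le → let S , S∈ , D⊆ , av = find (all W le) in S , S∈ , (λ {x} → D⊆ x) , λ {x} → av x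
... | inj₂ (W , le , none) = no λ rob → let S , S∈ , D⊆ , av = rob W le in none (lose S∈ ((λ x → D⊆ {x}) , λ x → av {x}))

Rob-mono : ∀ {n} {H H′ : List (Subset n)} {w D} → (∀ {S} → S ∈ˡ H → S ∈ˡ H′) → Rob H w D → Rob H′ w D
Rob-mono H⊆ rob W le = let S , S∈ , rest = rob W le in S , H⊆ S∈ , rest

edges : ∀ {n k} → KGraph n k → List (Subset n)
edges {n} {k} G = map (lookup (kSets n k)) (elems G)

module _ {n k : ℕ} (G : KGraph n k) where

  ∈-edges⁻ : ∀ {S} → S ∈ˡ edges {n} {k} G → IsEdge n k G S
  ∈-edges⁻ p = let e , e∈ , eq = ∈-map⁻ (lookup (kSets n k)) p in e , ∈-elems⁻ e∈ , sym eq

  edges-size : ∀ {S} → S ∈ˡ edges {n} {k} G → ∣ S ∣ ≡ k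
  edges-size p with ∈-map⁻ (lookup (kSets n k)) p
  ... | e , _ , refl = ∈-kSets⁻ (∈-lookup {xs = kSets n k} e)

  edges-unique : Unique (edges {n} {k} G)
  edges-unique = Unique.map⁺ (lookup-injective (kSets-unique n k)) (elems-unique G)

decode : ∀ n k → List (Subset n) → KGraph n k
decode n k Q = ⟦ (λ e → any? (lookup (kSets n k) e ≟ˢ_) Q) ⟧

decode-edges : ∀ {n k} (G : KGraph n k) Q → (∀ {S} → S ∈ˡ edges {n} {k} G → S ∈ˡ Q) →
  (∀ {S} → S ∈ˡ kSets n k → S ∈ˡ Q → S ∈ˡ edges {n} {k} G) → decode n k Q ≡ G
decode-edges {n} {k} G Q to from = ⊆-antisym
  (λ {e} e∈ → let e′ , e′∈ , eq = ∈-map⁻ (lookup (kSets n k)) (from (∈-lookup e) (∈-⟦⟧⁻ in? e∈)) in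
    subst (_∈ G) (sym (lookup-injective (kSets-unique n k) eq)) (∈-elems⁻ e′∈))
  (λ {e} e∈ → ∈-⟦⟧⁺ in? (to (∈-map⁺ (lookup (kSets n k)) (∈-elems⁺ e∈))))
  where
  in? : ∀ e → Dec (lookup (kSets n k) e ∈ˡ Q)
  in? e = any? (lookup (kSets n k) e ≟ˢ_) Q

Triple : ℕ → Set
Triple n = Fin n × Fin n × Fin n

triples : ∀ n → List (Triple n)
triples n = cartesianProduct (allFin n) (cartesianProduct (allFin n) (allFin n))

length-triples : ∀ n → length (triples n) ≡ n * (n * n)
length-triples n = trans (length-cartesianProductWith _,_ (allFin n) _)
  (cong₂ _*_ len (trans (length-cartesianProductWith _,_ (allFin n) (allFin n)) (cong₂ _*_ len len)))
  where len = length-tabulate {n = n} id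

-- This depends on the recorded triples only, so a decoder can recompute the container. The vertices
-- `y` and `y′` may coincide, which records the robust pairs through `c` as well.
Spanned : ∀ {n} → List (Triple n) → Subset n → Set
Spanned T S = ∃[ c ] c ∈ S × (∀ y y′ → y ∈ S ∖ c → y′ ∈ S ∖ c → (c , y , y′) ∈ˡ T)

spanned? : ∀ {n} (T : List (Triple n)) → Decidable (Spanned T)
spanned? T S = Fin.any? λ c → (c ∈? S) ×-dec Fin.all? λ y → Fin.all? λ y′ →
  (y ∈? S ∖ c) →-dec ((y′ ∈? S ∖ c) →-dec any? (×-≡-dec Fin._≟_ (×-≡-dec Fin._≟_ Fin._≟_) (c , y , y′)) T)

container : ∀ {n} → ℕ → List (Triple n) → List (Subset n)
container {n} k T = filter (spanned? T) (kSets n k)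

module Count {n k ℓ t w : ℕ} (5≤k : 5 ≤ k) (3≤ℓ : 3 ≤ ℓ) (parity : ℓ ≡ 1 + 2 * t ⊎ ℓ ≡ 2 + 2 * t)
  (2k≤w : k + k ≤ w) (cyc≤w : 3 * ℓ + ℓ * k ≤ w) (wide : (2 + 2 * t) + suc t * 2 ^ (2 + 2 * t) * k ≤ w) where

  open Extremal {n} {k} {ℓ} {t} {w} 5≤k 3≤ℓ parity 2k≤w cyc≤w wide

  ex : ℕ
  ex = t * (n C (k ∸ 1)) + slack

  alphabet : List (Subset n)
  alphabet = ∅ ∷ kSets n k

  -- A list of triples with an oversized container cannot come from a cycle-free graph, by
  -- `container≤ex`, and receives no codes; this keeps the bound uniform in `T`.
  block : (T : List (Triple n)) → Dec (length (container k T) ≤ ex) → List (KGraph n k)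
  block T (no _) = []
  block T (yes _) = cartesianProductWith (λ A R → decode n k (A ++ R)) (sublists (container k T)) (words slack alphabet)

  codes : List (KGraph n k)
  codes = concatMap (λ T → block T (length (container k T) ≤? ex)) (sublists (triples n))

  length-codes : length codes ≤ 2 ^ (n * (n * n)) * (2 ^ ex * (suc (n C k) ^ slack))
  length-codes = ≤-trans (length-concatMap-≤ _ (sublists (triples n)) _ (λ T → length-block T (length (container k T) ≤? ex)))
    (≤-reflexive (cong (_* (2 ^ ex * (suc (n C k) ^ slack))) (trans (length-sublists (triples n)) (cong (2 ^_) (length-triples n)))))
    where
    open ≤-Reasoning
    length-block : ∀ T d → length (block T d) ≤ 2 ^ ex * (suc (n C k) ^ slack)
    length-block T (no _) = z≤n
    length-block T (yes le) = begin
      length (block T (yes le))                                               ≡⟨ length-cartesianProductWith _ (sublists (container k T)) (words slack alphabet) ⟩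
      length (sublists (container k T)) * length (words slack alphabet)       ≡⟨ cong₂ _*_ (length-sublists (container k T)) (length-words slack alphabet) ⟩
      2 ^ length (container k T) * (suc (length (kSets n k)) ^ slack)         ≤⟨ *-monoˡ-≤ _ (^-monoʳ-≤ 2 le) ⟩
      2 ^ ex * (suc (length (kSets n k)) ^ slack)                             ≡⟨ cong (λ z → 2 ^ ex * (suc z ^ slack)) (length-kSets n k) ⟩
      2 ^ ex * (suc (n C k) ^ slack)                                          ∎

  module _ (G : KGraph n k) (no-cycle : ¬ LinCyc (edges {n} {k} G) ℓ) where

    private
      H = edges {n} {k} G
      rob? : Decidable (λ ((c , y , y′) : Triple n) → Rob H w (c ∷ y ∷ y′ ∷ []))
      rob? (c , y , y′) = Rob? H w (c ∷ y ∷ y′ ∷ [])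
      T = filter rob? (triples n)
      X = container k T

      ∈-T : ∀ {c y y′} → Rob H w (c ∷ y ∷ y′ ∷ []) → (c , y , y′) ∈ˡ T
      ∈-T rob = ∈-filter⁺ rob? (∈-cartesianProduct⁺ (∈-allFin _) (∈-cartesianProduct⁺ (∈-allFin _) (∈-allFin _))) rob

      -- The center of each edge serves as its third prescribed vertex in `embed`. If the center is
      -- itself a joint, the triple with both `y` and `y′` equal to the other joint is used.
      container-free : ¬ LinCyc X ℓ
      container-free cyc = no-cycle (embed H (edges-size {n} {k} G) cyc≤w v z v-inj
        (λ {i} {j} eq → v∈⇒ (subst (_∈ S i) eq (z∈ i)))
        (λ {i} {j} i≢j eq → S∩S i≢j (z∈ i) (subst (_∈ S j) (sym eq) (z∈ j))) rob)
        where
        open LinCyc cyc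
        span : ∀ i → Spanned T (S i)
        span i = proj₂ (∈-filter⁻ (spanned? T) {xs = kSets n k} (S∈ i))
        z : Fin ℓ → Fin n
        z i = proj₁ (span i)
        z∈ : ∀ i → z i ∈ S i
        z∈ i = proj₁ (proj₂ (span i))
        tr : ∀ i {y y′} → y ∈ S i → y ≢ z i → y′ ∈ S i → y′ ≢ z i → Rob H w (z i ∷ y ∷ y′ ∷ [])
        tr i {y} {y′} y∈ y≢ y′∈ y′≢ = proj₂ (∈-filter⁻ rob? {xs = triples n} (proj₂ (proj₂ (span i)) y y′ (∈-∖⁺ y∈ y≢) (∈-∖⁺ y′∈ y′≢)))
        v≢ : ∀ i → v i ≢ v (next i)
        v≢ i = next-≢ (≤-trans (n≤1+n 2) 3≤ℓ) i ∘ v-inj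
        rob : ∀ i → Rob H w (v i ∷ v (next i) ∷ z i ∷ [])
        rob i = by-cases (v i Fin.≟ z i) (v (next i) Fin.≟ z i)
          where
          by-cases : Dec (v i ≡ z i) → Dec (v (next i) ≡ z i) → Rob H w (v i ∷ v (next i) ∷ z i ∷ [])
          by-cases (yes eq) (yes eq′) = contradiction (trans eq (sym eq′)) (v≢ i)
          by-cases (yes eq) (no ne′) = Rob-resp {w = w}
            (there (there (here refl)) ∷ there (here refl) ∷ there (here refl) ∷ [])
            (here eq ∷ there (here refl) ∷ here refl ∷ []) (tr i (v-next∈ i) ne′ (v-next∈ i) ne′)
          by-cases (no ne) (yes eq′) = Rob-resp {w = w}
            (there (there (here refl)) ∷ here refl ∷ here refl ∷ [])
            (there (here refl) ∷ here eq′ ∷ here refl ∷ []) (tr i (v∈ i) ne (v∈ i) ne)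
          by-cases (no ne) (no ne′) = Rob-resp {w = w}
            (there (there (here refl)) ∷ here refl ∷ there (here refl) ∷ [])
            (there (here refl) ∷ there (there (here refl)) ∷ here refl ∷ []) (tr i (v∈ i) ne (v-next∈ i) ne′)

      container≤ex : length X ≤ ex
      container≤ex = subst (λ z → length X ≤ t * z + slack) (length-kSets n (k ∸ 1))
        (extremal X (Unique.filter⁺ (spanned? T) (kSets-unique n k))
          (λ S∈ → ∈-kSets⁻ (proj₁ (∈-filter⁻ (spanned? T) {xs = kSets n k} S∈))) container-free)

      bad = filter (¬? ∘ spanned? T) H

      bad⊆ : ∀ {S} → S ∈ˡ bad → S ∈ˡ H
      bad⊆ = proj₁ ∘ ∈-filter⁻ (¬? ∘ spanned? T) {xs = H}

      -- Too many unspanned edges would contain a self-good family. Its triples are robust already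
      -- within `bad`, hence in G, so its edges would be spanned after all.
      bad≤slack : length bad ≤ slack
      bad≤slack = ≮⇒≥ λ large → absurd (large⇒selfGood 5≤k 3≤ℓ 2k≤w cyc≤w bad
          (Unique.filter⁺ (¬? ∘ spanned? T) (edges-unique {n} {k} G)) (edges-size {n} {k} G ∘ bad⊆) (no-cycle ∘ LinCyc-mono bad⊆) large)
        where
        absurd : ¬ (∃[ P ] 0 < length P × PointedIn bad P × SelfGood w P)
        absurd ((f , c) ∷ P , _ , in-bad , good) = proj₂ (∈-filter⁻ (¬? ∘ spanned? T) {xs = H} (proj₂ (in-bad (here refl))))
          (c , x∈p∪q⁺ (inj₂ (x∈⁅x⁆ c)) , λ y y′ y∈ y′∈ → ∈-T (Rob-mono {w = w} bad⊆ (PRob⇒Rob {w = w} in-bad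
            (good (here refl) (back y∈) (back y′∈)))))
          where
          back : ∀ {y} → y ∈ (f ∪ ⁅ c ⁆) ∖ c → y ∈ f
          back = subst (_ ∈_) (∪-∖ (proj₁ (in-bad (here refl))))

      in-H? : Decidable (_∈ˡ H)
      in-H? S = any? (S ≟ˢ_) H

      kept = filter in-H? X
      -- Padding gives all words the same length; the empty set is no k-set, so decoding ignores it.
      pad = slack ∸ length bad
      word = bad ++ replicate pad ∅

      length-word : length word ≡ slack
      length-word = trans (length-++ bad) (trans (cong (length bad +_) (length-replicate pad)) (m+[n∸m]≡n bad≤slack))

      H⊆kSets : ∀ {S} → S ∈ˡ H → S ∈ˡ kSets n k
      H⊆kSets = ∈-kSets⁺ ∘ edges-size {n} {k} G

      ∈-replicate⁻ : ∀ m {S : Subset n} → S ∈ˡ replicate m ∅ → S ≡ ∅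
      ∈-replicate⁻ (suc m) (here e) = e
      ∈-replicate⁻ (suc m) (there p) = ∈-replicate⁻ m p

      word∈ : word ∈ˡ words slack alphabet
      word∈ = subst (λ z → word ∈ˡ words z alphabet) length-word (∈-words alphabet word
        (λ p → [ there ∘ H⊆kSets ∘ bad⊆ , here ∘ ∈-replicate⁻ pad ]′ (∈-++⁻ bad p)))

      decodes : decode n k (kept ++ word) ≡ G
      decodes = decode-edges {n} {k} G (kept ++ word) to from
        where
        to : ∀ {S} → S ∈ˡ H → S ∈ˡ kept ++ word
        to {S} S∈ = [ (λ s → ∈-++⁺ˡ (∈-filter⁺ in-H? (∈-filter⁺ (spanned? T) (H⊆kSets S∈) s) S∈)) ,
                      (λ ¬s → ∈-++⁺ʳ kept (∈-++⁺ˡ (∈-filter⁺ (¬? ∘ spanned? T) S∈ ¬s))) ]′ (toSum (spanned? T S))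
        from : ∀ {S} → S ∈ˡ kSets n k → S ∈ˡ kept ++ word → S ∈ˡ H
        from S∈k p = [ proj₂ ∘ ∈-filter⁻ in-H? {xs = X} , [ bad⊆ , (λ r → contradiction (empty (∈-replicate⁻ pad r)) id) ]′ ∘ ∈-++⁻ bad ]′ (∈-++⁻ kept p)
          where
          empty : _ ≡ ∅ → ⊥
          empty refl = contradiction (trans (sym (∈-kSets⁻ {k = k} S∈k)) (∣⊥∣≡0 n)) λ { refl → case 5≤k of λ () }

    graph∈codes : G ∈ˡ codes
    graph∈codes = ∈-concatMap⁺ _ (lose (filter-∈-sublists rob? (triples n)) (in-block (length X ≤? ex)))
      where
      in-block : ∀ d → G ∈ˡ block T d
      in-block (no ¬p) = contradiction container≤ex ¬p
      in-block (yes _) = subst (_∈ˡ block T (yes container≤ex)) decodes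
        (∈-cartesianProductWith⁺ (λ A R → decode n k (A ++ R)) (filter-∈-sublists in-H? X) word∈)

  forb-≤ : ∀ {c} → IsForb k ℓ n c → c ≤ 2 ^ (n * (n * n)) * (2 ^ ex * (suc (n C k) ^ slack))
  forb-≤ (L , u , L⇔ , refl) = ≤-trans (Unique-⊆-length u (λ {G} G∈ → graph∈codes G
    (Equivalence.to (L⇔ G) G∈ ∘ LinCyc⇒ContainsCycle {n} {k} G (edges {n} {k} G) (≤-trans (n≤1+n 2) 3≤ℓ)
      (λ p → ∈-edges⁻ {n} {k} G p , edges-size {n} {k} G p)))) length-codes

-- The lower bound

next-injective : ∀ {ℓ} {i j : Fin ℓ} → next i ≡ next j → i ≡ j
next-injective {i = i} {j} eq with last⊎suc i | last⊎suc j
... | inj₁ p | inj₁ q = Fin.toℕ-injective (suc-injective (trans p (sym q)))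
... | inj₂ p | inj₂ q = Fin.toℕ-injective (suc-injective (trans (sym (toℕ-next-suc i p)) (trans (cong toℕ eq) (toℕ-next-suc j q))))
... | inj₁ p | inj₂ q = contradiction (trans (sym (toℕ-next-suc j q)) (trans (cong toℕ (sym eq)) (toℕ-next-last i p))) λ ()
... | inj₂ p | inj₁ q = contradiction (trans (sym (toℕ-next-suc i p)) (trans (cong toℕ eq) (toℕ-next-last j q))) λ ()

-- A vertex of the linear cycle lies on at most two of its edges, so t vertices cover at most 2t < ℓ of them.
covered⇒no-cycle : ∀ {n k ℓ t} (G : KGraph n k) → 2 * t < ℓ →
  (∀ {S} → IsEdge n k G S → ∃[ x ] x ∈ S × toℕ x < t) → ¬ ContainsCycle n k ℓ G
covered⇒no-cycle {n} {k} {ℓ} {t} G 2t<ℓ cover (φ , φ-inj , E) =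
  let i , j , _ , _ , i≢j , eq = pigeonhole (×-≡-dec _≟_ Bool._≟_) code (allFin ℓ) codes (Unique.allFin⁺ ℓ) (λ {i} _ → code∈ i) few
  in i≢j (code-inj i j eq)
  where
  hit : ∀ i → ∃[ u ] CycMem {k} i u × toℕ (φ u) < t
  hit i = let S , S∈ , S⇔ = E i ; x , x∈ , x<t = cover S∈ ; u , mem , eq = Equivalence.to (S⇔ x) x∈
          in u , mem , subst (λ z → toℕ z < t) (sym eq) x<t
  side : ∀ {i} u → CycMem {k} i u → Bool
  side (inj₁ j) (inj₁ _) = true
  side (inj₁ j) (inj₂ _) = false
  side (inj₂ _) _ = true
  code : Fin ℓ → ℕ × Bool
  code i = let u , mem , _ = hit i in toℕ (φ u) , side u mem
  codes = cartesianProduct (upTo t) (true ∷ false ∷ [])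
  ∈-bools : ∀ b → b ∈ˡ true ∷ false ∷ []
  ∈-bools true = here refl
  ∈-bools false = there (here refl)
  code∈ : ∀ i → code i ∈ˡ codes
  code∈ i = let u , mem , lt = hit i in ∈-cartesianProduct⁺ (∈-upTo⁺ lt) (∈-bools (side u mem))
  few : length codes < length (allFin ℓ)
  few = ≤-trans (s≤s (≤-reflexive (trans (length-cartesianProductWith _,_ (upTo t) _)
    (trans (cong (_* 2) (length-upTo t)) (*-comm t 2))))) (≤-trans 2t<ℓ (≤-reflexive (sym (length-tabulate {n = ℓ} id))))
  same : ∀ {i j} u (p : CycMem {k} i u) (q : CycMem {k} j u) → side u p ≡ side u q → i ≡ j
  same (inj₁ _) (inj₁ p) (inj₁ q) _ = trans (sym p) q
  same (inj₁ _) (inj₂ p) (inj₂ q) _ = next-injective (trans (sym p) q)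
  same (inj₂ _) p q _ = trans (sym p) q
  code-inj : ∀ i j → code i ≡ code j → i ≡ j
  code-inj i j eq = go (hit i) (hit j) (cong proj₁ eq) (cong proj₂ eq)
    where
    go : (p : ∃[ u ] CycMem {k} i u × toℕ (φ u) < t) (q : ∃[ u ] CycMem {k} j u × toℕ (φ u) < t) →
      toℕ (φ (proj₁ p)) ≡ toℕ (φ (proj₁ q)) → side (proj₁ p) (proj₁ (proj₂ p)) ≡ side (proj₁ q) (proj₁ (proj₂ q)) → i ≡ j
    go (u , p , _) (u′ , q , _) e e′ with φ-inj {u} {u′} (Fin.toℕ-injective e)
    ... | refl = same u p q e′

-- The k-sets that meet the first t vertices, sorted by their least vertex so that none is listed
-- twice.
star : (t n k : ℕ) → List (Subset n)
star zero n k = []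
star (suc t) zero k = []
star (suc t) (suc n) k = map (inside ∷_) (kSets n (k ∸ 1)) ++ map (outside ∷_) (star t n k)

∈-star : ∀ t n k → 1 ≤ k → ∀ {S} → S ∈ˡ star t n k → ∣ S ∣ ≡ k × (∃[ x ] x ∈ S × toℕ x < t)
∈-star (suc t) (suc n) (suc k) 1≤k p with ∈-++⁻ (map (inside ∷_) (kSets n k)) p
... | inj₁ q with ∈-map⁻ (inside ∷_) q
...   | f , f∈ , refl = cong suc (∈-kSets⁻ f∈) , zero , here , s≤s z≤n
∈-star (suc t) (suc n) (suc k) 1≤k p | inj₂ q with ∈-map⁻ (outside ∷_) q
...   | S , S∈ , refl = let eq , x , x∈ , lt = ∈-star t n (suc k) 1≤k S∈ in eq , suc x , there x∈ , s≤s lt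

star-unique : ∀ t n k → Unique (star t n k)
star-unique zero n k = []
star-unique (suc t) zero k = []
star-unique (suc t) (suc n) k = Unique.++⁺
  (Unique.map⁺ Vec.∷-injectiveʳ (kSets-unique n (k ∸ 1))) (Unique.map⁺ Vec.∷-injectiveʳ (star-unique t n k))
  (λ (p , q) → case ∈-map⁻ (inside ∷_) p , ∈-map⁻ (outside ∷_) q of λ { ((_ , _ , refl) , (_ , _ , ())) })

sublists-unique : {xs : List A} → Unique xs → Unique (sublists xs)
sublists-unique [] = Unique-∷⁺ (λ ()) []
sublists-unique {xs = x ∷ xs} (x∉ ∷ u) = Unique.++⁺ (sublists-unique u)
  (Unique.map⁺ (proj₂ ∘ List.∷-injective) (sublists-unique u))
  (λ (p , q) → case ∈-map⁻ (x ∷_) q of λ { (_ , _ , refl) → All.lookup x∉ (∈-sublists⇒⊆ xs p (here refl)) refl })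

filter-sublist : {Q : A → Set} (Q? : Decidable Q) {xs : List A} → Unique xs → ∀ {ys} → ys ∈ˡ sublists xs →
  (∀ {x} → x ∈ˡ xs → Q x → x ∈ˡ ys) → (∀ {x} → x ∈ˡ ys → Q x) → filter Q? xs ≡ ys
filter-sublist Q? {[]} _ (here refl) _ _ = refl
filter-sublist Q? {x ∷ xs} (x∉ ∷ u) p to from with ∈-++⁻ (sublists xs) p
... | inj₁ q = trans (filter-reject Q? {x = x} (λ Qx → All.lookup x∉ (∈-sublists⇒⊆ xs q (to (here refl) Qx)) refl))
                 (filter-sublist Q? u q (to ∘ there) from)
... | inj₂ q with ∈-map⁻ (x ∷_) q
...   | zs , zs∈ , refl = trans (filter-accept Q? {x = x} (from (here refl)))
        (cong (x ∷_) (filter-sublist Q? u zs∈ (λ x′∈ Qx′ → case to (there x′∈) Qx′ of λ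
          { (here refl) → contradiction refl (All.lookup x∉ x′∈) ; (there r) → r }) (from ∘ there)))

decode-edge⁻ : ∀ {n k} Q {S} → IsEdge n k (decode n k Q) S → S ∈ˡ Q
decode-edge⁻ {n} {k} Q (e , e∈ , refl) = ∈-⟦⟧⁻ (λ e → any? (lookup (kSets n k) e ≟ˢ_) Q) e∈

decode-edge⁺ : ∀ {n k} Q {S} → S ∈ˡ Q → ∣ S ∣ ≡ k → S ∈ˡ edges {n} {k} (decode n k Q)
decode-edge⁺ {n} {k} Q {S} S∈ eq = subst (_∈ˡ edges (decode n k Q)) (sym (lookup-index p))
  (∈-map⁺ (lookup (kSets n k)) (∈-elems⁺ (∈-⟦⟧⁺ (λ e → any? (lookup (kSets n k) e ≟ˢ_) Q) (subst (_∈ˡ Q) (lookup-index p) S∈))))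
  where p = ∈-kSets⁺ {n} {k} eq

-- In place of an injection of the subfamilies into `L`, the map `trace` covers them from `L`: each
-- subfamily is the trace of the graph that it decodes to.
forb-≥ : ∀ {n k ℓ t c} → 1 ≤ k → 2 * t < ℓ → IsForb k ℓ n c → 2 ^ length (star t n k) ≤ c
forb-≥ {n} {k} {ℓ} {t} 1≤k 2t<ℓ (L , u , L⇔ , refl) = begin
  2 ^ length stars            ≡⟨ length-sublists stars ⟨
  length (sublists stars)     ≤⟨ Unique-⊆-length (sublists-unique (star-unique t n k)) traced ⟩
  length (map trace L)        ≡⟨ length-map trace L ⟩
  length L                    ∎
  where
  open ≤-Reasoning
  stars = star t n k
  in? : (G : KGraph n k) → Decidable (_∈ˡ edges {n} {k} G)
  in? G S = any? (S ≟ˢ_) (edges {n} {k} G)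
  trace : KGraph n k → List (Subset n)
  trace G = filter (in? G) stars
  traced : ∀ {Q} → Q ∈ˡ sublists stars → Q ∈ˡ map trace L
  traced {Q} Q∈ = subst (_∈ˡ map trace L)
    (filter-sublist (in? G) (star-unique t n k) Q∈
      (λ _ S∈ → decode-edge⁻ {n} {k} Q (∈-edges⁻ {n} {k} G S∈))
      (λ S∈ → decode-edge⁺ {n} {k} Q S∈ (proj₁ (∈-star t n k 1≤k (∈-sublists⇒⊆ stars Q∈ S∈)))))
    (∈-map⁺ trace (Equivalence.from (L⇔ G) (covered⇒no-cycle {n} {k} {ℓ} {t} G 2t<ℓ
      (λ e → proj₂ (∈-star t n k 1≤k (∈-sublists⇒⊆ stars Q∈ (decode-edge⁻ {n} {k} Q e)))))))
    where G = decode n k Q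

-- Asymptotics

-- The identity (b+1)·C(n, b+1) = (n-b)·C(n, b), freed from subtraction.
binomial-step : ∀ n b → suc b * (n C suc b) + b * (n C b) ≡ n * (n C b)
binomial-step zero zero = refl
binomial-step zero (suc b) = begin
  suc (suc b) * (0 C suc (suc b)) + suc b * (0 C suc b) ≡⟨ cong₂ (λ x y → suc (suc b) * x + suc b * y) (k>n⇒nCk≡0 {0} {suc (suc b)} (s≤s z≤n)) (k>n⇒nCk≡0 {0} {suc b} (s≤s z≤n)) ⟩
  suc (suc b) * 0 + suc b * 0                           ≡⟨ cong₂ _+_ (*-zeroʳ (suc (suc b))) (*-zeroʳ (suc b)) ⟩
  0                                                     ∎
  where open ≡-Reasoning
binomial-step (suc n) zero = trans (+-identityʳ _) (trans (*-identityˡ _) (trans (nC1≡n (suc n)) (sym (*-identityʳ (suc n)))))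
binomial-step (suc n) (suc b) = begin
  suc (suc b) * (suc n C suc (suc b)) + suc b * (suc n C suc b)
    ≡⟨ cong₂ (λ x y → suc (suc b) * x + suc b * y) (nCk+nC[k+1]≡[n+1]C[k+1] n (suc b)) (nCk+nC[k+1]≡[n+1]C[k+1] n b) ⟨
  suc (suc b) * (y + z) + suc b * (x + y)
    ≡⟨ regroup b x y z ⟩
  (suc (suc b) * z + suc b * y) + (suc b * y + b * x) + (x + y)
    ≡⟨ cong₂ (λ p q → p + q + (x + y)) (binomial-step n (suc b)) (binomial-step n b) ⟩
  n * y + n * x + (x + y)
    ≡⟨ collect n x y ⟩
  suc n * (x + y)
    ≡⟨ cong (suc n *_) (nCk+nC[k+1]≡[n+1]C[k+1] n b) ⟩
  suc n * (suc n C suc b) ∎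
  where
  open ≡-Reasoning
  x = n C b
  y = n C suc b
  z = n C suc (suc b)
  regroup : ∀ b x y z → suc (suc b) * (y + z) + suc b * (x + y) ≡ (suc (suc b) * z + suc b * y) + (suc b * y + b * x) + (x + y)
  regroup = solve-∀
  collect : ∀ n x y → n * y + n * x + (x + y) ≡ suc n * (x + y)
  collect = solve-∀

-- For n ≥ 2b the factor n-b in `binomial-step` is at least n/2.
binomial-growth : ∀ n b → 2 * b ≤ n → n * (n C b) ≤ 2 * suc b * (n C suc b)
binomial-growth n b 2b≤n = +-cancelʳ-≤ (n * (n C b)) _ _ (begin
  n * (n C b) + n * (n C b)                                  ≡⟨ cong (λ z → z + z) (binomial-step n b) ⟨
  (suc b * (n C suc b) + b * (n C b)) + (suc b * (n C suc b) + b * (n C b)) ≡⟨ regroup (suc b) (n C suc b) b (n C b) ⟩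
  2 * suc b * (n C suc b) + 2 * b * (n C b)                  ≤⟨ +-monoʳ-≤ (2 * suc b * (n C suc b)) (*-monoˡ-≤ (n C b) 2b≤n) ⟩
  2 * suc b * (n C suc b) + n * (n C b)                      ∎)
  where
  open ≤-Reasoning
  regroup : ∀ s y b x → (s * y + b * x) + (s * y + b * x) ≡ 2 * s * y + 2 * b * x
  regroup = solve-∀

-- This is 2^b · b!.
powConst : ℕ → ℕ
powConst zero = 1
powConst (suc b) = powConst b * (2 * suc b)

powConst>0 : ∀ b → 1 ≤ powConst b
powConst>0 zero = ≤-refl
powConst>0 (suc b) = *-mono-≤ (powConst>0 b) (s≤s (z≤n {b + suc (b + 0)}))

n^b≤nCb : ∀ n b → 2 * b ≤ n → n ^ b ≤ powConst b * (n C b)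
n^b≤nCb n zero _ = ≤-refl
n^b≤nCb n (suc b) 2b≤n = begin
  n * n ^ b                                  ≤⟨ *-monoʳ-≤ n (n^b≤nCb n b le) ⟩
  n * (powConst b * (n C b))                 ≡⟨ swap n (powConst b) (n C b) ⟩
  powConst b * (n * (n C b))                 ≤⟨ *-monoʳ-≤ (powConst b) (binomial-growth n b le) ⟩
  powConst b * (2 * suc b * (n C suc b))     ≡⟨ *-assoc (powConst b) (2 * suc b) (n C suc b) ⟨
  powConst b * (2 * suc b) * (n C suc b)     ∎
  where
  open ≤-Reasoning
  le : 2 * b ≤ n
  le = ≤-trans (*-monoʳ-≤ 2 (n≤1+n b)) 2b≤n
  swap : ∀ x y z → x * (y * z) ≡ y * (x * z)
  swap = solve-∀

binomial-mono : ∀ n b → n C b ≤ suc n C b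
binomial-mono n zero = ≤-refl
binomial-mono n (suc b) = ≤-trans (m≤n+m (n C suc b) (n C b)) (≤-reflexive (nCk+nC[k+1]≡[n+1]C[k+1] n b))

suc-binomial≤ : ∀ n k → suc (n C suc k) ≤ suc n ^ suc k
suc-binomial≤ zero k = ≤-reflexive (trans (cong suc (k>n⇒nCk≡0 {0} {suc k} (s≤s z≤n))) (sym (^-zeroˡ (suc k))))
suc-binomial≤ (suc n) zero = ≤-reflexive (trans (cong suc (nC1≡n (suc n))) (sym (*-identityʳ (suc (suc n)))))
suc-binomial≤ (suc n) (suc k) = begin
  suc (suc n C suc (suc k))                ≡⟨ cong suc (nCk+nC[k+1]≡[n+1]C[k+1] n (suc k)) ⟨
  suc (n C suc k + n C suc (suc k))        ≤⟨ +-mono-≤ (suc-binomial≤ n k) (<⇒≤ (suc-binomial≤ n (suc k))) ⟩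
  suc n ^ suc k + suc n ^ suc (suc k)      ≡⟨⟩
  suc (suc n) * suc n ^ suc k              ≤⟨ *-monoʳ-≤ (suc (suc n)) (^-monoˡ-≤ (suc k) (n≤1+n (suc n))) ⟩
  suc (suc n) ^ suc (suc k)                ∎
  where open ≤-Reasoning

-- Fixing the least vertex of the star gives terms C(n-i, k-1) for i up to t, each short of C(n,
-- k-1) by at most i·C(n, k-2). The generous error t² lets the induction close by completing a
-- square.
star-length : ∀ t n b → t * (n C suc b) ≤ length (star t n (suc (suc b))) + t * t * (n C b)
star-length zero n b = z≤n
star-length (suc t) zero b = ≤-trans (≤-reflexive (trans (cong (suc t *_) (k>n⇒nCk≡0 {0} {suc b} (s≤s z≤n))) (*-zeroʳ t))) z≤n
star-length (suc t) (suc n) b = begin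
  suc t * (suc n C suc b)                                ≡⟨ cong (suc t *_) (nCk+nC[k+1]≡[n+1]C[k+1] n b) ⟨
  suc t * (x + y)                                        ≡⟨ expand t x y ⟩
  y + t * y + suc t * x                                  ≤⟨ +-monoˡ-≤ (suc t * x) (+-monoʳ-≤ y (star-length t n b)) ⟩
  y + (s + t * t * x) + suc t * x                        ≤⟨ m≤m+n _ (t * x) ⟩
  y + (s + t * t * x) + suc t * x + t * x                ≡⟨ collect t x y s ⟩
  y + s + suc t * suc t * x                              ≤⟨ +-monoʳ-≤ (y + s) (*-monoʳ-≤ (suc t * suc t) (binomial-mono n b)) ⟩
  y + s + suc t * suc t * (suc n C b)                    ≡⟨ cong (_+ suc t * suc t * (suc n C b)) len ⟨
  length (star (suc t) (suc n) (suc (suc b))) + suc t * suc t * (suc n C b) ∎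
  where
  open ≤-Reasoning
  x = n C b
  y = n C suc b
  s = length (star t n (suc (suc b)))
  len : length (star (suc t) (suc n) (suc (suc b))) ≡ y + s
  len = trans (length-++ (map (inside ∷_) (kSets n (suc b)))) (cong₂ _+_
    (trans (length-map _ (kSets n (suc b))) (length-kSets n (suc b))) (length-map _ (star t n (suc (suc b)))))
  expand : ∀ t x y → suc t * (x + y) ≡ y + t * y + suc t * x
  expand = solve-∀
  collect : ∀ t x y s → y + (s + t * t * x) + suc t * x + t * x ≡ y + s + suc t * suc t * x
  collect = solve-∀

n<2^n : ∀ n → n < 2 ^ n
n<2^n zero = ≤-refl
n<2^n (suc n) = ≤-trans (+-mono-≤ (≤-trans (s≤s z≤n) (n<2^n n)) (n<2^n n)) (≤-reflexive (cong (2 ^ n +_) (sym (+-identityʳ (2 ^ n)))))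

-- At exponent 2K+1 the bound splits into K ≤ 2^K and K+1 ≤ 2^(K+1) up to a factor 2; afterwards the
-- right side doubles while the left at most doubles.
linear≤exp : ∀ K d → K * suc (suc (2 * K) + d) ≤ 2 ^ (suc (2 * K) + d)
linear≤exp K zero = begin
  K * suc (suc (2 * K) + 0)    ≡⟨ expand K ⟩
  K * (2 * suc K)              ≤⟨ *-mono-≤ (<⇒≤ (n<2^n K)) (*-monoʳ-≤ 2 (n<2^n K)) ⟩
  2 ^ K * 2 ^ suc K            ≡⟨ ^-distribˡ-+-* 2 K (suc K) ⟨
  2 ^ (K + suc K)              ≡⟨ cong (2 ^_) (exponent K) ⟩
  2 ^ (suc (2 * K) + 0)        ∎
  where
  open ≤-Reasoning
  expand : ∀ K → K * suc (suc (2 * K) + 0) ≡ K * (2 * suc K)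
  expand = solve-∀
  exponent : ∀ K → K + suc K ≡ suc (2 * K) + 0
  exponent = solve-∀
linear≤exp K (suc d) = begin
  K * suc (g + suc d)                       ≡⟨ cong (λ z → K * suc z) (+-suc g d) ⟩
  K * suc (suc (g + d))                     ≤⟨ *-monoʳ-≤ K (+-monoˡ-≤ (suc (g + d)) (s≤s (z≤n {g + d}))) ⟩
  K * (suc (g + d) + suc (g + d))           ≡⟨ *-distribˡ-+ K (suc (g + d)) (suc (g + d)) ⟩
  K * suc (g + d) + K * suc (g + d)         ≤⟨ +-mono-≤ (linear≤exp K d) (linear≤exp K d) ⟩
  2 ^ (g + d) + 2 ^ (g + d)                 ≡⟨ cong (2 ^ (g + d) +_) (+-identityʳ (2 ^ (g + d))) ⟨
  2 ^ suc (g + d)                           ≡⟨ cong (2 ^_) (+-suc g d) ⟨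
  2 ^ (g + suc d)                           ∎
  where
  open ≤-Reasoning
  g = suc (2 * K)

-- The needed form of log n = o(n), without computing a logarithm: `g` is about as large as the
-- linear constraint permits, and then the other bound compares a linear with an exponential
-- function. Dividing by B + 1 keeps the divisor positive.
log-room : ∀ A B → ∃[ N ] (∀ n → N ≤ n → ∃[ g ] suc n ≤ 2 ^ g × A + B * g ≤ n)
log-room A B = A + suc B * suc (2 * K) , room
  where
  open ≤-Reasoning
  K = A + suc B
  room : ∀ n → A + suc B * suc (2 * K) ≤ n → ∃[ g ] suc n ≤ 2 ^ g × A + B * g ≤ n
  room n N≤n = g , suc-n≤ , ≤-trans (+-monoʳ-≤ A (*-monoˡ-≤ g (n≤1+n B))) below
    where
    r = n ∸ A
    g = r / suc B
    A≤n : A ≤ n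
    A≤n = ≤-trans (m≤m+n A _) N≤n
    A+r≡n : A + r ≡ n
    A+r≡n = m+[n∸m]≡n A≤n
    g₀≤g : suc (2 * K) ≤ g
    g₀≤g = begin
      suc (2 * K)                    ≡⟨ m*n/n≡m (suc (2 * K)) (suc B) ⟨
      suc (2 * K) * suc B / suc B    ≤⟨ /-monoˡ-≤ (suc B) (+-cancelˡ-≤ A _ _ (begin
        A + suc (2 * K) * suc B        ≡⟨ cong (A +_) (*-comm (suc (2 * K)) (suc B)) ⟩
        A + suc B * suc (2 * K)        ≤⟨ N≤n ⟩
        n                              ≡⟨ A+r≡n ⟨
        A + r                          ∎)) ⟩
      r / suc B                      ∎
    below : A + suc B * g ≤ n
    below = begin
      A + suc B * g   ≡⟨ cong (A +_) (*-comm (suc B) g) ⟩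
      A + g * suc B   ≤⟨ +-monoʳ-≤ A (m/n*n≤m r (suc B)) ⟩
      A + r           ≡⟨ A+r≡n ⟩
      n               ∎
    suc-n≤ : suc n ≤ 2 ^ g
    suc-n≤ = begin
      suc n                                   ≡⟨ cong suc A+r≡n ⟨
      suc (A + r)                             ≡⟨ +-suc A r ⟨
      A + suc r                               ≡⟨ cong (λ z → A + suc z) (m≡m%n+[m/n]*n r (suc B)) ⟩
      A + (suc (r % suc B) + g * suc B)       ≤⟨ +-monoʳ-≤ A (+-monoˡ-≤ (g * suc B) (m%n<n r (suc B))) ⟩
      A + (suc B + g * suc B)                 ≤⟨ m≤m+n _ (g * A) ⟩
      A + (suc B + g * suc B) + g * A         ≡⟨ collect A (suc B) g ⟩
      K * suc g                               ≡⟨ cong (λ z → K * suc z) (m+[n∸m]≡n g₀≤g) ⟨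
      K * suc (suc (2 * K) + (g ∸ suc (2 * K))) ≤⟨ linear≤exp K (g ∸ suc (2 * K)) ⟩
      2 ^ (suc (2 * K) + (g ∸ suc (2 * K)))   ≡⟨ cong (2 ^_) (m+[n∸m]≡n g₀≤g) ⟩
      2 ^ g                                   ∎
      where
      collect : ∀ a s g → a + (s + g * s) + g * a ≡ (a + s) * suc g
      collect = solve-∀

-- Error terms in the exponents and the choice of parameters.

half-parity : ∀ ℓ → 3 ≤ ℓ → ℓ ≡ 1 + 2 * ((ℓ ∸ 1) / 2) ⊎ ℓ ≡ 2 + 2 * ((ℓ ∸ 1) / 2)
half-parity (suc l) _ with l % 2 | m≡m%n+[m/n]*n l 2 | m%n<n l 2
... | 0 | eq | _ = inj₁ (cong suc (trans eq (*-comm (l / 2) 2)))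
... | 1 | eq | _ = inj₂ (cong suc (trans eq (cong suc (*-comm (l / 2) 2))))
... | suc (suc _) | _ | s≤s (s≤s ())

module _ {n b t m : ℕ} where

  -- The deficit t²·C(n, k-2) of the star is at most the fraction 1/m of t·C(n, k-1) once n ≥
  -- 2mt(k-1).
  lower-exponent : 1 ≤ m → m * t * (2 * suc b) ≤ n → 2 * b ≤ n →
    (m ∸ 1) * (t * (n C suc b)) ≤ length (star t n (suc (suc b))) * m
  lower-exponent 1≤m N≤n 2b≤n = +-cancelʳ-≤ (t * y) _ _ (begin
    (m ∸ 1) * (t * y) + t * y           ≡⟨ +-comm ((m ∸ 1) * (t * y)) (t * y) ⟩
    suc (m ∸ 1) * (t * y)               ≡⟨ cong (_* (t * y)) (m+[n∸m]≡n 1≤m) ⟩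
    m * (t * y)                         ≤⟨ *-monoʳ-≤ m (star-length t n b) ⟩
    m * (s + t * t * x)                 ≡⟨ split m s t x ⟩
    s * m + t * (m * t * x)             ≤⟨ +-monoʳ-≤ (s * m) (*-monoʳ-≤ t small) ⟩
    s * m + t * y                       ∎)
    where
    open ≤-Reasoning
    x = n C b
    y = n C suc b
    s = length (star t n (suc (suc b)))
    split : ∀ m s t x → m * (s + t * t * x) ≡ s * m + t * (m * t * x)
    split = solve-∀
    move : ∀ d q x → d * (q * x) ≡ q * d * x
    move = solve-∀
    small : m * t * x ≤ y
    small = *-cancelˡ-≤ (2 * suc b) (begin
      2 * suc b * (m * t * x)   ≡⟨ move (2 * suc b) (m * t) x ⟩
      m * t * (2 * suc b) * x   ≤⟨ *-monoˡ-≤ x N≤n ⟩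
      n * x                     ≤⟨ binomial-growth n b 2b≤n ⟩
      2 * suc b * y             ∎)

  -- All errors are multiples of n^b with b = k-2: the triples cost n³ ≤ n^b, a second use of k ≥ 5,
  -- and the exceptional edges cost g·k bits each. By the room for g their sum, times m, is at most
  -- n^(b+1)/D, which is at most C(n, b+1).
  upper-exponent : ∀ (K g : ℕ) → 3 ≤ b → 1 ≤ t → 1 ≤ n → 2 * suc b ≤ n →
    powConst (suc b) * (m * suc K) + powConst (suc b) * (m * (K * suc (suc b))) * g ≤ n →
    m * (n * (n * n) + (t * (n C suc b) + n ^ b * K + g * suc (suc b) * (n ^ b * K))) ≤ (m + 1) * (t * (n C suc b))
  upper-exponent K g 3≤b 1≤t 1≤n 2b≤n room = begin
    m * (n * (n * n) + (t * y + p * K + g * k * (p * K)))  ≤⟨ *-monoʳ-≤ m (+-monoˡ-≤ _ n³≤p) ⟩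
    m * (p + (t * y + p * K + g * k * (p * K)))            ≡⟨ split m p t y K g k ⟩
    m * (t * y) + p * (m * suc K + m * (K * k) * g)        ≤⟨ +-monoʳ-≤ (m * (t * y)) error≤ ⟩
    m * (t * y) + t * y                                    ≡⟨ join m (t * y) ⟩
    (m + 1) * (t * y)                                      ∎
    where
    open ≤-Reasoning
    y = n C suc b
    p = n ^ b
    k = suc (suc b)
    D = powConst (suc b)
    instance
      n≢0 : NonZero n
      n≢0 = >-nonZero 1≤n
      D≢0 : NonZero D
      D≢0 = >-nonZero (powConst>0 (suc b))
    split : ∀ m p t y K g k → m * (p + (t * y + p * K + g * k * (p * K))) ≡ m * (t * y) + p * (m * suc K + m * (K * k) * g)
    split = solve-∀
    join : ∀ m z → m * z + z ≡ (m + 1) * z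
    join = solve-∀
    n³≤p : n * (n * n) ≤ p
    n³≤p = ≤-trans (≤-reflexive (cong (λ z → n * (n * z)) (sym (*-identityʳ n)))) (^-monoʳ-≤ n 3≤b)
    move : ∀ d p e f g → d * (p * (e + f * g)) ≡ p * (d * e + d * f * g)
    move = solve-∀
    error≤ : p * (m * suc K + m * (K * k) * g) ≤ t * y
    error≤ = ≤-trans (*-cancelˡ-≤ D (begin
      D * (p * (m * suc K + m * (K * k) * g))          ≡⟨ move D p (m * suc K) (m * (K * k)) g ⟩
      p * (D * (m * suc K) + D * (m * (K * k)) * g)    ≤⟨ *-monoʳ-≤ p room ⟩
      p * n                                            ≡⟨ *-comm p n ⟩
      n ^ suc b                                        ≤⟨ n^b≤nCb n (suc b) 2b≤n ⟩
      D * y                                            ∎))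
      (≤-trans (≤-reflexive (sym (*-identityˡ y))) (*-monoˡ-≤ y 1≤t))

-- The sum of three demands on obstacle lists: closure under intersection, embedding of a cycle, and
-- the zigzag.
width : (k ℓ t : ℕ) → ℕ
width k ℓ t = k + k + (3 * ℓ + ℓ * k) + ((2 + 2 * t) + suc t * 2 ^ (2 + 2 * t) * k)

-- The o(1) is expressed by every rate 1/m, with both exponents multiplied by m so that only natural
-- numbers occur.
theorem1p1 : (k ℓ : ℕ) → 5 ≤ k → 3 ≤ ℓ →
    (m : ℕ) → 1 ≤ m →
    ∃[ N ] ((n c : ℕ) → N ≤ n → IsForb k ℓ n c →
    (2 ^ ((m ∸ 1) * (((ℓ ∸ 1) / 2) * (n C (k ∸ 1)))) ≤ c ^ m)
    × (c ^ m ≤ 2 ^ ((m + 1) * (((ℓ ∸ 1) / 2) * (n C (k ∸ 1))))))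
theorem1p1 1 _ (s≤s ())
theorem1p1 k@(suc (suc b)) ℓ 5≤k 3≤ℓ m 1≤m = N , bounds
  where
  open ≤-Reasoning
  t = (ℓ ∸ 1) / 2
  parity = half-parity ℓ 3≤ℓ
  w = width k ℓ t
  K = sparseConst k w
  D = powConst (suc b)
  room = log-room (D * (m * suc K)) (D * (m * (K * k)))
  -- The summands serve the choice of `g`, the deficit of the star, and the comparison of n^(k-1)
  -- with C(n, k-1); the successor ensures n ≥ 1.
  N = suc (proj₁ room + (m * t * (2 * suc b) + 2 * suc b))
  2t<ℓ : 2 * t < ℓ
  2t<ℓ = [ (λ e → ≤-reflexive (sym e)) , (λ e → ≤-trans (n≤1+n _) (≤-reflexive (sym e))) ]′ parity
  bounds : (n c : ℕ) → N ≤ n → IsForb k ℓ n c →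
    (2 ^ ((m ∸ 1) * (t * (n C suc b))) ≤ c ^ m) × (c ^ m ≤ 2 ^ ((m + 1) * (t * (n C suc b))))
  bounds n c N≤n forb = lower , upper
    where
    room≤ : proj₁ room ≤ n
    room≤ = ≤-trans (m≤m+n _ _) (≤-trans (n≤1+n _) N≤n)
    rest≤ : m * t * (2 * suc b) + 2 * suc b ≤ n
    rest≤ = ≤-trans (m≤n+m _ (proj₁ room)) (≤-trans (n≤1+n _) N≤n)
    mtb≤ : m * t * (2 * suc b) ≤ n
    mtb≤ = ≤-trans (m≤m+n _ _) rest≤
    2b≤ : 2 * suc b ≤ n
    2b≤ = ≤-trans (m≤n+m _ (m * t * (2 * suc b))) rest≤
    lower : 2 ^ ((m ∸ 1) * (t * (n C suc b))) ≤ c ^ m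
    lower = begin
      2 ^ ((m ∸ 1) * (t * (n C suc b)))      ≤⟨ ^-monoʳ-≤ 2 (lower-exponent {n} {b} {t} {m} 1≤m mtb≤ (≤-trans (*-monoʳ-≤ 2 (n≤1+n b)) 2b≤)) ⟩
      2 ^ (length (star t n k) * m)          ≡⟨ ^-*-assoc 2 (length (star t n k)) m ⟨
      (2 ^ length (star t n k)) ^ m          ≤⟨ ^-monoˡ-≤ m (forb-≥ {n} {k} {ℓ} {t} (s≤s z≤n) 2t<ℓ forb) ⟩
      c ^ m                                  ∎
    g = proj₁ (proj₂ room n room≤)
    s = n ^ b * K
    e = n * (n * n) + (t * (n C suc b) + s + g * k * s)
    c≤ : c ≤ 2 ^ e
    c≤ = begin
      c                                                                        ≤⟨ Count.forb-≤ {n} {k} {ℓ} {t} {w} 5≤k 3≤ℓ parity 2k≤w cyc≤w wide forb ⟩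
      2 ^ (n * (n * n)) * (2 ^ (t * (n C suc b) + s) * (suc (n C k) ^ s))      ≤⟨ *-monoʳ-≤ (2 ^ (n * (n * n))) (*-monoʳ-≤ (2 ^ (t * (n C suc b) + s)) (^-monoˡ-≤ s edge-choices)) ⟩
      2 ^ (n * (n * n)) * (2 ^ (t * (n C suc b) + s) * ((2 ^ (g * k)) ^ s))    ≡⟨ cong (λ z → 2 ^ (n * (n * n)) * (2 ^ (t * (n C suc b) + s) * z)) (^-*-assoc 2 (g * k) s) ⟩
      2 ^ (n * (n * n)) * (2 ^ (t * (n C suc b) + s) * 2 ^ (g * k * s))        ≡⟨ cong (2 ^ (n * (n * n)) *_) (^-distribˡ-+-* 2 (t * (n C suc b) + s) (g * k * s)) ⟨
      2 ^ (n * (n * n)) * 2 ^ (t * (n C suc b) + s + g * k * s)                ≡⟨ ^-distribˡ-+-* 2 (n * (n * n)) (t * (n C suc b) + s + g * k * s) ⟨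
      2 ^ e                                                                    ∎
      where
      2k≤w : k + k ≤ w
      2k≤w = ≤-trans (m≤m+n (k + k) _) (m≤m+n _ _)
      cyc≤w : 3 * ℓ + ℓ * k ≤ w
      cyc≤w = ≤-trans (m≤n+m (3 * ℓ + ℓ * k) (k + k)) (m≤m+n _ _)
      wide : (2 + 2 * t) + suc t * 2 ^ (2 + 2 * t) * k ≤ w
      wide = m≤n+m _ (k + k + (3 * ℓ + ℓ * k))
      edge-choices : suc (n C k) ≤ 2 ^ (g * k)
      edge-choices = begin
        suc (n C k)      ≤⟨ suc-binomial≤ n (suc b) ⟩
        suc n ^ k        ≤⟨ ^-monoˡ-≤ k (proj₁ (proj₂ (proj₂ room n room≤))) ⟩
        (2 ^ g) ^ k      ≡⟨ ^-*-assoc 2 g k ⟩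
        2 ^ (g * k)      ∎
    upper : c ^ m ≤ 2 ^ ((m + 1) * (t * (n C suc b)))
    upper = begin
      c ^ m                                  ≤⟨ ^-monoˡ-≤ m c≤ ⟩
      (2 ^ e) ^ m                            ≡⟨ ^-*-assoc 2 e m ⟩
      2 ^ (e * m)                            ≡⟨ cong (2 ^_) (*-comm e m) ⟩
      2 ^ (m * e)                            ≤⟨ ^-monoʳ-≤ 2 (upper-exponent {n} {b} {t} {m} K g (s≤s⁻¹ (s≤s⁻¹ 5≤k)) (m≥n⇒m/n>0 (∸-monoˡ-≤ 1 3≤ℓ)) (≤-trans (s≤s z≤n) N≤n) 2b≤ (proj₂ (proj₂ (proj₂ room n room≤)))) ⟩
      2 ^ ((m + 1) * (t * (n C suc b)))      ∎
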